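{- There is a randomized algorithm with one-sided error for the Hedge $k$-Cut problem running in time $$\binom{O(k\log n)+\ell}{\ell}\cdot n^{O(k)}\cdot m^{O(1)},$$ where, for an input consisting of a hedge graph $G$ and an integer $k\ge 2$, $\ell$ is the size of an optimum hedge $k$-cut-set of $G$, $n=|V(G)|$ is the number of vertices, and $m=|E(G)|$ is the number of hedges.
   Context: A hedge graph $G$ consists of a finite set $V(G)$ of vertices and a finite collection $E(G)$ of hedges; each hedge $e\in E(G)$ is a collection of pairwise disjoint subsets of $V(G)$, each of size at least $2$, called the components of $e$. Different hedges may have equal or overlapping components, and $m=|E(G)|$ need not be bounded in terms of $n=|V(G)|$. (Equivalently: a multigraph whose edge set is partitioned into groups called hedges; the components of a hedge are the vertex sets of the connected components of the graph spanned by its edges.) A hedge $k$-cut of $G$ is a partition of $V(G)$ into $k$ non-empty sets. A hedge $e$ is cut by it if some component of $e$ intersects at least two parts of the partition. The set of all hedges cut by a hedge $k$-cut is the hedge $k$-cut-set associated with it, and a set $C\subseteq E(G)$ is a hedge $k$-cut-set if it is associated with some hedge $k$-cut. An optimum hedge $k$-cut-set is a hedge $k$-cut-set of minimum size. Hedge $k$-Cut problem: given $G$ and $k$, find an optimum hedge $k$-cut-set (equivalently, for a given $\ell$, decide whether one can delete at most $\ell$ hedges so that the resulting graph has at least $k$ connected components). One-sided error means that any set the algorithm outputs is always a genuine hedge $k$-cut-set of $G$ (of the reported size), and with at least a constant positive probability the output is an optimum one; the error is only that an existing solution of the optimum size may be missed. $\log$ is the natural logarithm. The $O$-notation hides absolute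 constants: there is an absolute constant $c$ such that the bound holds with $O(k\log n)$ replaced by $\lfloor c\,k\log n\rfloor$, $n^{O(k)}$ by $c\cdot n^{ck}$, and $m^{O(1)}$ by $c\cdot(m+1)^{c}$. -}

module Defs where

open import Data.Bool using (Bool; true; false; if_then_else_)
open import Data.Fin using (Fin)
open import Data.Fin.Subset using (Subset; _∈_; _∩_; ∣_∣; Empty)
open import Data.Integer using (+_)
open import Data.List as List using (List; []; _∷_; [_])
open import Data.List.Relation.Unary.All using (All)
open import Data.List.Relation.Unary.AllPairs using (AllPairs)
open import Data.List.Relation.Unary.Any using (Any)
open import Data.Nat using (ℕ; zero; suc; _+_; _*_; _^_; _≤_; _<_; _≡ᵇ_)
open import Data.Product using (_×_; _,_; proj₂; ∃; ∃-syntax; Σ-syntax)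
open import Data.Rational as ℚ using (ℚ; _/_)
open import Data.Sum using (_⊎_)
open import Data.Vec as Vec using (Vec; []; _∷_)
open import Function using (_∘_; _⇔_; StrictlySurjective)
open import Relation.Binary.PropositionalEquality using (_≡_; _≢_)

------------------------------------------------------------------------
-- Hedge graphs and hedge k-cuts

record Hedge (n : ℕ) : Set where
  field
    components : List (Subset n)
    size≥2     : All (λ A → 2 ≤ ∣ A ∣) components
    disjoint   : AllPairs (λ A B → Empty (A ∩ B)) components

open Hedge public

record HedgeGraph : Set where
  field
    n m    : ℕ
    hedges : Vec (Hedge n) m

open HedgeGraph public

-- A partition of the vertices into k non-empty parts; part u is the part of u.
-- (The numbering of the parts is irrelevant to which hedges are cut.)

record KCut (G : HedgeGraph) (k : ℕ) : Set where
  field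
    part     : Fin (n G) → Fin k
    nonEmpty : StrictlySurjective _≡_ part

open KCut public

MeetsTwoParts : ∀ {n k} → (Fin n → Fin k) → Subset n → Set
MeetsTwoParts f A = ∃[ u ] ∃[ v ] u ∈ A × v ∈ A × f u ≢ f v

IsCutBy : ∀ {n k} → Hedge n → (Fin n → Fin k) → Set
IsCutBy e f = Any (MeetsTwoParts f) (components e)

IsKCutSet : (G : HedgeGraph) → ℕ → Subset (m G) → Set
IsKCutSet G k C =
  Σ[ P ∈ KCut G k ] (∀ i → i ∈ C ⇔ IsCutBy (Vec.lookup (hedges G) i) (part P))

IsOptimum : (G : HedgeGraph) → ℕ → Subset (m G) → Set
IsOptimum G k C = IsKCutSet G k C × (∀ D → IsKCutSet G k D → ∣ C ∣ ≤ ∣ D ∣)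

OptimumSize : HedgeGraph → ℕ → ℕ → Set
OptimumSize G k ℓ = ∃[ C ] IsOptimum G k C × ∣ C ∣ ≡ ℓ

------------------------------------------------------------------------
-- Randomized algorithms: Jones's WHILE language over binary trees, with an
-- additional instruction that tosses a fair coin.  Every instruction acts on
-- variables only and does a constant amount of work (trees being shared
-- pointers), so unit cost is polynomially related to Turing machine time.

data Tree : Set where
  nil  : Tree
  cons : Tree → Tree → Tree

hd tl : Tree → Tree
hd nil        = nil
hd (cons s _) = s
tl nil        = nil
tl (cons _ t) = t

Var : Set
Var = ℕ

data Expr : Set where
  nilᵉ  : Expr
  varᵉ  : Var → Expr
  consᵉ : Var → Var → Expr
  hdᵉ   : Var → Expr
  tlᵉ   : Var → Expr

infixr 4 _⨾_
infix  5 _≔_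

data Cmd : Set where
  _≔_   : Var → Expr → Cmd
  toss  : Var → Cmd
  _⨾_   : Cmd → Cmd → Cmd
  if    : Var → Cmd → Cmd → Cmd
  while : Var → Cmd → Cmd

Store : Set
Store = Var → Tree

_[_↦_] : Store → Var → Tree → Store
(σ [ x ↦ t ]) y = if y ≡ᵇ x then t else σ y

eval : Expr → Store → Tree
eval nilᵉ        σ = nil
eval (varᵉ x)    σ = σ x
eval (consᵉ x y) σ = cons (σ x) (σ y)
eval (hdᵉ x)     σ = hd (σ x)
eval (tlᵉ x)     σ = tl (σ x)

encodeBool : Bool → Tree
encodeBool false = nil
encodeBool true  = cons nil nil

-- The commands still to be executed, and the store.

Config : Set
Config = List Cmd × Store

-- One unit of time.  A fresh random bit is supplied at every step, but only
-- `toss` looks at it.  In tests, nil is false and every other tree is true.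

step : Bool → Config → Config
step b ([]              , σ) = [] , σ
step b ((x ≔ e)     ∷ K , σ) = K , σ [ x ↦ eval e σ ]
step b (toss x      ∷ K , σ) = K , σ [ x ↦ encodeBool b ]
step b ((c ⨾ d)     ∷ K , σ) = c ∷ d ∷ K , σ
step b (if x c d    ∷ K , σ) with σ x
... | nil      = d ∷ K , σ
... | cons _ _ = c ∷ K , σ
step b (while x c   ∷ K , σ) with σ x
... | nil      = K , σ
... | cons _ _ = c ∷ while x c ∷ K , σ

-- Input and output are passed in variable 0.

start : Cmd → Tree → Config
start c t = [ c ] , (λ _ → nil) [ 0 ↦ t ]

run : ∀ {N} → Config → Vec Bool N → Config
run γ []      = γ
run γ (b ∷ w) = run (step b γ) w

data Halted : Config → Set where
  halted : ∀ {σ} → Halted ([] , σ)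

output : Config → Tree
output γ = proj₂ γ 0

-- The number of steps made within the first N time units.

time : ∀ {N} → Config → Vec Bool N → ℕ
time γ             []      = 0
time ([]    , σ)   (b ∷ w) = 0
time (c ∷ K , σ)   (b ∷ w) = suc (time (step b (c ∷ K , σ)) w)

------------------------------------------------------------------------
-- Probability over uniformly random bit strings

∑ : ∀ N → (Vec Bool N → ℕ) → ℕ
∑ zero    f = f []
∑ (suc N) f = ∑ N (f ∘ (false ∷_)) + ∑ N (f ∘ (true ∷_))

-- The event E has probability at least p: it contains a set S of at least
-- p · 2ᴺ bit strings.  (S makes the count meaningful without deciding E.)

Pr≥ : ℚ → ∀ N → (Vec Bool N → Set) → Set
Pr≥ p N E =
  Σ[ S ∈ (Vec Bool N → Bool) ]
    (∀ w → S w ≡ true → E w) ×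
    p ℚ.* (+ (2 ^ N) / 1) ℚ.≤ + ∑ N (λ w → if S w then 1 else 0) / 1

-- E[min(τ,N)] ≤ B for every N, τ being the running time; by monotone
-- convergence this says E[τ] ≤ B.

ExpectedTime≤ : Config → ℕ → Set
ExpectedTime≤ γ B = ∀ N → ∑ N (time γ) ≤ B * 2 ^ N

AlwaysHalts : Config → Set
AlwaysHalts γ = ∃[ N ] (∀ (w : Vec Bool N) → Halted (run γ w))

------------------------------------------------------------------------
-- Encoding of inputs and outputs (numbers in unary)

encodeList : List Tree → Tree
encodeList []       = nil
encodeList (t ∷ ts) = cons t (encodeList ts)

encodeℕ : ℕ → Tree
encodeℕ zero    = nil
encodeℕ (suc i) = cons nil (encodeℕ i)

encodeSubset : ∀ {n} → Subset n → Tree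
encodeSubset = encodeList ∘ Vec.toList ∘ Vec.map encodeBool

encodeHedge : ∀ {n} → Hedge n → Tree
encodeHedge e = encodeList (List.map encodeSubset (components e))

encodeInput : HedgeGraph → ℕ → Tree
encodeInput G k =
  cons (encodeℕ (n G))
    (cons (encodeℕ k)
      (encodeList (Vec.toList (Vec.map encodeHedge (hedges G)))))

-- A set of hedges is output together with its size; nil means that no set
-- is output.

encodeResult : ∀ {m} → Subset m → Tree
encodeResult C = cons (encodeSubset C) (encodeℕ ∣ C ∣)

Outputs : ∀ {m} → Config → Subset m → Set
Outputs γ C = Halted γ × output γ ≡ encodeResult C

Sound : Cmd → HedgeGraph → ℕ → Set
Sound A G k = ∀ N (w : Vec Bool N) →
  let γ = run (start A (encodeInput G k)) w in
  Halted γ → output γ ≡ nil ⊎ (∃[ C ] Outputs γ C × IsKCutSet G k C)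

FindsOptimumWithin : ℕ → ℚ → Cmd → HedgeGraph → ℕ → Set
FindsOptimumWithin T p A G k =
  Pr≥ p T (λ w → ∃[ C ] Outputs (run (start A (encodeInput G k)) w) C × IsOptimum G k C)

------------------------------------------------------------------------
-- Natural logarithm

-- e ^ a ≤ x and x < e ^ a, where e is the supremum of the strictly
-- increasing sequence (1 + 1/i)ⁱ: compare x with (1 + 1/i)^(i a).

Exp≤ : ℕ → ℕ → Set
Exp≤ a x = ∀ i → suc i ^ (i * a) ≤ x * i ^ (i * a)

<Exp : ℕ → ℕ → Set
<Exp x a = ∃[ i ] x * i ^ (i * a) < suc i ^ (i * a)

-- L = ⌊ ln x ⌋

IsFloorLn : ℕ → ℕ → Set
IsFloorLn x L = Exp≤ L x × <Exp x (suc L)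

module Submission where

-- Call a hedge large if its contraction removes at least one of every 8k blocks
-- of the current contraction.  As long as there is a large hedge, the search
-- branches, deleting the hedge or contracting it.  A branch has at most ℓ
-- deletions and O(k log n) contractions of large hedges, so by Pascal's rule
-- there are at most C(O(k log n) + ℓ, ℓ) branches.  Without large hedges, a
-- random hedge is contracted.  Any k − 1 blocks can be isolated by a k-cut, so
-- their degrees sum up to at least the number ℓ′ of remaining hedges of an
-- optimum cut-set; since those hedges are not large, it follows that with N
-- blocks the hedges outside the cut-set together remove at least N ℓ′ / (8k)
-- blocks.  By Bernoulli's inequality a trial then follows an optimum cut from N
-- blocks on with probability at least N^(−16k).
--
-- Stage j = 0, 1, … makes n^(20k) trials with at most j deletions.  From stage ℓ
-- on, a stage takes at most L + 1 times as long as the one before, but fails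
-- with probability at most 1 / (2 (L + 1)), so the expected time is dominated by
-- that of stage ℓ.

open import Defs
open import Data.Bool using (Bool; true; false; if_then_else_; not; _∧_; _∨_; T)
open import Data.Empty using (⊥; ⊥-elim)
open import Data.Fin as Fin using (Fin; zero; suc)
import Data.Fin.Properties as Finₚ
open import Data.Fin.Subset using (Subset; inside; outside; _∈_; _∉_; _∪_; ∣_∣; Nonempty) renaming (⊥ to ∅)
open import Data.Fin.Subset.Properties using (_∈?_; _⊆?_; x∈p∪q⁻; x∈p∪q⁺; x∈p∩q⁺; ∉⊥; ∣p∣≤n)
import Data.Integer as ℤ
import Data.Integer.Properties as ℤₚ
open import Data.List as List using (List; []; _∷_; _++_; length)
open import Data.List.Membership.Propositional using (find) renaming (_∈_ to _∈ˡ_)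
open import Data.List.Membership.Propositional.Properties using (∈-allFin; ∈-map⁺; ∈-map⁻)
import Data.List.Properties as Listₚ
open import Data.List.Relation.Unary.All as All using (All; []; _∷_)
import Data.List.Relation.Unary.All.Properties as Allₚ
open import Data.List.Relation.Unary.AllPairs as AllPairs using (AllPairs; []; _∷_)
import Data.List.Relation.Unary.AllPairs.Properties as AllPairsₚ
open import Data.List.Relation.Unary.Any as Any using (Any; here; there)
import Data.List.Relation.Unary.Any.Properties as Anyₚ
open import Data.Maybe as Maybe using (Maybe; just; nothing)
open import Data.Nat
open import Data.Nat.Combinatorics using (_C_; nCn≡1; nCk≡nC[n∸k]; nCk+nC[k+1]≡[n+1]C[k+1])
open import Data.Nat.Properties
open import Data.Nat.Tactic.RingSolver using (solve-∀)
open import Data.Product using (_×_; _,_; proj₁; proj₂; ∃-syntax; Σ-syntax; Σ)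
open import Data.Rational as ℚ using (ℚ; 0ℚ; ½)
import Data.Rational.Properties as ℚₚ
import Data.Rational.Unnormalised as ℚᵘ
import Data.Rational.Unnormalised.Properties as ℚᵘₚ
open import Data.Sum using (_⊎_; inj₁; inj₂)
open import Data.Unit using (⊤; tt)
open import Data.Vec as Vec using (Vec; []; _∷_; lookup; here; there)
import Data.Vec.Properties as Vecₚ
open import Function using (_∘_; flip; id; StrictlySurjective; mk⇔; Equivalence)
open import Relation.Binary.PropositionalEquality
open import Relation.Nullary using (¬_; Dec; yes; no; does; contradiction)
open import Relation.Nullary.Decidable using (_×-dec_; ¬?)

-- A stage tosses all its bits before it searches. The search is then a deterministic function of
-- its tape, probabilities are counts of bit strings, and the program can be compiled from a total
-- language whose time bounds compose by rules. States of a level may share bits because only the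
-- branch that follows the optimum cut is analysed.
--
-- The number of large contractions is not limited by the program, which therefore computes no
-- logarithm. It is bounded in the analysis only: by the number of blocks for soundness and
-- termination, where no ℓ is given, and by L for the time.
--
-- Why hedges need this: an edge meets two blocks, so in a graph a large degree sum means many edges
-- and a small risk of hitting the cut. A hedge may meet all blocks, and a few hedges, perhaps all
-- of them cut, can make up the whole degree sum. Without large hedges, the cut ones account for at
-- most half of the blocks that all hedges together remove. The risk of a random contraction is then
-- paid for by the blocks that uncut hedges remove, and the potential N^(16k) balances the two.

-- A total language over trees with a cost semantics

data Tm : ℕ → Set where
  varᵗ  : ∀ {n} → Fin n → Tm n
  nilᵗ  : ∀ {n} → Tm n
  consᵗ : ∀ {n} → Tm n → Tm n → Tm n
  hdᵗ   : ∀ {n} → Tm n → Tm n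
  tlᵗ   : ∀ {n} → Tm n → Tm n
  ifᵗ   : ∀ {n} → Tm n → Tm n → Tm n → Tm n
  callᵗ : ∀ {n k} → Tm k → Vec (Tm n) k → Tm n
  -- foldᵗ l z b is a left fold; in b, variable 0 is the list element and
  -- variable 1 the accumulator.
  foldᵗ : ∀ {n} → Tm n → Tm n → Tm (2 + n) → Tm n

ifTree : ∀ {a} {A : Set a} → Tree → A → A → A
ifTree nil        t e = e
ifTree (cons _ _) t e = t

foldTree : (Tree → Tree → Tree) → Tree → Tree → Tree
foldTree g z nil         = z
foldTree g z (cons x xs) = foldTree g (g x z) xs

mutual
  ⟦_⟧ : ∀ {n} → Tm n → Vec Tree n → Tree
  ⟦ varᵗ i ⟧ ρ      = lookup ρ i
  ⟦ nilᵗ ⟧ ρ        = nil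
  ⟦ consᵗ e f ⟧ ρ   = cons (⟦ e ⟧ ρ) (⟦ f ⟧ ρ)
  ⟦ hdᵗ e ⟧ ρ       = hd (⟦ e ⟧ ρ)
  ⟦ tlᵗ e ⟧ ρ       = tl (⟦ e ⟧ ρ)
  ⟦ ifᵗ c t e ⟧ ρ   = ifTree (⟦ c ⟧ ρ) (⟦ t ⟧ ρ) (⟦ e ⟧ ρ)
  ⟦ callᵗ f es ⟧ ρ  = ⟦ f ⟧ (⟦ es ⟧* ρ)
  ⟦ foldᵗ l z b ⟧ ρ = foldTree (λ x a → ⟦ b ⟧ (x ∷ a ∷ ρ)) (⟦ z ⟧ ρ) (⟦ l ⟧ ρ)

  ⟦_⟧* : ∀ {n k} → Vec (Tm n) k → Vec Tree n → Vec Tree k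
  ⟦ [] ⟧*     ρ = []
  ⟦ e ∷ es ⟧* ρ = ⟦ e ⟧ ρ ∷ ⟦ es ⟧* ρ

-- The constants count steps of the compiled loop: a test, which is all that remains at the end, and
-- in each round the sequencing, the two assignments before the body and the one after it.
foldCost : (Tree → Tree → Tree) → (Tree → Tree → ℕ) → Tree → Tree → ℕ
foldCost g c z nil         = 1
foldCost g c z (cons x xs) = 6 + (c x z + suc (foldCost g c (g x z) xs))

mutual
  cost : ∀ {n} → Tm n → Vec Tree n → ℕ
  cost (varᵗ i)      ρ = 1
  cost nilᵗ          ρ = 1
  cost (consᵗ e f)   ρ = suc (cost e ρ + suc (cost f ρ + 1))
  cost (hdᵗ e)       ρ = suc (cost e ρ + 1)
  cost (tlᵗ e)       ρ = suc (cost e ρ + 1)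
  cost (ifᵗ c t e)   ρ = suc (cost c ρ + suc (ifTree (⟦ c ⟧ ρ) (cost t ρ) (cost e ρ)))
  cost (callᵗ f es)  ρ = suc (cost* es ρ + suc (cost f (⟦ es ⟧* ρ) + 1))
  cost (foldᵗ l z b) ρ =
    suc (cost l ρ + suc (cost z ρ + suc
      (foldCost (λ x a → ⟦ b ⟧ (x ∷ a ∷ ρ)) (λ x a → cost b (x ∷ a ∷ ρ)) (⟦ z ⟧ ρ) (⟦ l ⟧ ρ) + 1)))

  cost* : ∀ {n k} → Vec (Tm n) k → Vec Tree n → ℕ
  cost* []       ρ = 1
  cost* (e ∷ es) ρ = suc (cost e ρ + cost* es ρ)

-- Compilation

registers : Var → ∀ k → Vec Var k
registers d zero    = []
registers d (suc k) = d ∷ registers (suc d) k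

-- comp e π d leaves the value of e in register d, given the value of variable
-- i in register lookup π i, and may overwrite the registers from d on.
mutual
  comp : ∀ {n} → Tm n → Vec Var n → Var → Cmd
  comp (varᵗ i)      π d = d ≔ varᵉ (lookup π i)
  comp nilᵗ          π d = d ≔ nilᵉ
  comp (consᵗ e f)   π d = comp e π d ⨾ comp f π (suc d) ⨾ d ≔ consᵉ d (suc d)
  comp (hdᵗ e)       π d = comp e π d ⨾ d ≔ hdᵉ d
  comp (tlᵗ e)       π d = comp e π d ⨾ d ≔ tlᵉ d
  comp (ifᵗ c t e)   π d = comp c π d ⨾ if d (comp t π d) (comp e π d)
  comp (callᵗ {k = k} f es) π d =
    comp* es π d ⨾ comp f (registers d k) (d + k) ⨾ d ≔ varᵉ (d + k)
  comp (foldᵗ l z b) π d =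
    comp l π d ⨾ comp z π (suc d) ⨾ while d (foldBody b π d) ⨾ d ≔ varᵉ (suc d)

  -- Register `d` holds the rest of the list, `1 + d` the accumulator and `2 + d` the current
  -- element, so the body is free to use the registers from `3 + d` on.
  foldBody : ∀ {n} → Tm (2 + n) → Vec Var n → Var → Cmd
  foldBody b π d =
    2 + d ≔ hdᵉ d ⨾ d ≔ tlᵉ d ⨾ comp b (2 + d ∷ suc d ∷ π) (3 + d) ⨾ suc d ≔ varᵉ (3 + d)

  comp* : ∀ {n k} → Vec (Tm n) k → Vec Var n → Var → Cmd
  comp* []       π d = d ≔ nilᵉ
  comp* (e ∷ es) π d = comp e π d ⨾ comp* es π (suc d)

-- Only steps with the same outcome for both values of the random bit are allowed, so such a run can
-- be inserted into every statement about random runs. The number is an upper bound: `done` absorbs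
-- any slack.
data _⟶⟨_⟩_ : Config → ℕ → Config → Set where
  done : ∀ {γ t} → γ ⟶⟨ t ⟩ γ
  next : ∀ {c K σ γ γ′ t} → (∀ b → step b (c ∷ K , σ) ≡ γ) → γ ⟶⟨ t ⟩ γ′ →
         (c ∷ K , σ) ⟶⟨ suc t ⟩ γ′

⟶-mono : ∀ {γ γ′ s t} → γ ⟶⟨ s ⟩ γ′ → s ≤ t → γ ⟶⟨ t ⟩ γ′
⟶-mono done       _       = done
⟶-mono (next e r) (s≤s p) = next e (⟶-mono r p)

⟶-trans : ∀ {γ γ′ γ″ s t} → γ ⟶⟨ s ⟩ γ′ → γ′ ⟶⟨ t ⟩ γ″ → γ ⟶⟨ s + t ⟩ γ″
⟶-trans {s = s} {t} done r = ⟶-mono r (m≤n+m t s)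
⟶-trans (next e q)  r = next e (⟶-trans q r)

upd-same : ∀ σ x t → (σ [ x ↦ t ]) x ≡ t
upd-same σ x t with x ≡ᵇ x in eq
... | true  = refl
... | false = contradiction (subst Data.Bool.T eq (≡⇒≡ᵇ x x refl)) λ ()

upd-other : ∀ σ x t {y} → y ≢ x → (σ [ x ↦ t ]) y ≡ σ y
upd-other σ x t {y} y≢x with y ≡ᵇ x in eq
... | true  = contradiction (≡ᵇ⇒≡ y x (subst Data.Bool.T (sym eq) _)) y≢x
... | false = refl

step-if : ∀ {x c d K σ} b → step b (if x c d ∷ K , σ) ≡ (ifTree (σ x) c d ∷ K , σ)
step-if {x} {σ = σ} b with σ x
... | nil      = refl
... | cons _ _ = refl

step-while : ∀ {x c K σ} b →
  step b (while x c ∷ K , σ) ≡ (ifTree (σ x) (c ∷ while x c ∷ K) K , σ)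
step-while {x} {σ = σ} b with σ x
... | nil      = refl
... | cons _ _ = refl

record Holds {n} (π : Vec Var n) (ρ : Vec Tree n) (σ : Store) : Set where
  constructor mkHolds
  field holdsAt : ∀ i → σ (lookup π i) ≡ lookup ρ i
open Holds

record Below {n} (π : Vec Var n) (d : Var) : Set where
  constructor mkBelow
  field belowAt : ∀ i → lookup π i < d
open Below

-- The frame condition below `d` protects intermediate values: the value of one subterm waits in
-- register `d` while the next subterm is evaluated from `suc d` on.
Computes : Cmd → Store → Var → Tree → ℕ → Set
Computes c σ d v t =
  ∀ K → ∃[ σ′ ] (c ∷ K , σ) ⟶⟨ t ⟩ (K , σ′) × σ′ d ≡ v × (∀ {x} → x < d → σ′ x ≡ σ x)

below-suc : ∀ {n} {π : Vec Var n} {d} → Below π d → Below π (suc d)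
below-suc p = mkBelow λ i → m<n⇒m<1+n (belowAt p i)

holds-cong : ∀ {n} {π : Vec Var n} {ρ d σ σ′} → Below π d → Holds π ρ σ →
  (∀ {x} → x < d → σ′ x ≡ σ x) → Holds π ρ σ′
holds-cong p h q = mkHolds λ i → trans (q (belowAt p i)) (holdsAt h i)

assign-≡ : ∀ {e σ d v} → eval e σ ≡ v → Computes (d ≔ e) σ d v 1
assign-≡ {e} {σ} {d} {v} eq K = _ , next (λ _ → refl) done ,
  trans (upd-same σ d _) eq , λ x<d → upd-other σ d _ (<⇒≢ x<d)

seq-⟶ : ∀ {c₁ c₂ K σ σ₁ γ s t} → (c₁ ∷ c₂ ∷ K , σ) ⟶⟨ s ⟩ (c₂ ∷ K , σ₁) →
  (c₂ ∷ K , σ₁) ⟶⟨ t ⟩ γ → ((c₁ ⨾ c₂) ∷ K , σ) ⟶⟨ suc (s + t) ⟩ γ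
seq-⟶ p q = next (λ _ → refl) (⟶-trans p q)

registers-holds : ∀ {k} d (vs : Vec Tree k) (σ : Store) → (∀ i → σ (d + Fin.toℕ i) ≡ lookup vs i) →
  ∀ i → σ (lookup (registers d k) i) ≡ lookup vs i
registers-holds d (v ∷ vs) σ h zero    = trans (cong σ (sym (+-identityʳ d))) (h zero)
registers-holds d (v ∷ vs) σ h (suc i) =
  registers-holds (suc d) vs σ (λ j → trans (cong σ (sym (+-suc d _))) (h (suc j))) i

registers-below : ∀ d k i → lookup (registers d k) i < d + k
registers-below d (suc k) zero    = m<m+n d z<s
registers-below d (suc k) (suc i) =
  subst (lookup (registers (suc d) k) i <_) (sym (+-suc d k)) (registers-below (suc d) k i)

enter : Var → Store → Store
enter d σ = (σ [ 2 + d ↦ hd (σ d) ]) [ d ↦ tl ((σ [ 2 + d ↦ hd (σ d) ]) d) ]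

enter-other : ∀ d σ {y} → y ≢ d → y ≢ 2 + d → enter d σ y ≡ σ y
enter-other d σ p q = trans (upd-other (σ [ 2 + d ↦ hd (σ d) ]) d _ p) (upd-other σ (2 + d) _ q)

enter-below : ∀ d σ {y} → y < d → enter d σ y ≡ σ y
enter-below d σ y<d = enter-other d σ (<⇒≢ y<d) (<⇒≢ (m<n⇒m<1+n (m<n⇒m<1+n y<d)))

mutual
  comp-correct : ∀ {n} (e : Tm n) {π ρ d σ} → Below π d → Holds π ρ σ →
    Computes (comp e π d) σ d (⟦ e ⟧ ρ) (cost e ρ)
  comp-correct (varᵗ i) p h = assign-≡ (holdsAt h i)
  comp-correct nilᵗ     p h = assign-≡ refl
  comp-correct (consᵗ e f) {d = d} p h K
    with σ₁ , r₁ , v₁ , q₁ ← comp-correct e p h ((comp f _ (suc d) ⨾ d ≔ consᵉ d (suc d)) ∷ K)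
    with σ₂ , r₂ , v₂ , q₂ ← comp-correct f (below-suc p) (holds-cong p h q₁) ((d ≔ consᵉ d (suc d)) ∷ K)
    with σ₃ , r₃ , v₃ , q₃ ← assign-≡ {consᵉ d (suc d)} {σ₂} {d} refl K =
    σ₃ , seq-⟶ r₁ (seq-⟶ r₂ r₃) ,
    trans v₃ (cong₂ cons (trans (q₂ (n<1+n d)) v₁) v₂) ,
    λ x<d → trans (q₃ x<d) (trans (q₂ (m<n⇒m<1+n x<d)) (q₁ x<d))
  comp-correct (hdᵗ e) {d = d} p h K
    with σ₁ , r₁ , v₁ , q₁ ← comp-correct e p h ((d ≔ hdᵉ d) ∷ K)
    with σ₂ , r₂ , v₂ , q₂ ← assign-≡ {hdᵉ d} {σ₁} {d} refl K =
    σ₂ , seq-⟶ r₁ r₂ , trans v₂ (cong hd v₁) , λ x<d → trans (q₂ x<d) (q₁ x<d)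
  comp-correct (tlᵗ e) {d = d} p h K
    with σ₁ , r₁ , v₁ , q₁ ← comp-correct e p h ((d ≔ tlᵉ d) ∷ K)
    with σ₂ , r₂ , v₂ , q₂ ← assign-≡ {tlᵉ d} {σ₁} {d} refl K =
    σ₂ , seq-⟶ r₁ r₂ , trans v₂ (cong tl v₁) , λ x<d → trans (q₂ x<d) (q₁ x<d)
  comp-correct (ifᵗ c t e) {π} {ρ} {d} {σ} p h K
    with σ₁ , r₁ , v₁ , q₁ ← comp-correct c p h (if d (comp t π d) (comp e π d) ∷ K)
    with ⟦ c ⟧ ρ
  ... | nil
    with σ₂ , r₂ , v₂ , q₂ ← comp-correct e p (holds-cong p h q₁) K =
    σ₂ , seq-⟶ r₁ (next (λ b → trans (step-if b) (cong (λ v → ifTree v _ _ ∷ K , σ₁) v₁)) r₂) ,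
    v₂ , λ x<d → trans (q₂ x<d) (q₁ x<d)
  ... | cons _ _
    with σ₂ , r₂ , v₂ , q₂ ← comp-correct t p (holds-cong p h q₁) K =
    σ₂ , seq-⟶ r₁ (next (λ b → trans (step-if b) (cong (λ v → ifTree v _ _ ∷ K , σ₁) v₁)) r₂) ,
    v₂ , λ x<d → trans (q₂ x<d) (q₁ x<d)
  comp-correct (callᵗ {k = k} f es) {ρ = ρ} {d} p h K
    with σ₁ , r₁ , v₁ , q₁ ← comp*-correct es p h
                               ((comp f (registers d k) (d + k) ⨾ d ≔ varᵉ (d + k)) ∷ K)
    with σ₂ , r₂ , v₂ , q₂ ← comp-correct f (mkBelow (registers-below d k))
                               (mkHolds (registers-holds d (⟦ es ⟧* ρ) σ₁ v₁)) ((d ≔ varᵉ (d + k)) ∷ K)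
    with σ₃ , r₃ , v₃ , q₃ ← assign-≡ {varᵉ (d + k)} {σ₂} {d} refl K =
    σ₃ , seq-⟶ r₁ (seq-⟶ r₂ r₃) , trans v₃ v₂ ,
    λ x<d → trans (q₃ x<d) (trans (q₂ (≤-trans x<d (m≤m+n d k))) (q₁ x<d))
  comp-correct (foldᵗ l z b) {d = d} p h K
    with σ₁ , r₁ , v₁ , q₁ ← comp-correct l p h
                               ((comp z _ (suc d) ⨾ while d (foldBody b _ d) ⨾ d ≔ varᵉ (suc d)) ∷ K)
    with σ₂ , r₂ , v₂ , q₂ ← comp-correct z (below-suc p) (holds-cong p h q₁)
                               ((while d (foldBody b _ d) ⨾ d ≔ varᵉ (suc d)) ∷ K)
    with σ₃ , r₃ , v₃ , q₃ ← loop-correct b _ p (trans (q₂ (n<1+n d)) v₁) v₂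
                               (holds-cong p (holds-cong p h q₁) (λ x<d → q₂ (m<n⇒m<1+n x<d)))
                               ((d ≔ varᵉ (suc d)) ∷ K)
    with σ₄ , r₄ , v₄ , q₄ ← assign-≡ {varᵉ (suc d)} {σ₃} {d} refl K =
    σ₄ , seq-⟶ r₁ (seq-⟶ r₂ (seq-⟶ r₃ r₄)) , trans v₄ v₃ ,
    λ x<d → trans (q₄ x<d) (trans (q₃ x<d) (trans (q₂ (m<n⇒m<1+n x<d)) (q₁ x<d)))

  loop-correct : ∀ {n} (b : Tm (2 + n)) xs {π ρ d σ z} → Below π d →
    σ d ≡ xs → σ (suc d) ≡ z → Holds π ρ σ → ∀ K →
    let g = λ x a → ⟦ b ⟧ (x ∷ a ∷ ρ) in
    ∃[ σ′ ] (while d (foldBody b π d) ∷ K , σ) ⟶⟨ foldCost g (λ x a → cost b (x ∷ a ∷ ρ)) z xs ⟩ (K , σ′) ×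
            σ′ (suc d) ≡ foldTree g z xs × (∀ {x} → x < d → σ′ x ≡ σ x)
  loop-correct b nil {d = d} {σ} p e₁ e₂ h K =
    _ , next (λ w → trans (step-while w) (cong (λ v → ifTree v _ K , σ) e₁)) done , e₂ , λ _ → refl
  loop-correct b (cons x xs) {π} {ρ} {d} {σ} {z} p e₁ e₂ h K
    with σ₁ , r₁ , v₁ , q₁ ← comp-correct b {2 + d ∷ suc d ∷ π} {x ∷ z ∷ ρ} {3 + d} {enter d σ}
           (mkBelow λ { zero → n<1+n _ ; (suc zero) → m<n⇒m<1+n (n<1+n _)
              ; (suc (suc i)) → belowAt (below-suc (below-suc (below-suc p))) i })
           (mkHolds λ { zero → trans (upd-other (σ [ 2 + d ↦ hd (σ d) ]) d _ λ e → <⇒≢ (m<n⇒m<1+n (n<1+n d)) (sym e))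
                         (trans (upd-same σ (2 + d) _) (cong hd e₁))
              ; (suc zero) → trans (enter-other d σ (λ e → <⇒≢ (n<1+n d) (sym e)) (<⇒≢ (n<1+n (suc d)))) e₂
              ; (suc (suc i)) → trans (enter-below d σ (belowAt p i)) (holdsAt h i) })
           ((suc d ≔ varᵉ (3 + d)) ∷ while d (foldBody b π d) ∷ K)
    with σ₂ , r₂ , v₂ , q₂ ← loop-correct b xs {π} {ρ} {d} {σ₁ [ suc d ↦ σ₁ (3 + d) ]} p
           (trans (upd-other σ₁ (suc d) _ (<⇒≢ (n<1+n d)))
             (trans (q₁ (m<n⇒m<1+n (m<n⇒m<1+n (n<1+n d))))
               (trans (upd-same (σ [ 2 + d ↦ hd (σ d) ]) d _)
                 (cong tl (trans (upd-other σ (2 + d) _ (<⇒≢ (m<n⇒m<1+n (n<1+n d)))) e₁)))))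
           (trans (upd-same σ₁ (suc d) _) v₁)
           (mkHolds λ i → trans (upd-other σ₁ (suc d) _ (<⇒≢ (belowAt (below-suc p) i)))
                    (trans (q₁ (belowAt (below-suc (below-suc (below-suc p))) i))
                      (trans (enter-below d σ (belowAt p i)) (holdsAt h i))))
           K =
    σ₂ ,
    next (λ w → trans (step-while w) (cong (λ v → ifTree v _ K , σ) e₁))
      (next (λ _ → refl) (next (λ _ → refl) (next (λ _ → refl) (next (λ _ → refl)
        (next (λ _ → refl) (⟶-trans r₁ (next (λ _ → refl) r₂))))))) ,
    v₂ ,
    λ x<d → trans (q₂ x<d)
      (trans (upd-other σ₁ (suc d) _ (<⇒≢ (m<n⇒m<1+n x<d)))
        (trans (q₁ (m<n⇒m<1+n (m<n⇒m<1+n (m<n⇒m<1+n x<d)))) (enter-below d σ x<d)))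

  comp*-correct : ∀ {n k} (es : Vec (Tm n) k) {π ρ d σ} → Below π d → Holds π ρ σ → ∀ K →
    ∃[ σ′ ] (comp* es π d ∷ K , σ) ⟶⟨ cost* es ρ ⟩ (K , σ′) ×
            (∀ i → σ′ (d + Fin.toℕ i) ≡ lookup (⟦ es ⟧* ρ) i) × (∀ {x} → x < d → σ′ x ≡ σ x)
  comp*-correct [] {d = d} {σ} p h K = _ , next (λ _ → refl) done , (λ ()) , λ x<d → upd-other σ d _ (<⇒≢ x<d)
  comp*-correct (e ∷ es) {d = d} p h K
    with σ₁ , r₁ , v₁ , q₁ ← comp-correct e p h (comp* es _ (suc d) ∷ K)
    with σ₂ , r₂ , v₂ , q₂ ← comp*-correct es (below-suc p) (holds-cong p h q₁) K =
    σ₂ , seq-⟶ r₁ r₂ ,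
    (λ { zero → trans (cong σ₂ (+-identityʳ d)) (trans (q₂ (n<1+n d)) v₁)
       ; (suc i) → trans (cong σ₂ (+-suc d _)) (v₂ i) }) ,
    λ x<d → trans (q₂ (m<n⇒m<1+n x<d)) (q₁ x<d)

-- Time bounds

infixr 6 _⊕_
infixr 7 _⊗_

data Poly : Set where
  con     : ℕ → Poly
  size    : Poly
  _⊕_ _⊗_ : Poly → Poly → Poly

⟦_⟧ᵖ : Poly → ℕ → ℕ
⟦ con c ⟧ᵖ s = c
⟦ size ⟧ᵖ  s = s
⟦ p ⊕ q ⟧ᵖ s = ⟦ p ⟧ᵖ s + ⟦ q ⟧ᵖ s
⟦ p ⊗ q ⟧ᵖ s = ⟦ p ⟧ᵖ s * ⟦ q ⟧ᵖ s

-- Not the usual degree, but an exponent that bounds the polynomial by a single power of s for s ≥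
-- 2. A constant c costs c because c ≤ 2^c, and a sum costs one more factor because 2 ≤ s.
degree : Poly → ℕ
degree (con c) = c
degree size    = 1
degree (p ⊕ q) = suc (degree p + degree q)
degree (p ⊗ q) = degree p + degree q

n≤2^n : ∀ n → n ≤ 2 ^ n
n≤2^n zero    = z≤n
n≤2^n (suc n) = ≤-trans (+-mono-≤ (m^n>0 2 n) (n≤2^n n)) (≤-reflexive (cong (2 ^ n +_) (sym (+-identityʳ _))))

poly-bound : ∀ p {s} → 2 ≤ s → ⟦ p ⟧ᵖ s ≤ s ^ degree p
poly-bound (con c) 2≤s = ≤-trans (n≤2^n c) (^-monoˡ-≤ c 2≤s)
poly-bound size {s} 2≤s = ≤-reflexive (sym (*-identityʳ s))
poly-bound (p ⊗ q) {s} 2≤s = ≤-trans (*-mono-≤ (poly-bound p 2≤s) (poly-bound q 2≤s))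
  (≤-reflexive (sym (^-distribˡ-+-* s (degree p) (degree q))))
poly-bound (p ⊕ q) {suc zero} (s≤s ())
poly-bound (p ⊕ q) {suc (suc s)} 2≤s = begin
  ⟦ p ⟧ᵖ t + ⟦ q ⟧ᵖ t                ≤⟨ +-mono-≤ (poly-bound p 2≤s) (poly-bound q 2≤s) ⟩
  t ^ degree p + t ^ degree q        ≤⟨ +-mono-≤ (^-monoʳ-≤ t (m≤m+n (degree p) _)) (^-monoʳ-≤ t (m≤n+m (degree q) (degree p))) ⟩
  t ^ e + t ^ e                      ≤⟨ ≤-reflexive (cong (t ^ e +_) (sym (+-identityʳ _))) ⟩
  2 * t ^ e                          ≤⟨ *-monoˡ-≤ (t ^ e) 2≤s ⟩
  t ^ suc e                          ∎
  where
    open ≤-Reasoning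
    t = suc (suc s)
    e = degree p + degree q

-- The bound is polynomial in the size s of the instance, and linear in the
-- scale w + 1: the number of states or the number of trials.
record _⊢_⇓_⟨_∣_,_⟩ {n} (ρ : Vec Tree n) (e : Tm n) (v : Tree) (p : Poly) (s w : ℕ) : Set where
  constructor judge
  field
    value : ⟦ e ⟧ ρ ≡ v
    bound : cost e ρ ≤ ⟦ p ⟧ᵖ s * suc w

record _⊢*_⇓_⟨_∣_,_⟩ {n k} (ρ : Vec Tree n) (es : Vec (Tm n) k) (vs : Vec Tree k) (p : Poly) (s w : ℕ) : Set where
  constructor judge
  field
    value : ⟦ es ⟧* ρ ≡ vs
    bound : cost* es ρ ≤ ⟦ p ⟧ᵖ s * suc w

infix 3 _⊢_⇓_⟨_∣_,_⟩ _⊢*_⇓_⟨_∣_,_⟩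

c≤c*w : ∀ c w → c ≤ c * suc w
c≤c*w c w = m≤m*n c (suc w)

cost1 : ∀ {a} P c w → a ≤ P * suc w → a + c ≤ (P + c) * suc w
cost1 P c w p = ≤-trans (+-mono-≤ p (c≤c*w c w)) (≤-reflexive (sym (*-distribʳ-+ (suc w) P c)))

cost2 : ∀ {a b} P Q c w → a ≤ P * suc w → b ≤ Q * suc w → a + (b + c) ≤ (P + (Q + c)) * suc w
cost2 P Q c w p q = ≤-trans (+-mono-≤ p (cost1 Q c w q)) (≤-reflexive (sym (*-distribʳ-+ (suc w) P (Q + c))))

cost3 : ∀ {a b d} P Q R c w → a ≤ P * suc w → b ≤ Q * suc w → d ≤ R * suc w →
  a + (b + (d + c)) ≤ (P + (Q + (R + c))) * suc w
cost3 P Q R c w p q r =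
  ≤-trans (+-mono-≤ p (cost2 Q R c w q r)) (≤-reflexive (sym (*-distribʳ-+ (suc w) P (Q + (R + c)))))

module _ {n} {ρ : Vec Tree n} {s w : ℕ} where

  varR : ∀ i → ρ ⊢ varᵗ i ⇓ lookup ρ i ⟨ con 1 ∣ s , w ⟩
  varR i = judge refl (s≤s z≤n)

  nilR : ρ ⊢ nilᵗ ⇓ nil ⟨ con 1 ∣ s , w ⟩
  nilR = judge refl (s≤s z≤n)

  consR : ∀ {e f u v p q} → ρ ⊢ e ⇓ u ⟨ p ∣ s , w ⟩ → ρ ⊢ f ⇓ v ⟨ q ∣ s , w ⟩ →
    ρ ⊢ consᵗ e f ⇓ cons u v ⟨ p ⊕ q ⊕ con 3 ∣ s , w ⟩
  consR {e} {f} {p = p} {q} (judge refl b₁) (judge refl b₂) = judge refl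
    (≤-trans (≤-reflexive (eq (cost e ρ) (cost f ρ))) (cost2 (⟦ p ⟧ᵖ s) (⟦ q ⟧ᵖ s) 3 w b₁ b₂))
    where eq : ∀ a b → suc (a + suc (b + 1)) ≡ a + (b + 3)
          eq = solve-∀

  hdR : ∀ {e v p} → ρ ⊢ e ⇓ v ⟨ p ∣ s , w ⟩ → ρ ⊢ hdᵗ e ⇓ hd v ⟨ p ⊕ con 2 ∣ s , w ⟩
  hdR {e} {p = p} (judge refl b) = judge refl
    (≤-trans (≤-reflexive (sym (+-suc (cost e ρ) 1))) (cost1 (⟦ p ⟧ᵖ s) 2 w b))

  tlR : ∀ {e v p} → ρ ⊢ e ⇓ v ⟨ p ∣ s , w ⟩ → ρ ⊢ tlᵗ e ⇓ tl v ⟨ p ⊕ con 2 ∣ s , w ⟩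
  tlR {e} {p = p} (judge refl b) = judge refl
    (≤-trans (≤-reflexive (sym (+-suc (cost e ρ) 1))) (cost1 (⟦ p ⟧ᵖ s) 2 w b))

  ifR : ∀ {c t e x v p q r} → ρ ⊢ c ⇓ x ⟨ p ∣ s , w ⟩ →
    (x ≢ nil → ρ ⊢ t ⇓ v ⟨ q ∣ s , w ⟩) → (x ≡ nil → ρ ⊢ e ⇓ v ⟨ r ∣ s , w ⟩) →
    ρ ⊢ ifᵗ c t e ⇓ v ⟨ p ⊕ q ⊕ r ⊕ con 2 ∣ s , w ⟩
  ifR {c} {t} {e} {nil} {p = p} {q} {r} (judge e₁ b) th el with judge refl b′ ← el refl = judge
    (cong (λ y → ifTree y (⟦ t ⟧ ρ) (⟦ e ⟧ ρ)) e₁)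
    (≤-trans (≤-reflexive (trans (cong (λ y → suc (cost c ρ + suc (ifTree y (cost t ρ) (cost e ρ)))) e₁)
                                 (eq (cost c ρ) (cost e ρ))))
             (cost3 (⟦ p ⟧ᵖ s) (⟦ q ⟧ᵖ s) (⟦ r ⟧ᵖ s) 2 w b z≤n b′))
    where eq : ∀ a b → suc (a + suc b) ≡ a + (0 + (b + 2))
          eq = solve-∀
  ifR {c} {t} {e} {cons _ _} {p = p} {q} {r} (judge e₁ b) th el with judge refl b′ ← th (λ ()) = judge
    (cong (λ y → ifTree y (⟦ t ⟧ ρ) (⟦ e ⟧ ρ)) e₁)
    (≤-trans (≤-reflexive (trans (cong (λ y → suc (cost c ρ + suc (ifTree y (cost t ρ) (cost e ρ)))) e₁)
                                 (eq (cost c ρ) (cost t ρ))))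
             (cost3 (⟦ p ⟧ᵖ s) (⟦ q ⟧ᵖ s) (⟦ r ⟧ᵖ s) 2 w b b′ z≤n))
    where eq : ∀ a b → suc (a + suc b) ≡ a + (b + (0 + 2))
          eq = solve-∀

  []R : ρ ⊢* [] ⇓ [] ⟨ con 1 ∣ s , w ⟩
  []R = judge refl (s≤s z≤n)

  infixr 5 _∷R_
  _∷R_ : ∀ {k e v p} {es : Vec (Tm n) k} {vs q} → ρ ⊢ e ⇓ v ⟨ p ∣ s , w ⟩ →
    ρ ⊢* es ⇓ vs ⟨ q ∣ s , w ⟩ → ρ ⊢* (e ∷ es) ⇓ (v ∷ vs) ⟨ p ⊕ q ⊕ con 1 ∣ s , w ⟩
  _∷R_ {e = e} {p = p} {es} {q = q} (judge refl b₁) (judge refl b₂) = judge refl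
    (≤-trans (≤-reflexive (eq (cost e ρ) (cost* es ρ))) (cost2 (⟦ p ⟧ᵖ s) (⟦ q ⟧ᵖ s) 1 w b₁ b₂))
    where eq : ∀ a b → suc (a + b) ≡ a + (b + 1)
          eq = solve-∀

  callR : ∀ {k} {f : Tm k} {es : Vec (Tm n) k} {vs v p q} → ρ ⊢* es ⇓ vs ⟨ p ∣ s , w ⟩ →
    vs ⊢ f ⇓ v ⟨ q ∣ s , w ⟩ → ρ ⊢ callᵗ f es ⇓ v ⟨ p ⊕ q ⊕ con 3 ∣ s , w ⟩
  callR {f = f} {es} {p = p} {q} (judge refl b₁) (judge refl b₂) = judge refl
    (≤-trans (≤-reflexive (eq (cost* es ρ) _)) (cost2 (⟦ p ⟧ᵖ s) (⟦ q ⟧ᵖ s) 3 w b₁ b₂))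
    where eq : ∀ a b → suc (a + suc (b + 1)) ≡ a + (b + 3)
          eq = solve-∀

  castR : ∀ {e u v p} → u ≡ v → ρ ⊢ e ⇓ u ⟨ p ∣ s , w ⟩ → ρ ⊢ e ⇓ v ⟨ p ∣ s , w ⟩
  castR refl d = d

foldr-inv : ∀ {A B : Set} (P : A → Set) (I : B → Set) (g : A → B → B) →
  (∀ {x y} → P x → I y → I (g x y)) → ∀ {xs z} → All P xs → I z → I (List.foldr g z xs)
foldr-inv P I g inv []       iz = iz
foldr-inv P I g inv (p ∷ ps) iz = inv p (foldr-inv P I g inv ps iz)

-- A fold is judged round by round, with the actual accumulators as indices, so that each round may
-- use whatever is known about the accumulator at that time.
data Loop {n} (ρ : Vec Tree n) (b : Tm (2 + n)) (r : Poly) (s w : ℕ) : List Tree → Tree → Tree → Set where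
  []  : ∀ {a} → Loop ρ b r s w [] a a
  _∷_ : ∀ {t ts a a₁ a′} → (t ∷ a ∷ ρ) ⊢ b ⇓ a₁ ⟨ r ∣ s , w ⟩ → Loop ρ b r s w ts a₁ a′ →
        Loop ρ b r s w (t ∷ ts) a a′

module _ {n} {ρ : Vec Tree n} {b : Tm (2 + n)} {r : Poly} {s w : ℕ} where

  loop-value : ∀ {ts a a′} → Loop ρ b r s w ts a a′ →
    foldTree (λ x y → ⟦ b ⟧ (x ∷ y ∷ ρ)) a (encodeList ts) ≡ a′
  loop-value []                 = refl
  loop-value (judge refl _ ∷ l) = loop-value l

  loop-cost : ∀ {ts a a′} → Loop ρ b r s w ts a a′ →
    foldCost (λ x y → ⟦ b ⟧ (x ∷ y ∷ ρ)) (λ x y → cost b (x ∷ y ∷ ρ)) a (encodeList ts) ≤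
    (⟦ r ⟧ᵖ s + 7) * (length ts * suc w) + 1
  loop-cost [] = m≤n+m 1 _
  loop-cost {t ∷ ts} {a} (judge refl c ∷ l) = begin
    6 + (cost b (t ∷ a ∷ ρ) + suc (foldCost _ _ _ (encodeList ts)))  ≤⟨ +-monoʳ-≤ 6 (+-mono-≤ c (s≤s (loop-cost l))) ⟩
    6 + (R * suc w + suc ((R + 7) * (length ts * suc w) + 1))        ≤⟨ m≤m+n _ (7 * w) ⟩
    6 + (R * suc w + suc ((R + 7) * (length ts * suc w) + 1)) + 7 * w ≡⟨ eq R w (length ts) ⟩
    (R + 7) * (suc (length ts) * suc w) + 1                          ∎
    where
      open ≤-Reasoning
      R = ⟦ r ⟧ᵖ s
      eq : ∀ R w k → 6 + (R * suc w + suc ((R + 7) * (k * suc w) + 1)) + 7 * w ≡ (R + 7) * (suc k * suc w) + 1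
      eq = solve-∀

  loop-end : ∀ {ts a a₁ a₂} → a₁ ≡ a₂ → Loop ρ b r s w ts a a₁ → Loop ρ b r s w ts a a₂
  loop-end refl l = l

  loop-∷ʳ : ∀ {ts t a a₁ a′} → Loop ρ b r s w ts a a₁ → (t ∷ a₁ ∷ ρ) ⊢ b ⇓ a′ ⟨ r ∣ s , w ⟩ →
    Loop ρ b r s w (ts List.∷ʳ t) a a′
  loop-∷ʳ []      d = d ∷ []
  loop-∷ʳ (e ∷ l) d = e ∷ loop-∷ʳ l d

  loop-foldl : ∀ {A B : Set} (encA : A → Tree) (encB : B → Tree) (P : A → Set) (I : B → Set) (g : B → A → B) →
    (∀ {x y} → P x → I y → (encA x ∷ encB y ∷ ρ) ⊢ b ⇓ encB (g y x) ⟨ r ∣ s , w ⟩) →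
    (∀ {x y} → P x → I y → I (g y x)) → ∀ {xs z} → All P xs → I z →
    Loop ρ b r s w (List.map encA xs) (encB z) (encB (List.foldl g z xs))
  loop-foldl encA encB P I g body inv []       iz = []
  loop-foldl encA encB P I g body inv (p ∷ ps) iz =
    body p iz ∷ loop-foldl encA encB P I g body inv ps (inv p iz)

  -- The language folds from the left only. Over the reversed list it performs the right folds in
  -- which most of the search is written.
  loop-foldr : ∀ {A B : Set} (encA : A → Tree) (encB : B → Tree) (P : A → Set) (I : B → Set) (g : A → B → B) →
    (∀ {x y} → P x → I y → (encA x ∷ encB y ∷ ρ) ⊢ b ⇓ encB (g x y) ⟨ r ∣ s , w ⟩) →
    (∀ {x y} → P x → I y → I (g x y)) → ∀ {xs z} → All P xs → I z →
    Loop ρ b r s w (List.reverse (List.map encA xs)) (encB z) (encB (List.foldr g z xs))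
  loop-foldr encA encB P I g body inv [] iz = []
  loop-foldr encA encB P I g body inv {x ∷ xs} (p ∷ ps) iz =
    subst (λ ts → Loop ρ b r s w ts _ _) (sym (Listₚ.unfold-reverse (encA x) (List.map encA xs)))
      (loop-∷ʳ (loop-foldr encA encB P I g body inv ps iz) (body p (foldr-inv P I g inv ps iz)))

  loop-count : (f : ℕ → Tree) {N : ℕ} → (∀ i → i < N → (nil ∷ f i ∷ ρ) ⊢ b ⇓ f (suc i) ⟨ r ∣ s , w ⟩) →
    ∀ k i → k + i ≤ N → Loop ρ b r s w (List.replicate k nil) (f i) (f (k + i))
  loop-count f body zero    i le = []
  loop-count f body (suc k) i le =
    body i (≤-trans (s≤s (m≤n+m i k)) le) ∷
    loop-end (cong f (+-suc k i)) (loop-count f body k (suc i) (≤-trans (≤-reflexive (+-suc k i)) le))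

foldR : ∀ {n} {ρ : Vec Tree n} {l z b ts a a′ p q r s w} (lp : Poly) {w₁} →
  ρ ⊢ l ⇓ encodeList ts ⟨ p ∣ s , w ⟩ → ρ ⊢ z ⇓ a ⟨ q ∣ s , w ⟩ →
  length ts * suc w₁ ≤ ⟦ lp ⟧ᵖ s * suc w → Loop ρ b r s w₁ ts a a′ →
  ρ ⊢ foldᵗ l z b ⇓ a′ ⟨ p ⊕ q ⊕ ((r ⊕ con 7) ⊗ lp) ⊕ con 5 ∣ s , w ⟩
foldR {ρ = ρ} {l} {z} {b} {ts} {p = p} {q} {r} {s} {w} lp {w₁} (judge e₁ b₁) (judge refl b₂) len it = judge
  (trans (cong (foldTree _ _) e₁) (loop-value it))
  (≤-trans
    (≤-trans (≤-reflexive (cong (λ t → suc (cost l ρ + suc (cost z ρ + suc (foldCost _ _ _ t + 1)))) e₁))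
      (≤-trans (s≤s (+-monoʳ-≤ (cost l ρ) (s≤s (+-monoʳ-≤ (cost z ρ) (s≤s (+-monoˡ-≤ 1 (loop-cost it)))))))
        (≤-reflexive (eq (cost l ρ) (cost z ρ) _))))
    (cost3 (⟦ p ⟧ᵖ s) (⟦ q ⟧ᵖ s) ((⟦ r ⟧ᵖ s + 7) * ⟦ lp ⟧ᵖ s) 5 w b₁ b₂
      (≤-trans (*-monoʳ-≤ (⟦ r ⟧ᵖ s + 7) len) (≤-reflexive (sym (*-assoc (⟦ r ⟧ᵖ s + 7) _ (suc w)))))))
  where eq : ∀ a b c → suc (a + suc (b + suc (c + 1 + 1))) ≡ a + (b + (c + 5))
        eq = solve-∀

revᵗ : Tm 1
revᵗ = foldᵗ (varᵗ zero) nilᵗ (consᵗ (varᵗ zero) (varᵗ (suc zero)))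

rev-loop : ∀ {n} {ρ : Vec Tree n} {s w} ts us →
  Loop ρ (consᵗ (varᵗ zero) (varᵗ (suc zero))) (con 1 ⊕ con 1 ⊕ con 3) s w ts (encodeList us) (encodeList (ts List.ʳ++ us))
rev-loop []       us = []
rev-loop (t ∷ ts) us = consR (varR zero) (varR (suc zero)) ∷ rev-loop ts (t ∷ us)

revR : ∀ {n} {ρ : Vec Tree n} {l ts p s w} (lp : Poly) → ρ ⊢ l ⇓ encodeList ts ⟨ p ∣ s , w ⟩ →
  length ts ≤ ⟦ lp ⟧ᵖ s * suc w →
  ρ ⊢ callᵗ revᵗ (l ∷ []) ⇓ encodeList (List.reverse ts) ⟨ _ ∣ s , w ⟩
revR {ts = ts} lp d len = callR (d ∷R []R)
  (foldR lp {0} (varR zero) nilR (≤-trans (≤-reflexive (*-identityʳ _)) len) (rev-loop ts []))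

foldrR : ∀ {n} {ρ : Vec Tree n} {l z b ts a a′ p q r s w} (lp : Poly) {w₁} →
  ρ ⊢ l ⇓ encodeList ts ⟨ p ∣ s , w ⟩ → ρ ⊢ z ⇓ a ⟨ q ∣ s , w ⟩ →
  length ts * suc w₁ ≤ ⟦ lp ⟧ᵖ s * suc w → Loop ρ b r s w₁ (List.reverse ts) a a′ →
  ρ ⊢ foldᵗ (callᵗ revᵗ (l ∷ [])) z b ⇓ a′ ⟨ _ ∣ s , w ⟩
foldrR {ts = ts} lp {w₁} d e len it =
  foldR lp (revR lp d (≤-trans (m≤m*n (length ts) (suc w₁)) len)) e
    (subst (λ k → k * suc w₁ ≤ _) (sym (Listₚ.length-reverse ts)) len) it

-- Finite sums over lists

Σˡ : ∀ {A : Set} → List A → (A → ℕ) → ℕ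
Σˡ []       f = 0
Σˡ (x ∷ xs) f = f x + Σˡ xs f

⟨_⟩ : Bool → ℕ
⟨ b ⟩ = if b then 1 else 0

module _ {A : Set} where

  Σˡ-cong : ∀ {f g : A → ℕ} xs → (∀ x → f x ≡ g x) → Σˡ xs f ≡ Σˡ xs g
  Σˡ-cong []       e = refl
  Σˡ-cong (x ∷ xs) e = cong₂ _+_ (e x) (Σˡ-cong xs e)

  Σˡ-mono : ∀ {f g : A → ℕ} xs → (∀ {x} → x ∈ˡ xs → f x ≤ g x) → Σˡ xs f ≤ Σˡ xs g
  Σˡ-mono []       e = z≤n
  Σˡ-mono (x ∷ xs) e = +-mono-≤ (e (here refl)) (Σˡ-mono xs (e ∘ there))

  Σˡ-0 : ∀ (xs : List A) → Σˡ xs (λ _ → 0) ≡ 0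
  Σˡ-0 []       = refl
  Σˡ-0 (x ∷ xs) = Σˡ-0 xs

  Σˡ-1 : ∀ (xs : List A) → Σˡ xs (λ _ → 1) ≡ length xs
  Σˡ-1 []       = refl
  Σˡ-1 (x ∷ xs) = cong suc (Σˡ-1 xs)

  Σˡ-+ : ∀ xs (f g : A → ℕ) → Σˡ xs (λ x → f x + g x) ≡ Σˡ xs f + Σˡ xs g
  Σˡ-+ []       f g = refl
  Σˡ-+ (x ∷ xs) f g rewrite Σˡ-+ xs f g = eq (f x) (g x) (Σˡ xs f) (Σˡ xs g)
    where eq : ∀ a b c d → a + b + (c + d) ≡ a + c + (b + d)
          eq = solve-∀

  Σˡ-* : ∀ xs c (f : A → ℕ) → Σˡ xs (λ x → c * f x) ≡ c * Σˡ xs f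
  Σˡ-* []       c f = sym (*-zeroʳ c)
  Σˡ-* (x ∷ xs) c f = trans (cong (c * f x +_) (Σˡ-* xs c f)) (sym (*-distribˡ-+ c (f x) _))

  Σˡ-++ : ∀ xs ys (f : A → ℕ) → Σˡ (xs ++ ys) f ≡ Σˡ xs f + Σˡ ys f
  Σˡ-++ []       ys f = refl
  Σˡ-++ (x ∷ xs) ys f = trans (cong (f x +_) (Σˡ-++ xs ys f)) (sym (+-assoc (f x) _ _))

  Σˡ-swap : ∀ {B : Set} (xs : List A) (ys : List B) (f : A → B → ℕ) →
    Σˡ xs (λ x → Σˡ ys (f x)) ≡ Σˡ ys (λ y → Σˡ xs (λ x → f x y))
  Σˡ-swap []       ys f = sym (lem ys)
    where lem : ∀ {B : Set} (ys : List B) → Σˡ ys (λ _ → 0) ≡ 0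
          lem []       = refl
          lem (_ ∷ ys) = lem ys
  Σˡ-swap {B} (x ∷ xs) ys f = trans (cong (Σˡ ys (f x) +_) (Σˡ-swap xs ys f)) (lem ys)
    where
      g : B → ℕ
      g y = Σˡ xs (λ x → f x y)
      lem : ∀ ys → Σˡ ys (f x) + Σˡ ys g ≡ Σˡ ys (λ y → f x y + g y)
      lem []       = refl
      lem (y ∷ ys) = trans (eq (f x y) (Σˡ ys (f x)) (g y) (Σˡ ys g)) (cong (f x y + g y +_) (lem ys))
        where eq : ∀ a b c d → a + b + (c + d) ≡ a + c + (b + d)
              eq = solve-∀

  Σˡ-member : ∀ {xs x} (f : A → ℕ) → x ∈ˡ xs → f x ≤ Σˡ xs f
  Σˡ-member f (here refl) = m≤m+n _ _
  Σˡ-member f (there x∈)  = ≤-trans (Σˡ-member f x∈) (m≤n+m _ _)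

  Σˡ-two : ∀ {xs x y} (f : A → ℕ) → x ∈ˡ xs → y ∈ˡ xs → x ≢ y → f x + f y ≤ Σˡ xs f
  Σˡ-two f (here refl) (here refl) x≢y = contradiction refl x≢y
  Σˡ-two f (here refl) (there y∈)  x≢y = +-monoʳ-≤ _ (Σˡ-member f y∈)
  Σˡ-two {x = x} f (there x∈)  (here refl) x≢y = ≤-trans (≤-reflexive (+-comm (f x) _)) (+-monoʳ-≤ _ (Σˡ-member f x∈))
  Σˡ-two f (there x∈)  (there y∈)  x≢y = ≤-trans (Σˡ-two f x∈ y∈ x≢y) (m≤n+m _ _)

  Σˡ-positive : ∀ xs (f : A → ℕ) → 1 ≤ Σˡ xs f → ∃[ x ] x ∈ˡ xs × 1 ≤ f x
  Σˡ-positive (x ∷ xs) f p with f x in eq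
  ... | suc _ = x , here refl , subst (1 ≤_) (sym eq) (s≤s z≤n)
  ... | zero  with y , y∈ , q ← Σˡ-positive xs f p = y , there y∈ , q

⟨⟩≤1 : ∀ b → ⟨ b ⟩ ≤ 1
⟨⟩≤1 true  = ≤-refl
⟨⟩≤1 false = z≤n

⟨⟩-of-true : ∀ {b} → b ≡ true → 1 ≤ ⟨ b ⟩
⟨⟩-of-true refl = ≤-refl

-- Merging blocks

meets : ∀ {n} → Subset n → Subset n → Bool
meets []      []      = false
meets (a ∷ A) (b ∷ B) = (a ∧ b) ∨ meets A B

mergeStep : ∀ {n} → Subset n → Subset n → Subset n × List (Subset n) → Subset n × List (Subset n)
mergeStep A B (U , Os) = if meets A B then (U ∪ B , Os) else (U , B ∷ Os)

mergeParts : ∀ {n} → List (Subset n) → Subset n → Subset n × List (Subset n)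
mergeParts bl A = List.foldr (mergeStep A) (A , []) bl

-- The new block comes first. `cutTest-cut` relies on this position, where the block serves as the
-- part that `isolate` leaves over.
merge : ∀ {n} → List (Subset n) → Subset n → List (Subset n)
merge bl A = proj₁ (mergeParts bl A) ∷ proj₂ (mergeParts bl A)

contract : ∀ {n} → List (Subset n) → List (Subset n) → List (Subset n)
contract = List.foldl merge

meets-elim : ∀ {n} (A B : Subset n) → meets A B ≡ true → ∃[ u ] u ∈ A × u ∈ B
meets-elim [] [] ()
meets-elim (true  ∷ A) (true  ∷ B) e = zero , here , here
meets-elim (true  ∷ A) (false ∷ B) e with u , p , q ← meets-elim A B e = suc u , there p , there q
meets-elim (false ∷ A) (b     ∷ B) e with u , p , q ← meets-elim A B e = suc u , there p , there q

meets-intro : ∀ {n} {A B : Subset n} {u} → u ∈ A → u ∈ B → meets A B ≡ true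
meets-intro here here = refl
meets-intro {A = a ∷ A} {b ∷ B} (there p) (there q) rewrite meets-intro p q with a ∧ b
... | true  = refl
... | false = refl

module _ {n : ℕ} where

  Disjoint : Subset n → Subset n → Set
  Disjoint A B = ∀ {u} → u ∈ A → u ∈ B → ⊥

  record IsPartition (bl : List (Subset n)) : Set where
    field
      covers   : ∀ u → ∃[ B ] B ∈ˡ bl × u ∈ B
      disjoint : AllPairs Disjoint bl
      nonempty : ∀ {B} → B ∈ˡ bl → Nonempty B
  open IsPartition public

  allPairs-unique : ∀ {bl} → AllPairs Disjoint bl → ∀ {B B′ u} → B ∈ˡ bl → B′ ∈ˡ bl → u ∈ B → u ∈ B′ → B ≡ B′
  allPairs-unique (d ∷ ds) (here refl) (here refl) p q = refl
  allPairs-unique (d ∷ ds) (here refl) (there y)   p q = ⊥-elim (All.lookup d y p q)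
  allPairs-unique (d ∷ ds) (there x)   (here refl) p q = ⊥-elim (All.lookup d x q p)
  allPairs-unique (d ∷ ds) (there x)   (there y)   p q = allPairs-unique ds x y p q

  unique : ∀ {bl} → IsPartition bl → ∀ {B B′ u} → B ∈ˡ bl → B′ ∈ˡ bl → u ∈ B → u ∈ B′ → B ≡ B′
  unique V = allPairs-unique (disjoint V)

  module _ (A : Subset n) where

    merged-⊇ : ∀ bl {u} → u ∈ A → u ∈ proj₁ (mergeParts bl A)
    merged-⊇ []       p = p
    merged-⊇ (B ∷ bl) p with meets A B
    ... | true  = x∈p∪q⁺ (inj₁ (merged-⊇ bl p))
    ... | false = merged-⊇ bl p

    merged-block : ∀ bl {B u} → B ∈ˡ bl → meets A B ≡ true → u ∈ B → u ∈ proj₁ (mergeParts bl A)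
    merged-block (B ∷ bl) (here refl) e p rewrite e = x∈p∪q⁺ {p = proj₁ (mergeParts bl A)} (inj₂ p)
    merged-block (C′ ∷ bl) (there B∈)  e p with meets A C′
    ... | true  = x∈p∪q⁺ (inj₁ (merged-block bl B∈ e p))
    ... | false = merged-block bl B∈ e p

    merged-elim : ∀ bl {u} → u ∈ proj₁ (mergeParts bl A) →
      u ∈ A ⊎ (∃[ B ] B ∈ˡ bl × meets A B ≡ true × u ∈ B)
    merged-elim []       p = inj₁ p
    merged-elim (B ∷ bl) p with meets A B in e
    ... | false with merged-elim bl p
    ...   | inj₁ q                 = inj₁ q
    ...   | inj₂ (C′ , C∈ , e′ , q) = inj₂ (C′ , there C∈ , e′ , q)
    merged-elim (B ∷ bl) p | true with x∈p∪q⁻ (proj₁ (mergeParts bl A)) B p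
    ...   | inj₂ q = inj₂ (B , here refl , e , q)
    ...   | inj₁ q with merged-elim bl q
    ...     | inj₁ r                 = inj₁ r
    ...     | inj₂ (C′ , C∈ , e′ , r) = inj₂ (C′ , there C∈ , e′ , r)

    kept-elim : ∀ bl {O} → O ∈ˡ proj₂ (mergeParts bl A) → O ∈ˡ bl × meets A O ≡ false
    kept-elim (B ∷ bl) O∈ with meets A B in e
    kept-elim (B ∷ bl) O∈ | true with p , q ← kept-elim bl O∈ = there p , q
    kept-elim (B ∷ bl) (here refl) | false = here refl , e
    kept-elim (B ∷ bl) (there O∈)  | false with p , q ← kept-elim bl O∈ = there p , q

    kept-intro : ∀ bl {O} → O ∈ˡ bl → meets A O ≡ false → O ∈ˡ proj₂ (mergeParts bl A)
    kept-intro (B ∷ bl) (here refl) e rewrite e = here refl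
    kept-intro (B ∷ bl) (there O∈)  e with meets A B
    ... | true  = kept-intro bl O∈ e
    ... | false = there (kept-intro bl O∈ e)

    kept-disjoint : ∀ {bl} → AllPairs Disjoint bl → AllPairs Disjoint (proj₂ (mergeParts bl A))
    kept-disjoint []                   = []
    kept-disjoint {B ∷ bl} (d ∷ ds) with meets A B
    ... | true  = kept-disjoint ds
    ... | false = All.tabulate (λ O∈ → All.lookup d (proj₁ (kept-elim bl O∈))) ∷ kept-disjoint ds

  Refines : List (Subset n) → List (Subset n) → Set
  Refines bl bl′ = ∀ {B} → B ∈ˡ bl → ∃[ F ] F ∈ˡ bl′ × (∀ {u} → u ∈ B → u ∈ F)

  refines-merge : ∀ bl A → Refines bl (merge bl A)
  refines-merge bl A {B} B∈ with meets A B in e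
  ... | true  = _ , here refl , merged-block A bl B∈ e
  ... | false = B , there (kept-intro A bl B∈ e) , id

  merge-partition : ∀ {bl A} → IsPartition bl → Nonempty A → IsPartition (merge bl A)
  merge-partition {bl} {A} V (a , a∈A) .covers u with B , B∈ , p ← covers V u
    with F , F∈ , q ← refines-merge bl A B∈ = F , F∈ , q p
  merge-partition {bl} {A} V _ .disjoint = All.tabulate sep ∷ kept-disjoint A (disjoint V)
    where
      sep : ∀ {O} → O ∈ˡ proj₂ (mergeParts bl A) → Disjoint (proj₁ (mergeParts bl A)) O
      sep O∈ p q with kept-elim A bl O∈ | merged-elim A bl p
      ... | O∈bl , e | inj₁ u∈A with trans (sym e) (meets-intro u∈A q)
      ...   | ()
      sep O∈ p q | O∈bl , e | inj₂ (B , B∈ , e′ , u∈B) with unique V B∈ O∈bl u∈B q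
      ...   | refl with trans (sym e) e′
      ...     | ()
  merge-partition {bl} {A} V (a , a∈A) .nonempty (here refl) = a , merged-⊇ A bl a∈A
  merge-partition {bl} {A} V _ .nonempty (there O∈) = nonempty V (proj₁ (kept-elim A bl O∈))

  refines-refl : ∀ {bl} → Refines bl bl
  refines-refl B∈ = _ , B∈ , id

  refines-trans : ∀ {X Y Z} → Refines X Y → Refines Y Z → Refines X Z
  refines-trans r s B∈ with F , F∈ , p ← r B∈ with H , H∈ , q ← s F∈ = H , H∈ , q ∘ p

  refines-contract : ∀ bl As → Refines bl (contract bl As)
  refines-contract bl []       = refines-refl
  refines-contract bl (A ∷ As) = refines-trans (refines-merge bl A) (refines-contract (merge bl A) As)

  contract-partition : ∀ {bl As} → IsPartition bl → All Nonempty As → IsPartition (contract bl As)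
  contract-partition V []       = V
  contract-partition V (p ∷ ps) = contract-partition (merge-partition V p) ps

  contract-⊇ : ∀ bl As {A} → A ∈ˡ As → ∃[ F ] F ∈ˡ contract bl As × (∀ {u} → u ∈ A → u ∈ F)
  contract-⊇ bl (A ∷ As) (here refl) with F , F∈ , p ← refines-contract (merge bl A) As (here refl) =
    F , F∈ , p ∘ merged-⊇ A bl
  contract-⊇ bl (A ∷ As) (there B∈) = contract-⊇ (merge bl A) As B∈

  module _ {k} (f : Fin n → Fin k) where

    Constant : Subset n → Set
    Constant A = ∀ {u v} → u ∈ A → v ∈ A → f u ≡ f v

    Coarser : List (Subset n) → Set
    Coarser bl = ∀ {B} → B ∈ˡ bl → Constant B

    -- Each vertex of the new block has the value of some vertex of `A`, since its old block shares
    -- a vertex with `A`.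
    coarser-merge : ∀ {bl A} → Coarser bl → Constant A → Coarser (merge bl A)
    coarser-merge {bl} {A} c d (here refl) p q with toA p | toA q
      where
        toA : ∀ {u} → u ∈ proj₁ (mergeParts bl A) → ∃[ a ] a ∈ A × f u ≡ f a
        toA {u} p with merged-elim A bl p
        ... | inj₁ u∈A = u , u∈A , refl
        ... | inj₂ (B , B∈ , e , u∈B) with a , a∈A , a∈B ← meets-elim A B e = a , a∈A , c B∈ u∈B a∈B
    ... | a , a∈ , e | b , b∈ , e′ = trans e (trans (d a∈ b∈) (sym e′))
    coarser-merge {bl} {A} c d (there O∈) = c (proj₁ (kept-elim A bl O∈))

    coarser-contract : ∀ {bl As} → Coarser bl → All Constant As → Coarser (contract bl As)
    coarser-contract c []       = c
    coarser-contract c (d ∷ ds) = coarser-contract (coarser-merge c d) ds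

    coarser-refines : ∀ {X Y} → Refines X Y → Coarser Y → Coarser X
    coarser-refines r c B∈ p q with F , F∈ , i ← r B∈ = c F∈ (i p) (i q)

  -- Double counting of the incidences between the blocks of X and the blocks
  -- of a coarser partition Y; every block of Y with a touched block contains
  -- at least two blocks, and q ≤ 2 (q − 1) for q ≥ 2.
  module _ {X Y : List (Subset n)} (VX : IsPartition X) (VY : IsPartition Y) (r : Refines X Y)
           (τ : Subset n → Bool)
           (τ-two : ∀ {B} → B ∈ˡ X → τ B ≡ true →
             ∃[ B′ ] B′ ∈ˡ X × B ≢ B′ × ∃[ F ] F ∈ˡ Y × meets B F ≡ true × meets B′ F ≡ true) where

    private
      meets-block : ∀ {B} → B ∈ˡ X → Σˡ Y (λ F → ⟨ meets B F ⟩) ≡ 1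
      meets-block {B} B∈ with F₀ , F₀∈ , i ← r B∈ with u , u∈B ← nonempty VX B∈ = go (disjoint VY) F₀∈
        where
          zeros : ∀ {Y} → All (Disjoint F₀) Y → Σˡ Y (λ F → ⟨ meets B F ⟩) ≡ 0
          zeros [] = refl
          zeros {F ∷ Y} (d ∷ ds) with meets B F in e
          ... | false = zeros ds
          ... | true with v , p , q ← meets-elim B F e = ⊥-elim (d (i p) q)
          go : ∀ {Y} → AllPairs Disjoint Y → F₀ ∈ˡ Y → Σˡ Y (λ F → ⟨ meets B F ⟩) ≡ 1
          go (d ∷ ds) (here refl) rewrite meets-intro u∈B (i u∈B) = cong suc (zeros d)
          go {F ∷ Y} (d ∷ ds) (there F₀∈) with meets B F in e
          ... | false = go ds F₀∈
          ... | true with v , p , q ← meets-elim B F e = ⊥-elim (All.lookup d F₀∈ q (i p))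

      q : Subset n → ℕ
      q F = Σˡ X (λ B → ⟨ meets B F ⟩)

      t : Subset n → ℕ
      t F = Σˡ X (λ B → ⟨ τ B ⟩ * ⟨ meets B F ⟩)

      q≥1 : ∀ {F} → F ∈ˡ Y → 1 ≤ q F
      q≥1 {F} F∈ with u , u∈F ← nonempty VY F∈ with B , B∈ , u∈B ← covers VX u =
        ≤-trans (⟨⟩-of-true (meets-intro u∈B u∈F)) (Σˡ-member (λ B → ⟨ meets B F ⟩) B∈)

      block-bound : ∀ {F} → F ∈ˡ Y → t F + 2 ≤ 2 * q F
      block-bound {F} F∈ with t F in eq
      ... | zero  = *-monoʳ-≤ 2 (q≥1 F∈)
      ... | suc _ with B , B∈ , pos ← Σˡ-positive X _ (subst (1 ≤_) (sym eq) (s≤s z≤n))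
        with τ B in eτ | meets B F in eF
      ...   | true | true with B′ , B′∈ , B≢ , F′ , F′∈ , m , m′ ← τ-two B∈ eτ = begin
          suc _ + 2     ≡⟨ cong (_+ 2) (sym eq) ⟩
          t F + 2       ≤⟨ +-monoˡ-≤ 2 (Σˡ-mono X (λ {C′} _ → ≤-trans (*-monoˡ-≤ _ (⟨⟩≤1 (τ C′))) (≤-reflexive (*-identityˡ _)))) ⟩
          q F + 2       ≤⟨ +-monoʳ-≤ (q F) two ⟩
          q F + q F     ≡⟨ cong (q F +_) (sym (+-identityʳ _)) ⟩
          2 * q F       ∎
        where
          open ≤-Reasoning
          F≡F′ : F ≡ F′
          F≡F′ with F₀ , F₀∈ , i ← r B∈ with u , u₁ , u₂ ← meets-elim B F eF with v , v₁ , v₂ ← meets-elim B F′ m =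
            trans (unique VY F∈ F₀∈ u₂ (i u₁)) (unique VY F₀∈ F′∈ (i v₁) v₂)
          two : 2 ≤ q F
          two = ≤-trans (≤-reflexive (sym (cong₂ (λ a b → ⟨ a ⟩ + ⟨ b ⟩) eF (trans (cong (meets B′) F≡F′) m′))))
                  (Σˡ-two (λ B → ⟨ meets B F ⟩) B∈ B′∈ B≢)

    touched-bound : Σˡ X (λ B → ⟨ τ B ⟩) + 2 * length Y ≤ 2 * length X
    touched-bound = begin
      Σˡ X (λ B → ⟨ τ B ⟩) + 2 * length Y              ≡⟨ cong₂ _+_ sum-t (trans (*-comm 2 (length Y)) (sum-2 Y)) ⟩
      Σˡ Y t + Σˡ Y (λ _ → 2)                          ≡⟨ sym (Σˡ-+ Y t (λ _ → 2)) ⟩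
      Σˡ Y (λ F → t F + 2)                             ≤⟨ Σˡ-mono Y block-bound ⟩
      Σˡ Y (λ F → 2 * q F)                             ≡⟨ Σˡ-* Y 2 q ⟩
      2 * Σˡ Y q                                       ≡⟨ cong (2 *_) sum-q ⟩
      2 * length X                                     ∎
      where
        open ≤-Reasoning
        sum-2 : ∀ {A : Set} (ys : List A) → length ys * 2 ≡ Σˡ ys (λ _ → 2)
        sum-2 []       = refl
        sum-2 (_ ∷ ys) = cong (2 +_) (sum-2 ys)
        on-X : ∀ {f g : Subset n → ℕ} Z → (∀ {B} → B ∈ˡ Z → f B ≡ g B) → Σˡ Z f ≡ Σˡ Z g
        on-X []      e = refl
        on-X (_ ∷ Z) e = cong₂ _+_ (e (here refl)) (on-X Z (e ∘ there))
        sum-q : Σˡ Y q ≡ length X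
        sum-q = trans (Σˡ-swap Y X (λ F B → ⟨ meets B F ⟩)) (trans (on-X X meets-block) (Σˡ-1 X))
        sum-t : Σˡ X (λ B → ⟨ τ B ⟩) ≡ Σˡ Y t
        sum-t = trans (on-X X (λ {B} B∈ → sym (trans (Σˡ-* Y ⟨ τ B ⟩ (λ F → ⟨ meets B F ⟩))
                  (trans (cong (⟨ τ B ⟩ *_) (meets-block B∈)) (*-identityʳ _)))))
                (Σˡ-swap X Y (λ B F → ⟨ τ B ⟩ * ⟨ meets B F ⟩))

  -- The double counting with no block marked as touched: what remains is that each block of `Y`
  -- contains at least one block of `X`.
  refines-length : ∀ {X Y} → IsPartition X → IsPartition Y → Refines X Y → length Y ≤ length X
  refines-length {X} {Y} VX VY r = *-cancelˡ-≤ 2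
    (≤-trans (m≤n+m (2 * length Y) (Σˡ X (λ _ → 0))) (touched-bound VX VY r (λ _ → false) (λ _ ())))

  contract-length : ∀ {bl As} → IsPartition bl → All Nonempty As → length (contract bl As) ≤ length bl
  contract-length {bl} {As} V ne = refines-length V (contract-partition V ne) (refines-contract bl As)

  -- The incidence between hedges and blocks of a contraction: summed over the hedges it gives the
  -- degree of the block, summed over the blocks the number of blocks that the hedge joins to
  -- others.
  touches : List (Subset n) → Subset n → Bool
  touches []       B = false
  touches (A ∷ As) B = (meets A B ∧ not (does (A ⊆? B))) ∨ touches As B

  ⊈-witness : ∀ {m} (A B : Subset m) → does (A ⊆? B) ≡ false → ∃[ v ] v ∈ A × v ∉ B
  ⊈-witness [] [] ()
  ⊈-witness (outside ∷ A) (b ∷ B) e with A ⊆? B in eq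
  ... | no _ with v , p , q ← ⊈-witness A B (cong does eq) = suc v , there p , λ { (there r) → q r }
  ⊈-witness (inside ∷ A) (outside ∷ B) e = zero , here , λ ()
  ⊈-witness (inside ∷ A) (inside ∷ B) e with A ⊆? B in eq
  ... | no _ with v , p , q ← ⊈-witness A B (cong does eq) = suc v , there p , λ { (there r) → q r }

  touches-elim : ∀ As {B} → touches As B ≡ true →
    ∃[ A ] A ∈ˡ As × (∃[ u ] u ∈ A × u ∈ B) × (∃[ v ] v ∈ A × v ∉ B)
  touches-elim (A ∷ As) {B} e with meets A B in em | does (A ⊆? B) in es
  ... | true  | false = A , here refl , meets-elim A B em , ⊈-witness A B es
  ... | true  | true  with C′ , C∈ , p ← touches-elim As e = C′ , there C∈ , p
  ... | false | _     with C′ , C∈ , p ← touches-elim As e = C′ , there C∈ , p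

  touches-intro : ∀ As {A B u v} → A ∈ˡ As → u ∈ A → u ∈ B → v ∈ A → v ∉ B → touches As B ≡ true
  touches-intro (A ∷ As) {B = B} (here refl) p q r s rewrite meets-intro p q with A ⊆? B
  ... | yes i = ⊥-elim (s (i r))
  ... | no _  = refl
  touches-intro (A ∷ As) {B = B} (there A∈) p q r s rewrite touches-intro As A∈ p q r s
    with meets A B ∧ not (does (A ⊆? B))
  ... | true  = refl
  ... | false = refl

  -- Every touched block is merged with another one. In the worst case they merge in pairs, so the
  -- number of removed blocks is at least half the number of touched ones. This is the passage from
  -- degrees to removed blocks.
  contract-touches : ∀ {bl As} → IsPartition bl → All Nonempty As →
    Σˡ bl (λ B → ⟨ touches As B ⟩) + 2 * length (contract bl As) ≤ 2 * length bl
  contract-touches {bl} {As} V ne =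
    touched-bound V (contract-partition V ne) (refines-contract bl As) (touches As) two
    where
      VY = contract-partition V ne
      two : ∀ {B} → B ∈ˡ bl → touches As B ≡ true →
        ∃[ B′ ] B′ ∈ˡ bl × B ≢ B′ × ∃[ F ] F ∈ˡ contract bl As × meets B F ≡ true × meets B′ F ≡ true
      two B∈ e with A , A∈ , (u , p , q) , (v , p′ , q′) ← touches-elim As e
        with B′ , B′∈ , v∈ ← covers V v with F , F∈ , i ← contract-⊇ bl As A∈ =
        B′ , B′∈ , (λ { refl → q′ v∈ }) , F , F∈ , meets-intro q (i p) , meets-intro v∈ (i p′)

  -- If no block disappears, `contract-touches` leaves no touched block, so every set in `As` lies
  -- inside a single block. Such a hedge cannot be cut by any cut that respects the blocks.
  trivial-constant : ∀ {k} {f : Fin n → Fin k} {bl As} → IsPartition bl → All Nonempty As → Coarser f bl →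
    length bl ≤ length (contract bl As) → All (Constant f) As
  trivial-constant {f = f} {bl} {As} V ne c le = All.tabulate λ {A} A∈ p q → const A∈ p q
    where
      none : Σˡ bl (λ B → ⟨ touches As B ⟩) ≤ 0
      none = +-cancelʳ-≤ (2 * length bl) _ 0 (≤-trans (+-monoʳ-≤ (Σˡ bl (λ B → ⟨ touches As B ⟩)) (*-monoʳ-≤ 2 le)) (contract-touches V ne))
      const : ∀ {A} → A ∈ˡ As → Constant f A
      const {A} A∈ {u} {v} p q with B , B∈ , u∈B ← covers V u with v ∈? B
      ... | yes v∈B = c B∈ u∈B v∈B
      ... | no  v∉B with ≤-trans (≤-trans (⟨⟩-of-true (touches-intro As A∈ p u∈B q v∉B))
                                   (Σˡ-member (λ B → ⟨ touches As B ⟩) B∈)) none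
      ...   | ()

-- Programs for booleans, numbers and subsets

v0 : ∀ {n t₀ s w} {ρ : Vec Tree n} → (t₀ ∷ ρ) ⊢ varᵗ zero ⇓ t₀ ⟨ con 1 ∣ s , w ⟩
v0 = varR zero

v1 : ∀ {n t₀ t₁ s w} {ρ : Vec Tree n} → (t₀ ∷ t₁ ∷ ρ) ⊢ varᵗ (suc zero) ⇓ t₁ ⟨ con 1 ∣ s , w ⟩
v1 = varR (suc zero)

v2 : ∀ {n t₀ t₁ t₂ s w} {ρ : Vec Tree n} → (t₀ ∷ t₁ ∷ t₂ ∷ ρ) ⊢ varᵗ (suc (suc zero)) ⇓ t₂ ⟨ con 1 ∣ s , w ⟩
v2 = varR (suc (suc zero))

v3 : ∀ {n t₀ t₁ t₂ t₃ s w} {ρ : Vec Tree n} →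
  (t₀ ∷ t₁ ∷ t₂ ∷ t₃ ∷ ρ) ⊢ varᵗ (suc (suc (suc zero))) ⇓ t₃ ⟨ con 1 ∣ s , w ⟩
v3 = varR (suc (suc (suc zero)))

v4 : ∀ {n t₀ t₁ t₂ t₃ t₄ s w} {ρ : Vec Tree n} →
  (t₀ ∷ t₁ ∷ t₂ ∷ t₃ ∷ t₄ ∷ ρ) ⊢ varᵗ (suc (suc (suc (suc zero)))) ⇓ t₄ ⟨ con 1 ∣ s , w ⟩
v4 = varR (suc (suc (suc (suc zero))))

v5 : ∀ {n t₀ t₁ t₂ t₃ t₄ t₅ s w} {ρ : Vec Tree n} →
  (t₀ ∷ t₁ ∷ t₂ ∷ t₃ ∷ t₄ ∷ t₅ ∷ ρ) ⊢ varᵗ (suc (suc (suc (suc (suc zero))))) ⇓ t₅ ⟨ con 1 ∣ s , w ⟩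
v5 = varR (suc (suc (suc (suc (suc zero)))))

v6 : ∀ {n t₀ t₁ t₂ t₃ t₄ t₅ t₆ s w} {ρ : Vec Tree n} →
  (t₀ ∷ t₁ ∷ t₂ ∷ t₃ ∷ t₄ ∷ t₅ ∷ t₆ ∷ ρ) ⊢ varᵗ (suc (suc (suc (suc (suc (suc zero)))))) ⇓ t₆ ⟨ con 1 ∣ s , w ⟩
v6 = varR (suc (suc (suc (suc (suc (suc zero))))))

isCons : Tree → Bool
isCons nil        = false
isCons (cons _ _) = true

isCons-bool : ∀ b → isCons (encodeBool b) ≡ b
isCons-bool true  = refl
isCons-bool false = refl

ifEncR : ∀ {n} {ρ : Vec Tree n} {s w c t e x p q r} {B : Set} (enc : B → Tree) {b} {y z : B} →
  isCons x ≡ b → ρ ⊢ c ⇓ x ⟨ p ∣ s , w ⟩ → ρ ⊢ t ⇓ enc y ⟨ q ∣ s , w ⟩ → ρ ⊢ e ⇓ enc z ⟨ r ∣ s , w ⟩ →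
  ρ ⊢ ifᵗ c t e ⇓ enc (if b then y else z) ⟨ p ⊕ q ⊕ r ⊕ con 2 ∣ s , w ⟩
ifEncR {x = x} enc {y = y} {z} refl dc dt de =
  ifR dc (λ x≢nil → castR (cong enc (then-eq x x≢nil)) dt) (λ { refl → de })
  where
    then-eq : ∀ x → x ≢ nil → y ≡ (if isCons x then y else z)
    then-eq nil        ne = contradiction refl ne
    then-eq (cons _ _) ne = refl

trueR : ∀ {n} {ρ : Vec Tree n} {s w} → ρ ⊢ consᵗ nilᵗ nilᵗ ⇓ encodeBool true ⟨ _ ∣ s , w ⟩
trueR = consR nilR nilR

ifBoolR : ∀ {n} {ρ : Vec Tree n} {s w c t e p q r b b₁ b₂} →
  ρ ⊢ c ⇓ encodeBool b ⟨ p ∣ s , w ⟩ → ρ ⊢ t ⇓ encodeBool b₁ ⟨ q ∣ s , w ⟩ →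
  ρ ⊢ e ⇓ encodeBool b₂ ⟨ r ∣ s , w ⟩ →
  ρ ⊢ ifᵗ c t e ⇓ encodeBool (if b then b₁ else b₂) ⟨ p ⊕ q ⊕ r ⊕ con 2 ∣ s , w ⟩
ifBoolR {b = b} = ifEncR encodeBool (isCons-bool b)

encodeℕ-replicate : ∀ k → encodeℕ k ≡ encodeList (List.replicate k nil)
encodeℕ-replicate zero    = refl
encodeℕ-replicate (suc k) = cong (cons nil) (encodeℕ-replicate k)

dropR : ∀ {n} {ρ : Vec Tree n} {s w l z ts us p q} (lp : Poly) →
  ρ ⊢ l ⇓ encodeList ts ⟨ p ∣ s , w ⟩ → ρ ⊢ z ⇓ encodeList us ⟨ q ∣ s , w ⟩ →
  length ts ≤ ⟦ lp ⟧ᵖ s →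
  ρ ⊢ foldᵗ l z (tlᵗ (varᵗ (suc zero))) ⇓ encodeList (List.drop (length ts) us) ⟨ _ ∣ s , w ⟩
dropR {ρ = ρ} {s} {w} lp d e len = foldR lp {w} d e (*-monoˡ-≤ (suc w) len) (loop _ _)
  where
    tl-drop : ∀ us → tl (encodeList us) ≡ encodeList (List.drop 1 us)
    tl-drop []      = refl
    tl-drop (_ ∷ _) = refl
    drop-drop : ∀ k us → List.drop {A = Tree} k (List.drop 1 us) ≡ List.drop (suc k) us
    drop-drop zero    us       = refl
    drop-drop (suc k) []       = refl
    drop-drop (suc k) (_ ∷ us) = refl
    loop : ∀ ts us → Loop ρ (tlᵗ (varᵗ (suc zero))) (con 1 ⊕ con 2) s w ts (encodeList us) (encodeList (List.drop (length ts) us))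
    loop []       us = []
    loop (t ∷ ts) us = castR (tl-drop us) (tlR v1) ∷
      loop-end (cong encodeList (drop-drop (length ts) us)) (loop ts (List.drop 1 us))

-- Truncated subtraction: `l` loses one element for each element of `l′`, and the comparison holds
-- exactly if nothing remains.
leqᵗ : ∀ {n} → Tm n → Tm n → Tm n
leqᵗ l l′ = ifᵗ (foldᵗ l′ l (tlᵗ (varᵗ (suc zero)))) nilᵗ (consᵗ nilᵗ nilᵗ)

leqR : ∀ {n} {ρ : Vec Tree n} {s w l l′ ts us p q} (lp : Poly) →
  ρ ⊢ l ⇓ encodeList ts ⟨ p ∣ s , w ⟩ → ρ ⊢ l′ ⇓ encodeList us ⟨ q ∣ s , w ⟩ →
  length us ≤ ⟦ lp ⟧ᵖ s →
  ρ ⊢ leqᵗ l l′ ⇓ encodeBool (length ts ≤ᵇ length us) ⟨ _ ∣ s , w ⟩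
leqR {ts = ts} {us} lp d d′ len = castR (cong encodeBool (eq ts us)) (ifEncR encodeBool refl (dropR lp d′ d len) nilR trueR)
  where
    <ᵇ-suc : ∀ m n → (m <ᵇ suc n) ≡ (m ≤ᵇ n)
    <ᵇ-suc zero    n = refl
    <ᵇ-suc (suc m) n = refl
    eq : ∀ ts us → (if isCons (encodeList (List.drop (length us) ts)) then false else true) ≡ (length ts ≤ᵇ length us)
    eq []       []       = refl
    eq []       (_ ∷ us) = refl
    eq (t ∷ ts) []       = refl
    eq (t ∷ ts) (u ∷ us) = trans (eq ts us) (sym (<ᵇ-suc (length ts) (length us)))

multᵗ : Tm 2
multᵗ = foldᵗ (varᵗ zero) nilᵗ
  (foldᵗ (varᵗ (suc (suc (suc zero)))) (varᵗ (suc zero)) (consᵗ nilᵗ (varᵗ (suc zero))))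

multR : ∀ {n} {ρ : Vec Tree n} {s w l l′ ts us p q} (lp lq : Poly) {w₁} →
  ρ ⊢ l ⇓ encodeList ts ⟨ p ∣ s , w ⟩ → ρ ⊢ l′ ⇓ encodeList us ⟨ q ∣ s , w ⟩ →
  length ts * suc w₁ ≤ ⟦ lp ⟧ᵖ s * suc w → length us ≤ ⟦ lq ⟧ᵖ s * suc w₁ →
  ρ ⊢ callᵗ multᵗ (l ∷ l′ ∷ []) ⇓ encodeℕ (length ts * length us) ⟨ _ ∣ s , w ⟩
multR {s = s} {w} {ts = ts} {us} lp lq {w₁} d d′ len len′ =
  castR (cong encodeℕ (+-identityʳ _)) (callR (d ∷R d′ ∷R []R) (foldR lp {w₁} v0 nilR len (outer ts 0)))
  where
    inner : ∀ {n} {ρ : Vec Tree n} ts i →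
      Loop ρ (consᵗ nilᵗ (varᵗ (suc zero))) (con 1 ⊕ con 1 ⊕ con 3) s 0 ts (encodeℕ i) (encodeℕ (length ts + i))
    inner []       i = []
    inner (t ∷ ts) i = consR nilR v1 ∷
      loop-end (cong encodeℕ (+-suc (length ts) i)) (inner ts (suc i))
    outer : ∀ vs i → Loop (encodeList ts ∷ encodeList us ∷ [])
      (foldᵗ (varᵗ (suc (suc (suc zero)))) (varᵗ (suc zero)) (consᵗ nilᵗ (varᵗ (suc zero))))
      (con 1 ⊕ con 1 ⊕ (((con 1 ⊕ con 1 ⊕ con 3) ⊕ con 7) ⊗ lq) ⊕ con 5) s w₁ vs
      (encodeℕ i) (encodeℕ (length vs * length us + i))
    outer []       i = []
    outer (v ∷ vs) i =
      foldR lq {0} v3 v1 (≤-trans (≤-reflexive (*-identityʳ _)) len′) (inner us i) ∷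
      loop-end (cong encodeℕ (eq (length vs * length us) (length us) i)) (outer vs (length us + i))
      where eq : ∀ a b c → a + (b + c) ≡ b + a + c
            eq = solve-∀

zipl : ∀ {C′ : Set} {n} → (Bool → Bool → C′ → C′) → C′ → Vec Bool n → Vec Bool n → C′
zipl g c []      []      = c
zipl g c (a ∷ A) (b ∷ B) = zipl g (g a b c) A B

loop-zip : ∀ {n} {ρ : Vec Tree n} {e r s w} {C′ : Set} (enc : C′ → Tree) (g : Bool → Bool → C′ → C′) →
  (∀ a b c t → (encodeBool a ∷ cons (enc c) (cons (encodeBool b) t) ∷ ρ) ⊢ e ⇓ cons (enc (g a b c)) t ⟨ r ∣ s , w ⟩) →
  ∀ {m} (A B : Vec Bool m) c →
  Loop ρ e r s w (Vec.toList (Vec.map encodeBool A)) (cons (enc c) (encodeSubset B)) (cons (enc (zipl g c A B)) nil)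
loop-zip enc g body []      []      c = []
loop-zip enc g body (a ∷ A) (b ∷ B) c = body a b c (encodeSubset B) ∷ loop-zip enc g body A B (g a b c)

length-bits : ∀ {m s} (A : Vec Bool m) → m ≤ s → length (Vec.toList (Vec.map encodeBool A)) ≤ s
length-bits A m≤s = ≤-trans (≤-reflexive (Vecₚ.length-toList (Vec.map encodeBool A))) m≤s

length-map≤ : ∀ {A B : Set} {f : A → B} {s} xs → length xs ≤ s → length (List.map f xs) ≤ s
length-map≤ {f = f} xs le = ≤-trans (≤-reflexive (Listₚ.length-map f xs)) le

-- In such a statement the program e and the bound p are found by unification,
-- from the derivation that proves the rest of it.
meetsP : Σ[ e ∈ Tm 2 ] Σ[ p ∈ Poly ] ∀ {n s w} → n ≤ s → (A B : Subset n) →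
  (encodeSubset A ∷ encodeSubset B ∷ []) ⊢ e ⇓ encodeBool (meets A B) ⟨ p ∣ s , w ⟩
meetsP = _ , _ , λ {n} {s} {w} n≤s A B →
  castR (cong encodeBool (sem A B false))
    (hdR (foldR size {w} v0 (consR nilR v1) (*-monoˡ-≤ (suc w) (length-bits A n≤s))
      (loop-zip encodeBool (λ a b f → if f then true else (if a then b else false))
        (λ a b f t → consR (ifBoolR {b = f} (hdR v1) trueR (ifBoolR {b = a} {b₂ = false} v0 (hdR (tlR v1)) nilR)) (tlR (tlR v1))) A B false)))
  where
    sem : ∀ {n} (A B : Subset n) f → zipl (λ a b f → if f then true else (if a then b else false)) f A B ≡ f ∨ meets A B
    sem []          []      true  = refl
    sem []          []      false = refl
    sem (a ∷ A)     (b ∷ B) true  = sem A B true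
    sem (true ∷ A)  (b ∷ B) false = sem A B b
    sem (false ∷ A) (b ∷ B) false = sem A B false

encodeBits : List Bool → Tree
encodeBits = encodeList ∘ List.map encodeBool

unionP : Σ[ e ∈ Tm 2 ] Σ[ p ∈ Poly ] ∀ {n s w} → n ≤ s → (A B : Subset n) →
  (encodeSubset A ∷ encodeSubset B ∷ []) ⊢ e ⇓ encodeSubset (A ∪ B) ⟨ p ∣ s , w ⟩
unionP = _ , _ , λ {n} {s} {w} n≤s A B →
  castR (cong encodeList (trans (cong (List.reverse ∘ List.map encodeBool) (sem A B [])) (rev-enc (A ∪ B))))
    (revR size
      (hdR (foldR size {w} v0 (consR nilR v1) (*-monoˡ-≤ (suc w) (length-bits A n≤s))
        (loop-zip encodeBits (λ a b out → (if a then true else b) ∷ out)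
          (λ a b f t → consR (consR (ifBoolR {b = a} v0 trueR (hdR (tlR v1))) (hdR v1)) (tlR (tlR v1))) A B [])))
      (≤-trans (length-map≤ (zipl _ [] A B) (≤-trans (≤-reflexive (len A B [])) (≤-trans (≤-reflexive (+-identityʳ n)) n≤s))) (m≤m*n s (suc w))))
  where
    g = λ a b out → (if a then true else b) List.∷ out
    or : ∀ a b → (if a then true else b) ≡ a ∨ b
    or true  b = refl
    or false b = refl
    sem : ∀ {n} (A B : Subset n) out → zipl g out A B ≡ Vec.toList (A ∪ B) List.ʳ++ out
    sem []      []      out = refl
    sem (a ∷ A) (b ∷ B) out = trans (sem A B _) (cong (λ c → Vec.toList (A ∪ B) List.ʳ++ (c ∷ out)) (or a b))
    len : ∀ {n} (A B : Subset n) out → length (zipl g out A B) ≡ n + length out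
    len []      []      out = refl
    len {suc n} (a ∷ A) (b ∷ B) out = trans (len A B _) (+-suc n _)
    rev-enc : ∀ {n} (A : Subset n) → List.reverse (List.map encodeBool (Vec.toList A List.ʳ++ [])) ≡ Vec.toList (Vec.map encodeBool A)
    rev-enc A = begin
      List.reverse (List.map encodeBool (List.reverse (Vec.toList A)))  ≡⟨ cong List.reverse (Listₚ.reverse-map encodeBool (Vec.toList A)) ⟩
      List.reverse (List.reverse (List.map encodeBool (Vec.toList A)))  ≡⟨ Listₚ.reverse-involutive _ ⟩
      List.map encodeBool (Vec.toList A)                                ≡⟨ sym (Vecₚ.toList-map encodeBool A) ⟩
      Vec.toList (Vec.map encodeBool A)                                 ∎
      where open ≡-Reasoning

-- Sizes of partitions and hedges

module _ {n : ℕ} where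

  disjoint-length : ∀ {As : List (Subset n)} → AllPairs Disjoint As → All Nonempty As → length As ≤ n
  disjoint-length {As} ds ne = begin
    length As                                                      ≡⟨ sym (Σˡ-1 As) ⟩
    Σˡ As (λ _ → 1)                                                ≤⟨ Σˡ-mono As (λ A∈ → occupied (All.lookup ne A∈)) ⟩
    Σˡ As (λ A → Σˡ (List.allFin n) (λ u → ⟨ lookup A u ⟩))        ≡⟨ Σˡ-swap As (List.allFin n) (λ A u → ⟨ lookup A u ⟩) ⟩
    Σˡ (List.allFin n) (λ u → Σˡ As (λ A → ⟨ lookup A u ⟩))        ≤⟨ Σˡ-mono (List.allFin n) (λ {u} _ → once u ds) ⟩
    Σˡ (List.allFin n) (λ _ → 1)                                   ≡⟨ Σˡ-1 (List.allFin n) ⟩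
    length (List.allFin n)                                         ≡⟨ Listₚ.length-tabulate (λ u → u) ⟩
    n                                                              ∎
    where
      open ≤-Reasoning
      occupied : ∀ {A : Subset n} → Nonempty A → 1 ≤ Σˡ (List.allFin n) (λ u → ⟨ lookup A u ⟩)
      occupied {A} (u , u∈A) = ≤-trans (⟨⟩-of-true (Vecₚ.[]=⇒lookup u∈A)) (Σˡ-member (λ u → ⟨ lookup A u ⟩) (∈-allFin u))
      none : ∀ u {A} {As : List (Subset n)} → u ∈ A → All (Disjoint A) As → Σˡ As (λ A → ⟨ lookup A u ⟩) ≡ 0
      none u p [] = refl
      none u p (_∷_ {B} d ds) with lookup B u in e
      ... | true  = ⊥-elim (d p (Vecₚ.lookup⇒[]= u B e))
      ... | false = none u p ds
      once : ∀ u {As : List (Subset n)} → AllPairs Disjoint As → Σˡ As (λ A → ⟨ lookup A u ⟩) ≤ 1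
      once u [] = z≤n
      once u (_∷_ {A} d ds) with lookup A u in e
      ... | true  = ≤-reflexive (cong suc (none u (Vecₚ.lookup⇒[]= u A e) d))
      ... | false = once u ds

  partition-length : ∀ {bl : List (Subset n)} → IsPartition bl → length bl ≤ n
  partition-length V = disjoint-length (disjoint V) (All.tabulate (nonempty V))

  hedge-nonempty : ∀ (h : Hedge n) → All Nonempty (components h)
  hedge-nonempty h = All.map (λ p → go _ (≤-trans (s≤s z≤n) p)) (size≥2 h)
    where
      go : ∀ {m} (A : Subset m) → 1 ≤ ∣ A ∣ → Nonempty A
      go (true  ∷ A) p = zero , here
      go (false ∷ A) p with u , q ← go A p = suc u , there q

  -- Here the disjointness of the components enters: it bounds the size of a hedge by a polynomial
  -- in n, and thus the work per hedge.
  hedge-length : ∀ (h : Hedge n) → length (components h) ≤ n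
  hedge-length h = disjoint-length (AllPairs.map (λ e {u} p q → e (u , x∈p∩q⁺ (p , q))) (Hedge.disjoint h)) (hedge-nonempty h)

singles : ∀ n → List (Subset n)
singles zero    = []
singles (suc n) = (inside ∷ ∅) ∷ List.map (outside ∷_) (singles n)

singles-length : ∀ n → length (singles n) ≡ n
singles-length zero    = refl
singles-length (suc n) = cong suc (trans (Listₚ.length-map _ (singles n)) (singles-length n))

singles-∈ : ∀ {n B u v} → B ∈ˡ singles n → u ∈ B → v ∈ B → u ≡ v
singles-∈ {suc n} (here refl) here      here      = refl
singles-∈ {suc n} (here refl) here      (there q) = ⊥-elim (∉⊥ q)
singles-∈ {suc n} (here refl) (there p) q         = ⊥-elim (∉⊥ p)
singles-∈ {suc n} (there B∈)  p         q with ∈-map⁻ (outside ∷_) B∈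
singles-∈ {suc n} (there B∈)  (there p) (there q) | C′ , C∈ , refl = cong suc (singles-∈ C∈ p q)

singles-partition : ∀ n → IsPartition (singles n)
singles-partition (suc n) .covers zero = _ , here refl , here
singles-partition (suc n) .covers (suc u) with B , B∈ , p ← covers (singles-partition n) u =
  _ , there (∈-map⁺ (outside ∷_) B∈) , there p
singles-partition zero .disjoint = []
singles-partition (suc n) .disjoint =
  Allₚ.map⁺ (All.tabulate λ _ → λ { (there p) (there q) → ∉⊥ p }) ∷
  AllPairsₚ.map⁺ (AllPairs.map (λ d {u} → λ { (there p) (there q) → d p q }) (disjoint (singles-partition n)))
singles-partition (suc n) .nonempty (here refl) = zero , here
singles-partition (suc n) .nonempty (there B∈) with C′ , C∈ , refl ← ∈-map⁻ (outside ∷_) B∈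
  with u , p ← nonempty (singles-partition n) C∈ = suc u , there p

-- The search

isNonEmpty : ∀ {A : Set} → List A → Bool
isNonEmpty []      = false
isNonEmpty (_ ∷ _) = true

hasTwo : ∀ {A : Set} → List A → Bool
hasTwo []           = false
hasTwo (_ ∷ [])     = false
hasTwo (_ ∷ _ ∷ _)  = true

isPositive : ℕ → Bool
isPositive zero    = false
isPositive (suc _) = true

-- Dealing the elements out alternately requires no length and yields halves that differ by at most
-- one element.
split : ∀ {A : Set} → List A → List A × List A
split = List.foldl (λ p x → proj₂ p , x ∷ proj₁ p) ([] , [])

-- A list without two elements stays as it is, so surplus bits do no harm and one fixed number of
-- bits serves lists of all lengths.
halve : ∀ {A : Set} → Bool → List A → List A
halve b xs = if hasTwo xs then (if b then proj₁ (split xs) else proj₂ (split xs)) else xs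

pick : ∀ {A : Set} {m} → Vec Bool m → List A → List A
pick []      xs = xs
pick (b ∷ w) xs = pick w (halve b xs)

-- The blocks of the current contraction, the number of hedges that may still
-- be deleted, and the hedges that are left.
State : ℕ → Set
State n = List (Subset n) × ℕ × List (Hedge n)

unions : ∀ {n} → Subset n → List (Subset n) → Subset n
unions = List.foldl _∪_

coarsenTo : ∀ {n} → List (Subset n) → List (Subset n) → List (Subset n)
coarsenTo bl []       = bl
coarsenTo bl (R ∷ Rs) = merge bl (unions R Rs)

-- A hedge is uncut exactly if its contraction loses no block, so the contraction program also
-- decides which hedges are cut.
cutTest : ∀ {n} → List (Subset n) → Hedge n → Bool
cutTest Y h = if length Y ≤ᵇ length (contract Y (components h)) then false else true

count : List Bool → ℕ
count = List.foldr (λ b c → if b then suc c else c) 0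

accept : ℕ → List Bool → Maybe (List Bool)
accept j bs = if count bs ≤ᵇ j then just bs else nothing

initial : ∀ {n} → ℕ → List (Hedge n) → List (State n)
initial {n} j hs = (singles n , j , hs) ∷ []

module _ {n : ℕ} (k : ℕ) where

  -- A hedge that would remove no block is dropped for good, because no cut that respects the blocks
  -- cuts it. The first large hedge that the fold meets is taken out and only its contraction is
  -- kept; all other hedges stay.
  classifyStep : List (Subset n) → Hedge n → List (Subset n) × List (Hedge n) → List (Subset n) × List (Hedge n)
  classifyStep bl h (F , rest) =
    let bl′ = contract bl (components h) in
    if length bl ≤ᵇ length bl′ then (F , rest)
    else if isNonEmpty F then (F , h ∷ rest)
    else if length bl ≤ᵇ (length bl ∸ length bl′) * (k * 8) then (bl′ , rest)
    else (F , h ∷ rest)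

  -- The first component is [] if no hedge is large.
  classify : List (Subset n) → List (Hedge n) → List (Subset n) × List (Hedge n)
  classify bl = List.foldr (classifyStep bl) ([] , [])

  contractHead : List (Subset n) → ℕ → List (Hedge n) → List (Hedge n) → List (State n) → List (State n)
  contractHead bl b rest []      acc = acc
  contractHead bl b rest (h ∷ _) acc = (contract bl (components h) , b , rest) ∷ acc

  expandClassified : ∀ {m} → Vec Bool m → List (Subset n) → ℕ → List (Subset n) × List (Hedge n) →
    List (State n) → List (State n)
  expandClassified w bl b (F , rest) acc =
    if isNonEmpty F then (F , b , rest) ∷ (if isPositive b then (bl , pred b , rest) ∷ acc else acc)
    -- The contracted hedge remains in `rest`. It is trivial in the new contraction, so the next
    -- classification drops it.
    else if isNonEmpty rest then contractHead bl b rest (pick w rest) acc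
    else (bl , b , rest) ∷ acc

  expand : ∀ {m} → Vec Bool m → State n → List (State n) → List (State n)
  expand w (bl , b , hs) = expandClassified w bl b (classify bl hs)

  level : ∀ {m} → Vec Bool m → List (State n) → List (State n)
  level w = List.foldr (expand w) []

  -- All states of a level share the random bits of that level.
  levels : ∀ {m} lv → Vec Bool (lv * m) → List (State n) → List (State n)
  levels         zero     w fs = fs
  levels {m = m} (suc lv) w fs = levels lv (Vec.drop m w) (level (Vec.take m w) fs)

  coarsen : List (Subset n) → List (Subset n)
  coarsen bl = coarsenTo bl (List.drop (pred k) bl)

  -- The cut hedges are recomputed among all original hedges `hs`. Whatever branch a partition comes
  -- from, an accepted candidate is thus a genuine cut-set of size at most j.
  candidate : ℕ → List (Hedge n) → List (Subset n) → Maybe (List Bool)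
  candidate j hs bl = if k ≤ᵇ length bl then accept j (List.map (cutTest (coarsen bl)) hs) else nothing

  scanStep : ℕ → List (Hedge n) → State n → Maybe (List Bool) → Maybe (List Bool)
  scanStep j hs st r = if Maybe.is-just r then r else candidate j hs (proj₁ st)

  scan : ℕ → List (Hedge n) → Maybe (List Bool) → List (State n) → Maybe (List Bool)
  scan j hs = List.foldr (scanStep j hs)

  trials : ∀ {m} lv R → Vec Bool (R * (lv * m)) → ℕ → List (Hedge n) → Maybe (List Bool) → Maybe (List Bool)
  trials         lv zero    w j hs r = r
  trials {m = m} lv (suc R) w j hs r =
    trials lv R (Vec.drop (lv * m) w) j hs (scan j hs r (levels lv (Vec.take (lv * m) w) (initial j hs)))

-- The programs for the search

rule : ∀ {c} {A : Set} {B : A → Set} {C′ : ∀ a → B a → Set c} (x : Σ A λ a → Σ (B a) (C′ a)) → C′ (proj₁ x) (proj₁ (proj₂ x))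
rule x = proj₂ (proj₂ x)

-- Every list serves as the unary number of its length, whatever its elements are. The list of
-- hedges can thus count bits, and lists of blocks can be compared and subtracted, with no length
-- computed.
record IsNumeral (t : Tree) (a : ℕ) : Set where
  constructor numeral
  field
    elements  : List Tree
    is-list   : t ≡ encodeList elements
    has-length : length elements ≡ a

num-map : ∀ {A : Set} (f : A → Tree) xs → IsNumeral (encodeList (List.map f xs)) (length xs)
num-map f xs = numeral (List.map f xs) refl (Listₚ.length-map f xs)

num-ℕ : ∀ k → IsNumeral (encodeℕ k) k
num-ℕ k = numeral (List.replicate k nil) (encodeℕ-replicate k) (Listₚ.length-replicate k)

num-drop : ∀ {A : Set} (f : A → Tree) a xs → IsNumeral (encodeList (List.drop a (List.map f xs))) (length xs ∸ a)
num-drop f a xs = numeral _ refl (trans (Listₚ.length-drop a (List.map f xs)) (cong (_∸ a) (Listₚ.length-map f xs)))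

module _ {n} {ρ : Vec Tree n} {s w : ℕ} where

  leqN : ∀ {l l′ t t′ a b p q} (lp : Poly) → IsNumeral t a → IsNumeral t′ b →
    ρ ⊢ l ⇓ t ⟨ p ∣ s , w ⟩ → ρ ⊢ l′ ⇓ t′ ⟨ q ∣ s , w ⟩ → b ≤ ⟦ lp ⟧ᵖ s →
    ρ ⊢ leqᵗ l l′ ⇓ encodeBool (a ≤ᵇ b) ⟨ _ ∣ s , w ⟩
  leqN lp (numeral _ refl refl) (numeral _ refl refl) d e len = leqR lp d e len

  multN : ∀ {l l′ t t′ a b p q} (lp lq : Poly) {w₁} → IsNumeral t a → IsNumeral t′ b →
    ρ ⊢ l ⇓ t ⟨ p ∣ s , w ⟩ → ρ ⊢ l′ ⇓ t′ ⟨ q ∣ s , w ⟩ →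
    a * suc w₁ ≤ ⟦ lp ⟧ᵖ s * suc w → b ≤ ⟦ lq ⟧ᵖ s * suc w₁ →
    ρ ⊢ callᵗ multᵗ (l ∷ l′ ∷ []) ⇓ encodeℕ (a * b) ⟨ _ ∣ s , w ⟩
  multN lp lq {w₁} (numeral _ refl refl) (numeral _ refl refl) d e len len′ = multR lp lq {w₁} d e len len′

  dropN : ∀ {l z t us a p q} (lp : Poly) → IsNumeral t a →
    ρ ⊢ l ⇓ t ⟨ p ∣ s , w ⟩ → ρ ⊢ z ⇓ encodeList us ⟨ q ∣ s , w ⟩ → a ≤ ⟦ lp ⟧ᵖ s →
    ρ ⊢ foldᵗ l z (tlᵗ (varᵗ (suc zero))) ⇓ encodeList (List.drop a us) ⟨ _ ∣ s , w ⟩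
  dropN lp (numeral _ refl refl) d e len = dropR lp d e len

encodeBlocks : ∀ {n} → List (Subset n) → Tree
encodeBlocks = encodeList ∘ List.map encodeSubset

encodeHedges : ∀ {n} → List (Hedge n) → Tree
encodeHedges = encodeList ∘ List.map encodeHedge

trivially : ∀ {A : Set} {xs : List A} → All (λ _ → ⊤) xs
trivially {xs = xs} = All.universal (λ _ → tt) xs

encodeMerged : ∀ {n} → Subset n × List (Subset n) → Tree
encodeMerged p = cons (encodeSubset (proj₁ p)) (encodeBlocks (proj₂ p))

mergeP : Σ[ e ∈ Tm 2 ] Σ[ p ∈ Poly ] ∀ {n s w} → n ≤ s → (bl : List (Subset n)) (A : Subset n) → length bl ≤ s →
  (encodeBlocks bl ∷ encodeSubset A ∷ []) ⊢ e ⇓ encodeBlocks (merge bl A) ⟨ p ∣ s , w ⟩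
mergeP = _ , _ , λ {n} {s} {w} n≤s bl A len →
  foldrR size {w} v0 (consR v1 nilR) (*-monoˡ-≤ (suc w) (length-map≤ bl len))
    (loop-foldr encodeSubset encodeMerged (λ _ → ⊤) (λ _ → ⊤) (mergeStep A)
      (λ {B} {y} _ _ → ifEncR encodeMerged (isCons-bool (meets A B))
        (callR (v3 ∷R v0 ∷R []R) (rule meetsP n≤s A B))
        (consR (callR (hdR v1 ∷R v0 ∷R []R) (rule unionP n≤s (proj₁ y) B)) (tlR v1))
        (consR (hdR v1) (consR v0 (tlR v1))))
      (λ _ _ → tt) (trivially {xs = bl}) tt)

contractP : Σ[ e ∈ Tm 2 ] Σ[ p ∈ Poly ] ∀ {n s w} → n ≤ s → (bl As : List (Subset n)) → IsPartition bl →
  All Nonempty As → length As ≤ s →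
  (encodeBlocks bl ∷ encodeBlocks As ∷ []) ⊢ e ⇓ encodeBlocks (contract bl As) ⟨ p ∣ s , w ⟩
contractP = _ , _ , λ {n} {s} {w} n≤s bl As V ne len →
  foldR size {w} v1 v0 (*-monoˡ-≤ (suc w) (length-map≤ As len))
    (loop-foldl encodeSubset encodeBlocks Nonempty IsPartition merge
      (λ {A} {bl} _ V → callR (v1 ∷R v0 ∷R []R) (rule mergeP n≤s bl A (≤-trans (partition-length V) n≤s)))
      (λ ne V → merge-partition V ne) ne V)

contractHedgeR : ∀ {n s w} → n ≤ s → (bl : List (Subset n)) → IsPartition bl → (h : Hedge n) →
  (encodeBlocks bl ∷ encodeHedge h ∷ []) ⊢ proj₁ contractP ⇓ encodeBlocks (contract bl (components h)) ⟨ proj₁ (proj₂ contractP) ∣ s , w ⟩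
contractHedgeR n≤s bl V h =
  rule contractP n≤s bl (components h) V (hedge-nonempty h) (≤-trans (hedge-length h) n≤s)

encodeClassified : ∀ {n} → List (Subset n) × List (Hedge n) → Tree
encodeClassified p = cons (encodeBlocks (proj₁ p)) (encodeHedges (proj₂ p))

isCons-map : ∀ {A : Set} (f : A → Tree) xs → isCons (encodeList (List.map f xs)) ≡ isNonEmpty xs
isCons-map f []      = refl
isCons-map f (_ ∷ _) = refl

classifyStepP : Σ[ e ∈ Tm 5 ] Σ[ p ∈ Poly ] ∀ {n s w} → n ≤ s → ∀ {k} → k ≤ s → (bl : List (Subset n)) → IsPartition bl →
  ∀ h y → (encodeBlocks (contract bl (components h)) ∷ encodeHedge h ∷ encodeClassified y ∷ encodeBlocks bl ∷ encodeℕ k ∷ []) ⊢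
    e ⇓ encodeClassified (classifyStep k bl h y) ⟨ p ∣ s , w ⟩
classifyStepP = _ , _ , λ {n} {s} {w} n≤s {k} k≤s bl V h y →
  let bl′ = contract bl (components h)
      len  = ≤-trans (partition-length V) n≤s
      len′ = ≤-trans (contract-length V (hedge-nonempty h)) len
  in ifEncR encodeClassified (isCons-bool _)
       (leqN size (num-map encodeSubset bl) (num-map encodeSubset bl′) v3 v0 len′) v2
       (ifEncR encodeClassified (isCons-map encodeSubset (proj₁ y)) (hdR v2) (consR (hdR v2) (consR v1 (tlR v2)))
         (ifEncR encodeClassified (isCons-bool _)
           (leqN (size ⊗ size ⊗ con 8) (num-map encodeSubset bl) (num-ℕ _) v3
             (multN size (size ⊗ con 8) {w} (num-drop encodeSubset (length bl′) bl) (num-ℕ _)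
               (dropN size (num-map encodeSubset bl′) v0 v3 len′)
               (multN size (con 8) {w} (num-ℕ k) (num-ℕ 8) v4 (eightR) (*-monoˡ-≤ (suc w) k≤s) (m≤m*n 8 (suc w)))
               (*-monoˡ-≤ (suc w) (≤-trans (m∸n≤m (length bl) (length bl′)) len))
               (≤-trans (*-monoˡ-≤ 8 k≤s) (m≤m*n (s * 8) (suc w))))
             (*-mono-≤ (≤-trans (m∸n≤m (length bl) (length bl′)) len) (*-monoˡ-≤ 8 k≤s)))
           (consR v0 (tlR v2)) (consR (hdR v2) (consR v1 (tlR v2)))))
  where
    eightR : ∀ {n} {ρ : Vec Tree n} {s w} → ρ ⊢ _ ⇓ encodeℕ 8 ⟨ _ ∣ s , w ⟩
    eightR = consR nilR (consR nilR (consR nilR (consR nilR (consR nilR (consR nilR (consR nilR (consR nilR nilR)))))))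

classifyP : Σ[ e ∈ Tm 3 ] Σ[ p ∈ Poly ] ∀ {n s w} → n ≤ s → ∀ {k} → k ≤ s → (bl : List (Subset n)) → IsPartition bl →
  ∀ hs → length hs ≤ s → (encodeBlocks bl ∷ encodeHedges hs ∷ encodeℕ k ∷ []) ⊢ e ⇓ encodeClassified (classify k bl hs) ⟨ p ∣ s , w ⟩
classifyP = _ , _ , λ {n} {s} {w} n≤s {k} k≤s bl V hs len →
  foldrR size {w} v1 (consR nilR nilR) (*-monoˡ-≤ (suc w) (length-map≤ hs len))
    (loop-foldr encodeHedge encodeClassified (λ _ → ⊤) (λ _ → ⊤) (classifyStep k bl)
      (λ {h} {y} _ _ → callR (callR (v2 ∷R v0 ∷R []R) (contractHedgeR n≤s bl V h) ∷R v0 ∷R v1 ∷R v2 ∷R v4 ∷R []R)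
        (rule classifyStepP n≤s k≤s bl V h y))
      (λ _ _ → tt) (trivially {xs = hs}) tt)

encodePair : ∀ {n} → List (Hedge n) × List (Hedge n) → Tree
encodePair p = cons (encodeHedges (proj₁ p)) (encodeHedges (proj₂ p))

splitP : Σ[ e ∈ Tm 1 ] Σ[ p ∈ Poly ] ∀ {n s w} (xs : List (Hedge n)) → length xs ≤ s →
  (encodeHedges xs ∷ []) ⊢ e ⇓ encodePair (split xs) ⟨ p ∣ s , w ⟩
splitP = _ , _ , λ {n} {s} {w} xs len →
  foldR size {w} v0 (consR nilR nilR) (*-monoˡ-≤ (suc w) (length-map≤ xs len))
    (loop-foldl encodeHedge encodePair (λ _ → ⊤) (λ _ → ⊤) (λ p x → proj₂ p , x ∷ proj₁ p)
      (λ _ _ → consR (tlR v1) (consR v0 (hdR v1))) (λ _ _ → tt) (trivially {xs = xs}) tt)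

split-length : ∀ {A : Set} (xs : List A) a b →
  let p = List.foldl (λ p x → proj₂ p , x ∷ proj₁ p) (a , b) xs in
  length (proj₁ p) + length (proj₂ p) ≡ length xs + (length a + length b)
split-length []       a b = refl
split-length (x ∷ xs) a b = trans (split-length xs b (x ∷ a)) (eq (length xs) (length a) (length b))
  where eq : ∀ c a b → c + (b + suc a) ≡ suc (c + (a + b))
        eq = solve-∀

halve-length : ∀ {A : Set} b (xs : List A) → length (halve b xs) ≤ length xs
halve-length b xs with hasTwo xs
halve-length b     xs | false = ≤-refl
halve-length true  xs | true  = ≤-trans (m≤m+n _ _) (≤-reflexive (trans (split-length xs [] []) (+-identityʳ _)))
halve-length false xs | true  = ≤-trans (m≤n+m _ (length (proj₁ (split xs)))) (≤-reflexive (trans (split-length xs [] []) (+-identityʳ _)))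

isCons-two : ∀ {A : Set} (f : A → Tree) xs → isCons (tl (encodeList (List.map f xs))) ≡ hasTwo xs
isCons-two f []          = refl
isCons-two f (_ ∷ [])    = refl
isCons-two f (_ ∷ _ ∷ _) = refl

infixr 6 _▹_
-- Bits in front of the unread rest of the tape: a program that consumes the bits hands the rest on
-- to the next one.
_▹_ : ∀ {m} → Vec Bool m → Tree → Tree
[]      ▹ t = t
(b ∷ w) ▹ t = cons (encodeBool b) (w ▹ t)

halveP : Σ[ e ∈ Tm 5 ] Σ[ p ∈ Poly ] ∀ {n s w} (xs : List (Hedge n)) → length xs ≤ s → ∀ b t x (ρ : Vec Tree 3) →
  (x ∷ cons (encodeHedges xs) (cons (encodeBool b) t) ∷ ρ) ⊢ e ⇓ cons (encodeHedges (halve b xs)) t ⟨ p ∣ s , w ⟩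
halveP = _ , _ , λ xs len b t x ρ →
  consR (ifEncR encodeHedges (isCons-two encodeHedge xs) (tlR (hdR v1))
          (ifEncR encodeHedges (isCons-bool b) (hdR (tlR v1))
            (hdR (callR (hdR v1 ∷R []R) (rule splitP xs len)))
            (tlR (callR (hdR v1 ∷R []R) (rule splitP xs len))))
          (hdR v1))
        (tlR (tlR v1))

pickP : Σ[ e ∈ Tm 3 ] Σ[ p ∈ Poly ] ∀ {n s w m fuel} → IsNumeral fuel m → m ≤ s → (u : Vec Bool m) → ∀ t (xs : List (Hedge n)) → length xs ≤ s →
  (fuel ∷ u ▹ t ∷ encodeHedges xs ∷ []) ⊢ e ⇓ cons (encodeHedges (pick u xs)) t ⟨ p ∣ s , w ⟩
pickP = _ , _ , λ { {s = s} {w} (numeral ts refl refl) m≤s u t xs len →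
  foldR size {w} v0 (consR v2 v1) (*-monoˡ-≤ (suc w) m≤s) (loop ts u t xs len) }
  where
    loop : ∀ {n s w} {ρ : Vec Tree 3} ts (u : Vec Bool (length ts)) t (xs : List (Hedge n)) → length xs ≤ s →
      Loop ρ (proj₁ halveP) (proj₁ (proj₂ halveP)) s w ts (cons (encodeHedges xs) (u ▹ t)) (cons (encodeHedges (pick u xs)) t)
    loop []       []      t xs len = []
    loop (x ∷ ts) (b ∷ u) t xs len = rule halveP xs len b (u ▹ t) x _ ∷ loop ts u t (halve b xs) (≤-trans (halve-length b xs) len)

skipR : ∀ {n} {ρ : Vec Tree n} {s w l l′ m fuel p q} → IsNumeral fuel m → m ≤ s → (u : Vec Bool m) → ∀ t →
  ρ ⊢ l ⇓ fuel ⟨ p ∣ s , w ⟩ → ρ ⊢ l′ ⇓ u ▹ t ⟨ q ∣ s , w ⟩ →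
  ρ ⊢ foldᵗ l l′ (tlᵗ (varᵗ (suc zero))) ⇓ t ⟨ _ ∣ s , w ⟩
skipR {ρ = ρ} {s} {w} (numeral ts refl refl) m≤s u t d e = foldR size {w} d e (*-monoˡ-≤ (suc w) m≤s) (loop ts u)
  where
    loop : ∀ ts (u : Vec Bool (length ts)) → Loop ρ (tlᵗ (varᵗ (suc zero))) (con 1 ⊕ con 2) s w ts (u ▹ t) t
    loop []       []      = []
    loop (_ ∷ ts) (b ∷ u) = tlR v1 ∷ loop ts u

encodeState : ∀ {n} → State n → Tree
encodeState st = cons (encodeBlocks (proj₁ st)) (cons (encodeℕ (proj₁ (proj₂ st))) (encodeHedges (proj₂ (proj₂ st))))

encodeStates : ∀ {n} → List (State n) → Tree
encodeStates = encodeList ∘ List.map encodeState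

Bounded : ∀ {n} → ℕ → State n → Set
Bounded s st = IsPartition (proj₁ st) × length (proj₂ (proj₂ st)) ≤ s

isCons-ℕ : ∀ b → isCons (encodeℕ b) ≡ isPositive b
isCons-ℕ zero    = refl
isCons-ℕ (suc b) = refl

tl-ℕ : ∀ b → tl (encodeℕ b) ≡ encodeℕ (pred b)
tl-ℕ zero    = refl
tl-ℕ (suc b) = refl

nonempty-head : ∀ {A : Set} (f : A → Tree) xs → encodeList (List.map f xs) ≢ nil → ∃[ x ] ∃[ ys ] xs ≡ x ∷ ys
nonempty-head f []       ne = contradiction refl ne
nonempty-head f (x ∷ ys) ne = x , ys , refl

contractHeadP : Σ[ e ∈ Tm 5 ] Σ[ p ∈ Poly ] ∀ {n s w} → n ≤ s → ∀ k (bl : List (Subset n)) → IsPartition bl → ∀ b rest hs acc →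
  (encodeHedges hs ∷ encodeBlocks bl ∷ encodeℕ b ∷ encodeHedges rest ∷ encodeStates acc ∷ []) ⊢ e ⇓
    encodeStates (contractHead k bl b rest hs acc) ⟨ p ∣ s , w ⟩
contractHeadP = _ , _ , λ n≤s k bl V b rest hs acc →
  ifR v0
    (λ ne → let h , hs′ , eq = nonempty-head encodeHedge hs ne in
      castR (cong (λ hs → encodeStates (contractHead k bl b rest hs acc)) (sym eq))
        (consR (consR (callR (v1 ∷R castR (cong (hd ∘ encodeHedges) eq) (hdR v0) ∷R []R) (contractHedgeR n≤s bl V h)) (consR v2 v3)) v4))
    (λ e → castR (cong (encodeStates ∘ flip (contractHead k bl b rest) acc) (sym (empty hs e))) v4)
  where
    empty : ∀ {n} (hs : List (Hedge n)) → encodeHedges hs ≡ nil → hs ≡ []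
    empty [] e = refl

expandClassifiedP : Σ[ e ∈ Tm 5 ] Σ[ p ∈ Poly ] ∀ {n s w m fuel} → n ≤ s → ∀ k → IsNumeral fuel m → m ≤ s → (u : Vec Bool m) → ∀ t (st : State n) →
  Bounded s st → ∀ c → length (proj₂ c) ≤ s → ∀ acc →
  (encodeClassified c ∷ encodeState st ∷ encodeStates acc ∷ u ▹ t ∷ fuel ∷ []) ⊢ e ⇓
    encodeStates (expandClassified k u (proj₁ st) (proj₁ (proj₂ st)) c acc) ⟨ p ∣ s , w ⟩
expandClassifiedP = _ , _ , λ n≤s k num m≤s u t st (V , len) c len-c acc →
  let b = proj₁ (proj₂ st) in
  ifEncR encodeStates (isCons-map encodeSubset (proj₁ c)) (hdR v0)
    (consR (consR (hdR v0) (consR (hdR (tlR v1)) (tlR v0)))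
      (ifEncR encodeStates (isCons-ℕ b) (hdR (tlR v1))
        (consR (consR (hdR v1) (consR (castR (tl-ℕ b) (tlR (hdR (tlR v1)))) (tlR v0))) v2) v2))
    (ifEncR encodeStates (isCons-map encodeHedge (proj₂ c)) (tlR v0)
      (callR (hdR (callR (v4 ∷R v3 ∷R tlR v0 ∷R []R) (rule pickP num m≤s u t (proj₂ c) len-c))
              ∷R hdR v1 ∷R hdR (tlR v1) ∷R tlR v0 ∷R v2 ∷R []R)
        (rule contractHeadP n≤s k (proj₁ st) V b (proj₂ c) (pick u (proj₂ c)) acc))
      (consR (consR (hdR v1) (consR (hdR (tlR v1)) (tlR v0))) v2))

classify-length : ∀ {n} k (bl : List (Subset n)) hs → length (proj₂ (classify k bl hs)) ≤ length hs
classify-length k bl []       = z≤n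
classify-length k bl (h ∷ hs) with length bl ≤ᵇ length (contract bl (components h))
... | true = m≤n⇒m≤1+n (classify-length k bl hs)
... | false with isNonEmpty (proj₁ (classify k bl hs))
...   | true = s≤s (classify-length k bl hs)
...   | false with length bl ≤ᵇ (length bl ∸ length (contract bl (components h))) * (k * 8)
...     | true  = m≤n⇒m≤1+n (classify-length k bl hs)
...     | false = s≤s (classify-length k bl hs)

expandP : Σ[ e ∈ Tm 5 ] Σ[ p ∈ Poly ] ∀ {n s w m fuel} → n ≤ s → ∀ {k} → k ≤ s → IsNumeral fuel m → m ≤ s → (u : Vec Bool m) → ∀ t (st : State n) →
  Bounded s st → ∀ acc →
  (encodeState st ∷ encodeStates acc ∷ encodeℕ k ∷ u ▹ t ∷ fuel ∷ []) ⊢ e ⇓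
    encodeStates (expand k u st acc) ⟨ p ∣ s , w ⟩
expandP = _ , _ , λ n≤s {k} k≤s num m≤s u t st (V , len) acc →
  callR (callR (hdR v0 ∷R tlR (tlR v0) ∷R v2 ∷R []R) (rule classifyP n≤s k≤s (proj₁ st) V (proj₂ (proj₂ st)) len)
         ∷R v0 ∷R v1 ∷R v3 ∷R v4 ∷R []R)
    (rule expandClassifiedP n≤s k num m≤s u t st (V , len) (classify k (proj₁ st) (proj₂ (proj₂ st)))
      (≤-trans (classify-length k (proj₁ st) (proj₂ (proj₂ st))) len) acc)

length*1 : ∀ {A : Set} {f : A → Tree} {w} xs → length xs ≤ suc w → length (List.map f xs) * 1 ≤ 1 * suc w
length*1 {w = w} xs le = ≤-trans (≤-reflexive (*-identityʳ _)) (≤-trans (length-map≤ xs le) (≤-reflexive (sym (*-identityˡ (suc w)))))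

levelP : Σ[ e ∈ Tm 4 ] Σ[ p ∈ Poly ] ∀ {n s w m fuel} → n ≤ s → ∀ {k} → k ≤ s → IsNumeral fuel m → m ≤ s → (u : Vec Bool m) → ∀ t (fs : List (State n)) →
  All (Bounded s) fs → length fs ≤ suc w →
  (encodeStates fs ∷ encodeℕ k ∷ u ▹ t ∷ fuel ∷ []) ⊢ e ⇓ encodeStates (level k u fs) ⟨ p ∣ s , w ⟩
levelP = _ , _ , λ {n} {s} n≤s {k} k≤s num m≤s u t fs ok len →
  foldrR (con 1) {0} v0 nilR (length*1 fs len)
    (loop-foldr encodeState encodeStates (Bounded s) (λ _ → ⊤) (expand k u)
      (λ {st} {acc} ok _ → callR (v0 ∷R v1 ∷R v3 ∷R v4 ∷R v5 ∷R []R) (rule expandP n≤s k≤s num m≤s u t st ok acc))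
      (λ _ _ → tt) ok tt)

take-drop-▹ : ∀ m {n} (w : Vec Bool (m + n)) t → w ▹ t ≡ Vec.take m w ▹ Vec.drop m w ▹ t
take-drop-▹ zero    w       t = refl
take-drop-▹ (suc m) (b ∷ w) t = cong (cons (encodeBool b)) (take-drop-▹ m w t)

levelBodyP : Σ[ e ∈ Tm 7 ] Σ[ p ∈ Poly ] ∀ {n s w m fuel} → n ≤ s → ∀ {k} → k ≤ s → IsNumeral fuel m → m ≤ s →
  (u : Vec Bool m) → ∀ t (fs : List (State n)) → All (Bounded s) fs → length fs ≤ suc w → ∀ x y₁ y₂ y₃ →
  (x ∷ cons (encodeStates fs) (u ▹ t) ∷ y₁ ∷ encodeℕ k ∷ y₂ ∷ fuel ∷ y₃ ∷ []) ⊢ e ⇓ cons (encodeStates (level k u fs)) t ⟨ p ∣ s , w ⟩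
levelBodyP = _ , _ , λ n≤s k≤s num m≤s u t fs ok len x y₁ y₂ y₃ →
  consR (callR (hdR v1 ∷R v3 ∷R tlR v1 ∷R v5 ∷R []R) (rule levelP n≤s k≤s num m≤s u t fs ok len))
        (skipR num m≤s u t v5 (tlR v1))

-- Hides the reason why there are few states. The programs are judged once against this interface,
-- and two different bounds on the number of states are plugged in later.
record Invariant {n} (k m s w : ℕ) : Set₁ where
  field
    Inv       : List (State n) → Set
    inv-bound : ∀ {fs} → Inv fs → All (Bounded s) fs × length fs ≤ suc w
    inv-level : ∀ (u : Vec Bool m) {fs} → Inv fs → Inv (level k u fs)

levelsP : Σ[ e ∈ Tm 5 ] Σ[ p ∈ Poly ] ∀ {n s w m fuel lvs} lv → n ≤ s → ∀ {k} → k ≤ s → IsNumeral fuel m → m ≤ s →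
  IsNumeral lvs lv → lv ≤ s → (I : Invariant {n} k m s w) → (u : Vec Bool (lv * m)) → ∀ t (fs : List (State n)) → Invariant.Inv I fs →
  (encodeStates fs ∷ encodeℕ k ∷ u ▹ t ∷ fuel ∷ lvs ∷ []) ⊢ e ⇓ cons (encodeStates (levels k lv u fs)) t ⟨ p ∣ s , w ⟩
levelsP = _ , _ , λ { {s = s} {w} lv n≤s k≤s num m≤s (numeral ts refl refl) lv≤s I u t fs i →
    foldR size {w} v4 (consR v0 v2) (*-monoˡ-≤ (suc w) lv≤s) (loop ts n≤s k≤s num m≤s I u t fs i _ _ _) }
  where
    loop : ∀ {n s w m fuel} ts → n ≤ s → ∀ {k} → k ≤ s → IsNumeral fuel m → m ≤ s → (I : Invariant {n} k m s w) →
      (u : Vec Bool (length ts * m)) → ∀ t fs → Invariant.Inv I fs → ∀ y₁ y₂ y₃ →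
      Loop (y₁ ∷ encodeℕ k ∷ y₂ ∷ fuel ∷ y₃ ∷ []) (proj₁ levelBodyP) (proj₁ (proj₂ levelBodyP)) s w ts
        (cons (encodeStates fs) (u ▹ t)) (cons (encodeStates (levels k (length ts) u fs)) t)
    loop [] n≤s k≤s num m≤s I [] t fs i y₁ y₂ y₃ = []
    loop {m = m} (x ∷ ts) n≤s {k} k≤s num m≤s I u t fs i y₁ y₂ y₃ rewrite take-drop-▹ m u t =
      rule levelBodyP n≤s k≤s num m≤s (Vec.take m u) (Vec.drop m u ▹ t) fs (proj₁ (Invariant.inv-bound I i))
        (proj₂ (Invariant.inv-bound I i)) x y₁ y₂ y₃ ∷
      loop ts n≤s k≤s num m≤s I (Vec.drop m u) t (level k (Vec.take m u) fs) (Invariant.inv-level I (Vec.take m u) i) y₁ y₂ y₃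

unions-⊇ : ∀ {n} (R : Subset n) Rs {u} → u ∈ R → u ∈ unions R Rs
unions-⊇ R []        p = p
unions-⊇ R (R′ ∷ Rs) p = unions-⊇ (R ∪ R′) Rs (x∈p∪q⁺ (inj₁ p))

unionsP : Σ[ e ∈ Tm 1 ] Σ[ p ∈ Poly ] ∀ {n s w} → n ≤ s → ∀ (R : Subset n) Rs → length Rs ≤ s →
  (encodeBlocks (R ∷ Rs) ∷ []) ⊢ e ⇓ encodeSubset (unions R Rs) ⟨ p ∣ s , w ⟩
unionsP = _ , _ , λ {n} {s} {w} n≤s R Rs len →
  foldR size {w} (tlR v0) (hdR v0) (*-monoˡ-≤ (suc w) (length-map≤ Rs len))
    (loop-foldl encodeSubset encodeSubset (λ _ → ⊤) (λ _ → ⊤) _∪_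
      (λ {A} {U} _ _ → callR (v1 ∷R v0 ∷R []R) (rule unionP n≤s U A)) (λ _ _ → tt) (trivially {xs = Rs}) tt)

cutTestsP : Σ[ e ∈ Tm 2 ] Σ[ p ∈ Poly ] ∀ {n s w} → n ≤ s → (Y : List (Subset n)) → IsPartition Y → ∀ hs → length hs ≤ s →
  (encodeBlocks Y ∷ encodeHedges hs ∷ []) ⊢ e ⇓ encodeBits (List.map (cutTest Y) hs) ⟨ p ∣ s , w ⟩
cutTestsP = _ , _ , λ {n} {s} {w} n≤s Y V hs len →
  castR (cong encodeBits (sym (Listₚ.map-is-foldr hs)))
    (foldrR size {w} v1 nilR (*-monoˡ-≤ (suc w) (length-map≤ hs len))
      (loop-foldr encodeHedge encodeBits (λ _ → ⊤) (λ _ → ⊤) (λ h acc → cutTest Y h ∷ acc)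
        (λ {h} _ _ → consR (ifBoolR
            (leqN size (num-map encodeSubset Y) (num-map encodeSubset (contract Y (components h))) v2
              (callR (v2 ∷R v0 ∷R []R) (contractHedgeR n≤s Y V h))
              (≤-trans (contract-length V (hedge-nonempty h)) (≤-trans (partition-length V) n≤s)))
            nilR trueR) v1)
        (λ _ _ → tt) (trivially {xs = hs}) tt))

countP : Σ[ e ∈ Tm 1 ] Σ[ p ∈ Poly ] ∀ {s w} bs → length bs ≤ s →
  (encodeBits bs ∷ []) ⊢ e ⇓ encodeℕ (count bs) ⟨ p ∣ s , w ⟩
countP = _ , _ , λ {s} {w} bs len →
  foldrR size {w} v0 nilR (*-monoˡ-≤ (suc w) (length-map≤ bs len))
    (loop-foldr encodeBool encodeℕ (λ _ → ⊤) (λ _ → ⊤) (λ b c → if b then suc c else c)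
      (λ {b} _ _ → ifEncR encodeℕ (isCons-bool b) v0 (consR nilR v1) v1) (λ _ _ → tt) (trivially {xs = bs}) tt)

encodeMaybe : Maybe (List Bool) → Tree
encodeMaybe nothing   = nil
encodeMaybe (just bs) = cons (encodeBits bs) (encodeℕ (count bs))

isCons-maybe : ∀ r → isCons (encodeMaybe r) ≡ Maybe.is-just r
isCons-maybe nothing  = refl
isCons-maybe (just _) = refl

acceptP : Σ[ e ∈ Tm 2 ] Σ[ p ∈ Poly ] ∀ {s w} bs → length bs ≤ s → ∀ {j} → j ≤ s →
  (encodeBits bs ∷ encodeℕ j ∷ []) ⊢ e ⇓ encodeMaybe (accept j bs) ⟨ p ∣ s , w ⟩
acceptP = _ , _ , λ bs len {j} j≤s →
  ifEncR encodeMaybe (isCons-bool _)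
    (leqN size (num-ℕ (count bs)) (num-ℕ j) (callR (v0 ∷R []R) (rule countP bs len)) v1 j≤s)
    (consR v0 (callR (v0 ∷R []R) (rule countP bs len))) nilR

drop-nonempty : ∀ {A : Set} i (xs : List A) → i < length xs → ∃[ y ] ∃[ ys ] List.drop i xs ≡ y ∷ ys
drop-nonempty zero    (x ∷ xs) _       = x , xs , refl
drop-nonempty (suc i) (x ∷ xs) (s≤s p) = drop-nonempty i xs p

drop-⊆ : ∀ {A : Set} i (xs : List A) {y} → y ∈ˡ List.drop i xs → y ∈ˡ xs
drop-⊆ zero    xs       y∈ = y∈
drop-⊆ (suc i) (x ∷ xs) y∈ = there (drop-⊆ i xs y∈)

encodeBool-true : ∀ {b} → encodeBool b ≢ nil → b ≡ true
encodeBool-true {true}  ne = refl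
encodeBool-true {false} ne = contradiction refl ne

encodeBool-false : ∀ {b} → encodeBool b ≡ nil → b ≡ false
encodeBool-false {false} e = refl

module _ {n k} (bl : List (Subset n)) (1≤k : 1 ≤ k) (le : (k ≤ᵇ length bl) ≡ true) where

  surplus : ∃[ R ] ∃[ Rs ] List.drop (pred k) bl ≡ R ∷ Rs
  surplus = drop-nonempty (pred k) bl
    (≤-trans (≤-reflexive (suc-pred k {{>-nonZero 1≤k}})) (≤ᵇ⇒≤ k (length bl) (subst T (sym le) tt)))

  surplus-nonempty : IsPartition bl → Nonempty (unions (proj₁ surplus) (proj₁ (proj₂ surplus)))
  surplus-nonempty V with R , Rs , eq ← surplus
    with u , p ← nonempty V (drop-⊆ (pred k) bl (subst (R ∈ˡ_) (sym eq) (here refl))) = u , unions-⊇ R Rs p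

  coarsen-merge : coarsen k bl ≡ merge bl (unions (proj₁ surplus) (proj₁ (proj₂ surplus)))
  coarsen-merge = cong (coarsenTo bl) (proj₂ (proj₂ surplus))

  coarsen-partition : IsPartition bl → IsPartition (coarsen k bl)
  coarsen-partition V = subst IsPartition (sym coarsen-merge) (merge-partition V (surplus-nonempty V))

  surplus-length : length (proj₁ (proj₂ surplus)) ≤ length bl
  surplus-length = ≤-trans (n≤1+n _) (≤-trans (≤-reflexive (trans (cong length (sym (proj₂ (proj₂ surplus))))
    (Listₚ.length-drop (pred k) bl))) (m∸n≤m (length bl) (pred k)))

candidateP : Σ[ e ∈ Tm 4 ] Σ[ p ∈ Poly ] ∀ {n s w} → n ≤ s → ∀ {k} → 1 ≤ k → k ≤ s → ∀ {j} → j ≤ s → ∀ hs → length hs ≤ s →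
  (bl : List (Subset n)) → IsPartition bl →
  (encodeBlocks bl ∷ encodeℕ k ∷ encodeℕ j ∷ encodeHedges hs ∷ []) ⊢ e ⇓ encodeMaybe (candidate k j hs bl) ⟨ p ∣ s , w ⟩
candidateP = _ , _ , λ n≤s {k} 1≤k k≤s {j} j≤s hs len bl V →
  let choose = λ b → encodeMaybe (if b then accept j (List.map (cutTest (coarsen k bl)) hs) else nothing)
      len-bl = ≤-trans (partition-length V) n≤s in
  ifR (leqN size (num-ℕ k) (num-map encodeSubset bl) v1 v0 len-bl)
    (λ ne → let le = encodeBool-true ne
                R , Rs , eq = surplus bl 1≤k le in
      castR (cong choose (sym le))
        (callR (callR (castR (cong encodeBlocks (sym (coarsen-merge bl 1≤k le)))
                   (callR (v0 ∷R
                           callR (castR (cong encodeList (trans (Listₚ.drop-map {f = encodeSubset} (pred k) bl) (cong (List.map encodeSubset) eq)))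
                                    (dropN size (num-ℕ (pred k)) (castR (tl-ℕ k) (tlR v1)) v0 (≤-trans (pred[n]≤n {k}) k≤s)) ∷R []R)
                             (rule unionsP n≤s R Rs (≤-trans (surplus-length bl 1≤k le) len-bl)) ∷R []R)
                     (rule mergeP n≤s bl (unions R Rs) len-bl)) ∷R v3 ∷R []R)
                 (rule cutTestsP n≤s (coarsen k bl) (coarsen-partition bl 1≤k le V) hs len) ∷R v2 ∷R []R)
          (rule acceptP (List.map (cutTest (coarsen k bl)) hs) (length-map≤ hs len) j≤s)))
    (λ e → castR (cong choose (sym (encodeBool-false e))) nilR)

scanP : Σ[ e ∈ Tm 5 ] Σ[ p ∈ Poly ] ∀ {n s w} → n ≤ s → ∀ {k} → 1 ≤ k → k ≤ s → ∀ {j} → j ≤ s → ∀ hs → length hs ≤ s →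
  ∀ r (fs : List (State n)) → All (Bounded s) fs → length fs ≤ suc w →
  (encodeStates fs ∷ encodeMaybe r ∷ encodeℕ k ∷ encodeℕ j ∷ encodeHedges hs ∷ []) ⊢ e ⇓ encodeMaybe (scan k j hs r fs) ⟨ p ∣ s , w ⟩
scanP = _ , _ , λ {n} {s} n≤s {k} 1≤k k≤s {j} j≤s hs len r fs ok len-fs →
  foldrR (con 1) {0} v0 v1 (length*1 fs len-fs)
    (loop-foldr encodeState encodeMaybe (Bounded s) (λ _ → ⊤) (scanStep k j hs)
      (λ {st} {r} ok _ → ifEncR encodeMaybe (isCons-maybe r) v1 v1
        (callR (hdR v0 ∷R v4 ∷R v5 ∷R v6 ∷R []R) (rule candidateP n≤s 1≤k k≤s j≤s hs len (proj₁ st) (proj₁ ok))))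
      (λ _ _ → tt) ok tt)

inv-levels : ∀ {n k m s w} (I : Invariant {n} k m s w) lv (u : Vec Bool (lv * m)) {fs} → Invariant.Inv I fs → Invariant.Inv I (levels k lv u fs)
inv-levels         I zero     u i = i
inv-levels {m = m} I (suc lv) u i = inv-levels I lv (Vec.drop m u) (Invariant.inv-level I (Vec.take m u) i)

trialEndP : Σ[ e ∈ Tm 5 ] Σ[ p ∈ Poly ] ∀ {n s w} → n ≤ s → ∀ {k} → 1 ≤ k → k ≤ s → ∀ {j} → j ≤ s → ∀ hs → length hs ≤ s →
  ∀ r (fs : List (State n)) → All (Bounded s) fs → length fs ≤ suc w → ∀ t →
  (cons (encodeStates fs) t ∷ encodeMaybe r ∷ encodeℕ k ∷ encodeℕ j ∷ encodeHedges hs ∷ []) ⊢ e ⇓ cons (encodeMaybe (scan k j hs r fs)) t ⟨ p ∣ s , w ⟩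
trialEndP = _ , _ , λ n≤s 1≤k k≤s j≤s hs len r fs ok len-fs t →
  consR (callR (hdR v0 ∷R v1 ∷R v2 ∷R v3 ∷R v4 ∷R []R) (rule scanP n≤s 1≤k k≤s j≤s hs len r fs ok len-fs)) (tlR v0)

trialP : Σ[ e ∈ Tm 9 ] Σ[ p ∈ Poly ] ∀ {n s w m} → n ≤ s → ∀ {k} → 1 ≤ k → k ≤ s → ∀ {j} → j ≤ s → (hs : List (Hedge n)) → length hs ≡ m → m ≤ s →
  ∀ lv → lv ≤ s → (I : Invariant {n} k m s w) → Invariant.Inv I (initial j hs) → ∀ r (u : Vec Bool (lv * m)) t x y z →
  (x ∷ cons (encodeMaybe r) (u ▹ t) ∷ encodeℕ k ∷ encodeℕ j ∷ encodeHedges hs ∷ encodeℕ lv ∷ encodeStates (initial j hs) ∷ y ∷ z ∷ []) ⊢ e ⇓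
    cons (encodeMaybe (scan k j hs r (levels k lv u (initial j hs)))) t ⟨ p ∣ s , w ⟩
trialP = _ , _ , λ { n≤s {k} 1≤k k≤s {j} j≤s hs refl m≤s lv lv≤s I i r u t x y z →
  callR (callR (v6 ∷R v2 ∷R tlR v1 ∷R v4 ∷R v5 ∷R []R)
           (rule levelsP lv n≤s k≤s (num-map encodeHedge hs) m≤s (num-ℕ lv) lv≤s I u t (initial j hs) i)
         ∷R hdR v1 ∷R v2 ∷R v3 ∷R v4 ∷R []R)
    (rule trialEndP n≤s 1≤k k≤s j≤s hs m≤s r (levels k lv u (initial j hs))
      (proj₁ (Invariant.inv-bound I (inv-levels I lv u i))) (proj₂ (Invariant.inv-bound I (inv-levels I lv u i))) t) }

trialsP : Σ[ e ∈ Tm 7 ] Σ[ p ∈ Poly ] ∀ {n s w₁ w m} → n ≤ s → ∀ {k} → 1 ≤ k → k ≤ s → ∀ {j} → j ≤ s → (hs : List (Hedge n)) → length hs ≡ m → m ≤ s →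
  ∀ lv → lv ≤ s → (I : Invariant {n} k m s w₁) → Invariant.Inv I (initial j hs) → ∀ R → R * suc w₁ ≤ suc w → (u : Vec Bool (R * (lv * m))) →
  (encodeℕ k ∷ encodeℕ j ∷ encodeHedges hs ∷ encodeℕ lv ∷ encodeStates (initial j hs) ∷ u ▹ nil ∷ encodeℕ R ∷ []) ⊢ e ⇓
    encodeMaybe (trials k lv R u j hs nothing) ⟨ p ∣ s , w ⟩
trialsP = _ , _ , λ {n} {s} {w₁} {w} n≤s 1≤k k≤s j≤s hs len m≤s lv lv≤s I i R le u →
    hdR (foldR (con 1) {w₁} (castR (encodeℕ-replicate R) v6) (consR nilR v5)
      (≤-trans (≤-reflexive (cong (_* suc w₁) (Listₚ.length-replicate R))) (≤-trans le (≤-reflexive (sym (*-identityˡ (suc w))))))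
      (loop n≤s 1≤k k≤s j≤s hs len m≤s lv lv≤s I i R u nothing _ _))
  where
    loop : ∀ {n s w m} → n ≤ s → ∀ {k} → 1 ≤ k → k ≤ s → ∀ {j} → j ≤ s → (hs : List (Hedge n)) → length hs ≡ m → m ≤ s →
      ∀ lv → lv ≤ s → (I : Invariant {n} k m s w) → Invariant.Inv I (initial j hs) → ∀ R (u : Vec Bool (R * (lv * m))) r y z →
      Loop (encodeℕ k ∷ encodeℕ j ∷ encodeHedges hs ∷ encodeℕ lv ∷ encodeStates (initial j hs) ∷ y ∷ z ∷ [])
        (proj₁ trialP) (proj₁ (proj₂ trialP)) s w (List.replicate R nil)
        (cons (encodeMaybe r) (u ▹ nil)) (cons (encodeMaybe (trials k lv R u j hs r)) nil)
    loop n≤s 1≤k k≤s j≤s hs len m≤s lv lv≤s I i zero [] r y z = []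
    loop {m = m} n≤s {k} 1≤k k≤s {j} j≤s hs len m≤s lv lv≤s I i (suc R) u r y z rewrite take-drop-▹ (lv * m) u nil =
      rule trialP n≤s 1≤k k≤s j≤s hs len m≤s lv lv≤s I i r (Vec.take (lv * m) u) (Vec.drop (lv * m) u ▹ nil) nil y z ∷
      loop n≤s 1≤k k≤s j≤s hs len m≤s lv lv≤s I i R (Vec.drop (lv * m) u) (scan k j hs r (levels k lv (Vec.take (lv * m) u) (initial j hs))) y z

singlesP : Σ[ e ∈ Tm 1 ] Σ[ p ∈ Poly ] ∀ {s w} n → n ≤ s → (encodeℕ n ∷ []) ⊢ e ⇓ encodeBlocks (singles n) ⟨ p ∣ s , w ⟩
singlesP = _ , _ , λ {s} {w} n n≤s →
  castR (cong (encodeBlocks ∘ singles) (+-identityʳ n))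
    (tlR (foldR size {w} (castR (encodeℕ-replicate n) v0) (consR nilR nilR)
      (*-monoˡ-≤ (suc w) (≤-trans (≤-reflexive (Listₚ.length-replicate n)) n≤s))
      -- The accumulator carries the empty subset of i vertices along. With one element in front it
      -- becomes the new singleton, while all older sets receive a leading `outside`.
      (loop-count (λ i → cons (encodeSubset (∅ {i})) (encodeBlocks (singles i))) {n}
        (λ i i<n → consR (consR nilR (hdR v1)) (consR (consR trueR (hdR v1))
          (castR (cong encodeBlocks (sym (Listₚ.map-is-foldr (singles i))))
            (foldrR size {w} (tlR v1) nilR
              (*-monoˡ-≤ (suc w) (length-map≤ (singles i) (≤-trans (≤-reflexive (singles-length i)) (≤-trans (<⇒≤ i<n) n≤s))))
              (loop-foldr encodeSubset encodeBlocks (λ _ → ⊤) (λ _ → ⊤) (λ A acc → (outside ∷ A) ∷ acc)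
                (λ _ _ → consR (consR nilR v0) v1) (λ _ _ → tt) (trivially {xs = singles i}) tt)))))
        n 0 (≤-reflexive (+-identityʳ n)))))

lit : ∀ {n} → ℕ → Tm n
lit zero    = nilᵗ
lit (suc c) = consᵗ nilᵗ (lit c)

litPoly : ℕ → Poly
litPoly zero    = con 1
litPoly (suc c) = con 1 ⊕ litPoly c ⊕ con 3

litR : ∀ {n} {ρ : Vec Tree n} {s w} c → ρ ⊢ lit c ⇓ encodeℕ c ⟨ litPoly c ∣ s , w ⟩
litR zero    = nilR
litR (suc c) = consR nilR (litR c)

powᵗ : Tm 2
powᵗ = foldᵗ (varᵗ (suc zero)) (lit 1) (callᵗ multᵗ (varᵗ (suc zero) ∷ varᵗ (suc (suc zero)) ∷ []))

-- Numbers are unary, so each intermediate power takes as much space as its value and has to fit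
-- into the scale.
powR : ∀ {n} {ρ : Vec Tree n} {s w l l′ b e p q} (lp lq : Poly) →
  ρ ⊢ l ⇓ encodeℕ b ⟨ p ∣ s , w ⟩ → ρ ⊢ l′ ⇓ encodeℕ e ⟨ q ∣ s , w ⟩ →
  b ≤ ⟦ lp ⟧ᵖ s → e ≤ ⟦ lq ⟧ᵖ s → (∀ i → i ≤ e → b ^ i ≤ suc w) →
  ρ ⊢ callᵗ powᵗ (l ∷ l′ ∷ []) ⇓ encodeℕ (b ^ e) ⟨ _ ∣ s , w ⟩
powR {s = s} {w} {b = b} {e} lp lq d d′ b≤ e≤ pw = callR (d ∷R d′ ∷R []R)
  (castR (cong (encodeℕ ∘ (b ^_)) (+-identityʳ e))
    (foldR lq {w} (castR (encodeℕ-replicate e) v1) (litR 1)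
      (*-monoˡ-≤ (suc w) (≤-trans (≤-reflexive (Listₚ.length-replicate e)) e≤))
      (loop-count (λ i → encodeℕ (b ^ i)) {e}
        (λ i i<e → castR (cong encodeℕ (*-comm (b ^ i) b))
          (multN (con 1) lp {0} (num-ℕ (b ^ i)) (num-ℕ b) v1 v2
            (≤-trans (≤-reflexive (*-identityʳ _)) (≤-trans (pw i (<⇒≤ i<e)) (≤-reflexive (sym (*-identityˡ (suc w))))))
            (≤-trans b≤ (≤-reflexive (sym (*-identityʳ _))))))
        e 0 (≤-reflexive (+-identityʳ e)))))

-- Cuts as colourings, and the cut that isolates given blocks

cut? : ∀ {n k} (f : Fin n → Fin k) (h : Hedge n) → Dec (IsCutBy h f)
cut? f h = Any.any? (λ A → Finₚ.any? λ u → Finₚ.any? λ v → (u ∈? A) ×-dec (v ∈? A) ×-dec ¬? (f u Fin.≟ f v)) (components h)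

cuts : ∀ {n k} → (Fin n → Fin k) → Hedge n → ℕ
cuts f h = ⟨ does (cut? f h) ⟩

module _ {n k} {f : Fin n → Fin k} {h : Hedge n} where

  constant-uncut : All (Constant f) (components h) → ¬ IsCutBy h f
  constant-uncut c p with A , A∈ , u , v , u∈ , v∈ , ne ← find p = ne (All.lookup c A∈ u∈ v∈)

  uncut-constant : ¬ IsCutBy h f → All (Constant f) (components h)
  uncut-constant ¬p = All.tabulate λ {A} A∈ {u} {v} u∈ v∈ → go A∈ u∈ v∈ (f u Fin.≟ f v)
    where
      go : ∀ {A u v} → A ∈ˡ components h → u ∈ A → v ∈ A → Dec (f u ≡ f v) → f u ≡ f v
      go A∈ u∈ v∈ (yes e) = e
      go {u = u} {v} A∈ u∈ v∈ (no ne) = ⊥-elim (¬p (Any.map (λ { refl → u , v , u∈ , v∈ , ne }) A∈))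

  cuts-constant : All (Constant f) (components h) → cuts f h ≡ 0
  cuts-constant c with cut? f h
  ... | yes p = ⊥-elim (constant-uncut c p)
  ... | no _  = refl

-- The cut whose parts are the sets in `ys` and everything else, which gets the last number. With k
-- - 1 blocks it competes with the optimum; this is the analogue of the cut around a single vertex
-- for k = 2.
isolate : ∀ {n} (ys : List (Subset n)) → Fin n → Fin (suc (length ys))
isolate []       u = zero
isolate (B ∷ ys) u = if does (u ∈? B) then zero else suc (isolate ys u)

isolate-here : ∀ {n} {B : Subset n} ys {u} → u ∈ B → isolate (B ∷ ys) u ≡ zero
isolate-here {B = B} ys {u} u∈ with u ∈? B
... | yes _ = refl
... | no ∉  = contradiction u∈ ∉

isolate-there : ∀ {n} {B : Subset n} ys {u} → u ∉ B → isolate (B ∷ ys) u ≡ suc (isolate ys u)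
isolate-there {B = B} ys {u} u∉ with u ∈? B
... | yes u∈ = contradiction u∈ u∉
... | no _   = refl

module _ {n : ℕ} where

  isolate-surjective : ∀ (ys : List (Subset n)) → AllPairs Disjoint ys → All Nonempty ys →
    ∀ u → (∀ {B} → B ∈ˡ ys → u ∉ B) → StrictlySurjective _≡_ (isolate ys)
  isolate-surjective ys ds ne u out i = let v , e , _ = reach ys ds ne out i in v , e
    where
      reach : ∀ ys → AllPairs Disjoint ys → All Nonempty ys → (∀ {B} → B ∈ˡ ys → u ∉ B) →
        ∀ i → ∃[ v ] isolate ys v ≡ i × (v ≡ u ⊎ ∃[ C′ ] C′ ∈ˡ ys × v ∈ C′)
      reach []       _        _               out zero = u , refl , inj₁ refl
      reach (B ∷ ys) (d ∷ ds) ((v , v∈) ∷ ne) out zero =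
        v , isolate-here ys v∈ , inj₂ (B , here refl , v∈)
      reach (B ∷ ys) (d ∷ ds) (_ ∷ ne) out (suc i) with reach ys ds ne (out ∘ there) i
      ... | v , e , inj₁ refl         = v , trans (isolate-there ys (out (here refl))) (cong suc e) , inj₁ refl
      ... | v , e , inj₂ (C′ , C∈ , p) =
        v , trans (isolate-there ys (λ v∈ → All.lookup d C∈ v∈ p)) (cong suc e) , inj₂ (C′ , there C∈ , p)

  isolate-separates : ∀ (ys : List (Subset n)) u v → isolate ys u ≢ isolate ys v →
    ∃[ B ] B ∈ˡ ys × ((u ∈ B × v ∉ B) ⊎ (v ∈ B × u ∉ B))
  isolate-separates []       u v ne = contradiction refl ne
  isolate-separates (B ∷ ys) u v ne with u ∈? B | v ∈? B
  ... | yes p | yes q = contradiction refl ne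
  ... | yes p | no  q = B , here refl , inj₁ (p , q)
  ... | no  p | yes q = B , here refl , inj₂ (q , p)
  ... | no  p | no  q with C′ , C∈ , r ← isolate-separates ys u v (ne ∘ cong suc) = C′ , there C∈ , r

  -- A cut component has vertices in different parts, and at least one of these parts is a member of
  -- `ys`, which the component meets and leaves. So the value of the cut is at most the sum of the
  -- degrees.
  isolate-cuts : ∀ (ys : List (Subset n)) (h : Hedge n) →
    cuts (isolate ys) h ≤ Σˡ ys (λ B → ⟨ touches (components h) B ⟩)
  isolate-cuts ys h with cut? (isolate ys) h
  ... | no _ = z≤n
  ... | yes p with A , A∈ , u , v , u∈ , v∈ , ne ← find p with isolate-separates ys u v ne
  ...   | B , B∈ , inj₁ (q , r) = ≤-trans (⟨⟩-of-true (touches-intro (components h) A∈ u∈ q v∈ r)) (Σˡ-member (λ B → ⟨ touches (components h) B ⟩) B∈)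
  ...   | B , B∈ , inj₂ (q , r) = ≤-trans (⟨⟩-of-true (touches-intro (components h) A∈ v∈ q u∈ r)) (Σˡ-member (λ B → ⟨ touches (components h) B ⟩) B∈)

  isolate-coarser : ∀ {bl : List (Subset n)} → IsPartition bl → ∀ ys → (∀ {B} → B ∈ˡ ys → B ∈ˡ bl) → Coarser (isolate ys) bl
  isolate-coarser V []       sub B∈ p q = refl
  isolate-coarser V (C′ ∷ ys) sub {B} B∈ {u} {v} p q with u ∈? C′ | v ∈? C′
  ... | yes _ | yes _ = refl
  ... | no _  | no _  = cong suc (isolate-coarser V ys (sub ∘ there) B∈ p q)
  ... | yes r | no s  with refl ← unique V B∈ (sub (here refl)) p r = contradiction q s
  ... | no s  | yes r with refl ← unique V B∈ (sub (here refl)) q r = contradiction p s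

  isolate-member : ∀ {Os : List (Subset n)} → AllPairs Disjoint Os → ∀ {O u v} → O ∈ˡ Os → u ∈ O →
    isolate Os u ≡ isolate Os v → v ∈ O
  isolate-member {O ∷ Os} (d ∷ ds) {u = u} {v} (here refl) p e with v ∈? O
  ... | yes q = q
  ... | no  q with trans (sym (isolate-here Os p)) e
  ...   | ()
  isolate-member {B ∷ Os} (d ∷ ds) {O} {u} {v} (there O∈) p e with v ∈? B
  ... | yes q with trans (sym (isolate-there Os (λ r → All.lookup d O∈ r p))) e
  ...   | ()
  isolate-member {B ∷ Os} (d ∷ ds) {O} {u} {v} (there O∈) p e | no q =
    isolate-member ds O∈ p (Finₚ.suc-injective (trans (sym (isolate-there Os (λ r → All.lookup d O∈ r p))) e))

  module _ {M : Subset n} {Os : List (Subset n)} (V : IsPartition (M ∷ Os)) where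

    isolate-block : ∀ {A : Subset n} → Nonempty A → Constant (isolate Os) A →
      ∃[ F ] F ∈ˡ (M ∷ Os) × (∀ {u} → u ∈ A → u ∈ F)
    isolate-block (u , u∈) c with covers V u
    ... | O , there O∈ , p = O , there O∈ , λ v∈ → isolate-member (AllPairs.tail (disjoint V)) O∈ p (c u∈ v∈)
    ... | M , here refl , p = M , here refl , inM
      where
        inM : ∀ {v} → v ∈ _ → v ∈ M
        inM {v} v∈ with covers V v
        ... | _ , here refl , q = q
        ... | O , there O∈  , q = ⊥-elim (All.lookup (AllPairs.head (disjoint V)) O∈ p
                (isolate-member (AllPairs.tail (disjoint V)) O∈ q (c v∈ u∈)))

    -- If no block is lost, the components lie inside blocks and `h` is uncut. If `h` is uncut,
    -- every block of its contraction lies in a block of `M ∷ Os`, so by `refines-length` no block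
    -- is lost.
    cutTest-cut : ∀ h → cutTest (M ∷ Os) h ≡ does (cut? (isolate Os) h)
    cutTest-cut h with length (M ∷ Os) ≤ᵇ length (contract (M ∷ Os) (components h)) in e | cut? (isolate Os) h
    ... | false | yes _ = refl
    ... | true  | no _  = refl
    ... | true  | yes p = ⊥-elim (constant-uncut {h = h} (trivial-constant V (hedge-nonempty h) (isolate-coarser V Os there)
            (≤ᵇ⇒≤ _ (length (contract (M ∷ Os) (components h))) (subst T (sym e) tt))) p)
    ... | false | no ¬p = ⊥-elim (subst T e (≤⇒≤ᵇ (refines-length (contract-partition V (hedge-nonempty h)) V
            (λ B∈ → isolate-block (nonempty (contract-partition V (hedge-nonempty h)) B∈)
               (coarser-contract (isolate Os) (isolate-coarser V Os there) (uncut-constant {h = h} ¬p) B∈)))))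

-- What the classification of the hedges preserves

module _ {n : ℕ} (k : ℕ) (bl : List (Subset n)) where

  Trivial : Hedge n → Set
  Trivial h = length bl ≤ length (contract bl (components h))

  reduction : Hedge n → ℕ
  reduction h = length bl ∸ length (contract bl (components h))

  Large : Hedge n → Set
  Large h = length bl ≤ reduction h * (k * 8)

  -- Two lists with the same nontrivial hedges, counted with multiplicity, since different hedges
  -- may be equal as values. The analysis uses the lists only through sums of this kind.
  SameSum : List (Hedge n) → List (Hedge n) → Set
  SameSum hs hs′ = ∀ (χ : Hedge n → ℕ) → (∀ h → Trivial h → χ h ≡ 0) → Σˡ hs χ ≡ Σˡ hs′ χ

  data Classified (hs : List (Hedge n)) : List (Subset n) × List (Hedge n) → Set where
    allSmall : ∀ {rest} → (∀ {h} → h ∈ˡ rest → ¬ Trivial h × ¬ Large h) → SameSum hs rest → Classified hs ([] , rest)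
    oneLarge : ∀ {h rest F} → ¬ Trivial h → Large h → F ≡ contract bl (components h) → isNonEmpty F ≡ true →
      SameSum hs (h ∷ rest) → Classified hs (F , rest)

  ≤ᵇ-true : ∀ {a b} → (a ≤ᵇ b) ≡ true → a ≤ b
  ≤ᵇ-true {a} {b} e = ≤ᵇ⇒≤ a b (subst T (sym e) tt)

  ≤ᵇ-false : ∀ {a b} → (a ≤ᵇ b) ≡ false → ¬ a ≤ b
  ≤ᵇ-false e p = subst T e (≤⇒≤ᵇ p)

  -- This makes the empty list an unambiguous mark for the absence of a large hedge.
  contract-nonempty : ∀ (bl As : List (Subset n)) → ¬ length bl ≤ length (contract bl As) → isNonEmpty (contract bl As) ≡ true
  contract-nonempty []       As       ¬le = contradiction z≤n ¬le
  contract-nonempty (B ∷ bl) []       ¬le = refl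
  contract-nonempty (B ∷ bl) (A ∷ As) ¬le = go (merge (B ∷ bl) A) As refl
    where
      go : ∀ Y As → isNonEmpty Y ≡ true → isNonEmpty (contract Y As) ≡ true
      go Y []       e = e
      go Y (A ∷ As) e = go (merge Y A) As refl

  swap-sum : ∀ a b c → a + (b + c) ≡ b + (a + c)
  swap-sum = solve-∀

  classify-classified : ∀ hs → Classified hs (classify k bl hs)
  classify-classified [] = allSmall (λ ()) (λ χ z → refl)
  classify-classified (h ∷ hs) with classify k bl hs | classify-classified hs
  ... | F , rest | c with length bl ≤ᵇ length (contract bl (components h)) in e
  classify-classified (h ∷ hs) | F , rest | allSmall s eq | true =
    allSmall s (λ χ z → trans (cong (_+ Σˡ hs χ) (z h (≤ᵇ-true e))) (eq χ z))
  classify-classified (h ∷ hs) | F , rest | oneLarge t l f ne eq | true =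
    oneLarge t l f ne (λ χ z → trans (cong (_+ Σˡ hs χ) (z h (≤ᵇ-true e))) (eq χ z))
  classify-classified (h ∷ hs) | F , rest | oneLarge {h′} t l f ne eq | false rewrite ne =
    oneLarge t l f ne (λ χ z → trans (cong (χ h +_) (eq χ z)) (swap-sum (χ h) (χ h′) (Σˡ rest χ)))
  classify-classified (h ∷ hs) | [] , rest | allSmall s eq | false
    with length bl ≤ᵇ reduction h * (k * 8) in e′
  ... | true  = oneLarge (≤ᵇ-false e) (≤ᵇ-true e′) refl (contract-nonempty bl (components h) (≤ᵇ-false e))
                  (λ χ z → cong (χ h +_) (eq χ z))
  ... | false = allSmall (λ { (here refl) → ≤ᵇ-false e , ≤ᵇ-false e′ ; (there h∈) → s h∈ })
                  (λ χ z → cong (χ h +_) (eq χ z))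

-- The number of states

bin : ℕ → ℕ → ℕ
bin zero    b       = 1
bin (suc a) zero    = 1
bin (suc a) (suc b) = bin a (suc b) + bin (suc a) b

bin≥1 : ∀ a b → 1 ≤ bin a b
bin≥1 zero    b       = ≤-refl
bin≥1 (suc a) zero    = ≤-refl
bin≥1 (suc a) (suc b) = ≤-trans (bin≥1 a (suc b)) (m≤m+n _ _)

bin-zero : ∀ a → bin a 0 ≡ 1
bin-zero zero    = refl
bin-zero (suc a) = refl

isNonEmpty-length : ∀ {A : Set} (xs : List A) → isNonEmpty xs ≡ true → 1 ≤ length xs
isNonEmpty-length (_ ∷ _) _ = s≤s z≤n

-- V a r: a large contractions suffice from r blocks on.  The states with a
-- large hedge split according to Pascal's rule, so the sum of the weights
-- bin a b over the states does not increase.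
module Weights (k m : ℕ) (V : ℕ → ℕ → Set) (V-mono : ∀ {a r r′} → r′ ≤ r → V a r → V a r′)
  (V-step : ∀ {a r r′} → V a r → r ≤ (r ∸ r′) * (k * 8) → r′ < r → 1 ≤ r′ → ∃[ a′ ] a ≡ suc a′ × V a′ r′) where

  data Weighted {n} : List (State n) → ℕ → Set where
    []    : ∀ {w} → Weighted [] w
    weigh : ∀ {a bl b hs fs w w′} → V a (length bl) → IsPartition bl → length hs ≤ m → bin a b + w′ ≤ w →
            Weighted fs w′ → Weighted ((bl , b , hs) ∷ fs) w

  weaken : ∀ {n} {fs : List (State n)} {w w′} → w′ ≤ w → Weighted fs w′ → Weighted fs w
  weaken le []                = []
  weaken le (weigh v V l e f) = weigh v V l (≤-trans e le) f

  -- Pascal's rule itself: contraction lowers `a`, deletion lowers `b`. With an exhausted budget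
  -- only the contraction remains, and both weights are 1.
  large-weighted : ∀ {n} (u : Vec Bool m) {a w w′} {bl F : List (Subset n)} {rest acc} → isNonEmpty F ≡ true →
    V (suc a) (length bl) → V a (length F) → IsPartition bl → IsPartition F → length rest ≤ m → ∀ b →
    bin (suc a) b + w′ ≤ w → Weighted acc w′ → Weighted (expandClassified k u bl b (F , rest) acc) w
  large-weighted u {a} {w′ = w′} ne v v′ P P′ l zero    le f rewrite ne =
    weigh v′ P′ l (≤-trans (≤-reflexive (cong (_+ w′) (bin-zero a))) le) f
  large-weighted u {a} {w′ = w′} ne v v′ P P′ l (suc b) le f rewrite ne =
    weigh v′ P′ l (≤-trans (≤-reflexive (sym (+-assoc (bin a (suc b)) (bin (suc a) b) w′))) le) (weigh v P l ≤-refl f)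

  -- A random contraction replaces a state by at most one other, whose weight may stay the same
  -- because `V` survives a decrease of the number of blocks. Only large hedges make the number of
  -- states grow.
  expand-weighted : ∀ {n} (u : Vec Bool m) {a w w′} {bl : List (Subset n)} {b hs acc} → V a (length bl) → IsPartition bl → length hs ≤ m →
    bin a b + w′ ≤ w → Weighted acc w′ → Weighted (expand k u (bl , b , hs) acc) w
  expand-weighted u {bl = bl} {b} {hs} v P l le f with classify k bl hs | classify-classified k bl hs | classify-length k bl hs
  expand-weighted u {a} {w} {w′} {bl} {b} v P l le f | _ | allSmall {[]} s eq | l′ = weigh v P z≤n le f
  expand-weighted u {a} {w} {w′} {bl} {b} v P l le f | _ | allSmall {r ∷ rest} s eq | l′ with pick u (r ∷ rest)
  ... | []    = weaken (≤-trans (m≤n+m w′ (bin a b)) le) f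
  ... | h ∷ _ = weigh (V-mono (contract-length P (hedge-nonempty h)) v) (contract-partition P (hedge-nonempty h)) (≤-trans l′ l) le f
  expand-weighted u v P l le f | F , rest | oneLarge {h} t lg refl ne eq | l′
    with a′ , refl , v′ ← V-step v lg (≰⇒> t) (isNonEmpty-length F ne) =
    large-weighted u ne v v′ P (contract-partition P (hedge-nonempty h)) (≤-trans l′ l) _ le f

  level-weighted : ∀ {n} (u : Vec Bool m) {fs : List (State n)} {w} → Weighted fs w → Weighted (level k u fs) w
  level-weighted u []                = []
  level-weighted u (weigh {hs = hs} v P l e f) = expand-weighted u {hs = hs} v P l e (level-weighted u f)

  weighted-bounded : ∀ {n s} {fs : List (State n)} {w} → m ≤ s → Weighted fs w → All (Bounded s) fs × length fs ≤ w
  weighted-bounded m≤s [] = [] , z≤n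
  weighted-bounded m≤s (weigh {a} {b = b} v P l e f) with ok , len ← weighted-bounded m≤s f =
    (P , ≤-trans l m≤s) ∷ ok , ≤-trans (+-mono-≤ (bin≥1 a b) len) e

  weightInvariant : ∀ {n} s W → m ≤ s → Invariant {n} k m s W
  weightInvariant s W m≤s = record
    { Inv       = λ fs → Weighted fs W
    ; inv-bound = λ f → let ok , len = weighted-bounded m≤s f in ok , m≤n⇒m≤1+n len
    ; inv-level = λ u f → level-weighted u f
    }

  initial-weighted : ∀ {n a j hs} → V a n → length hs ≤ m → Weighted (initial {n} j hs) (bin a j)
  initial-weighted {n} v l = weigh (subst (V _) (sym (singles-length n)) v) (singles-partition n) l (≤-reflexive (+-identityʳ _)) []

-- Sums over bit strings

∑-cong : ∀ N {f g : Vec Bool N → ℕ} → (∀ w → f w ≡ g w) → ∑ N f ≡ ∑ N g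
∑-cong zero    e = e []
∑-cong (suc N) e = cong₂ _+_ (∑-cong N (λ w → e (false ∷ w))) (∑-cong N (λ w → e (true ∷ w)))

∑-mono : ∀ N {f g : Vec Bool N → ℕ} → (∀ w → f w ≤ g w) → ∑ N f ≤ ∑ N g
∑-mono zero    e = e []
∑-mono (suc N) e = +-mono-≤ (∑-mono N (λ w → e (false ∷ w))) (∑-mono N (λ w → e (true ∷ w)))

∑-+ : ∀ N (f g : Vec Bool N → ℕ) → ∑ N (λ w → f w + g w) ≡ ∑ N f + ∑ N g
∑-+ zero    f g = refl
∑-+ (suc N) f g = trans (cong₂ _+_ (∑-+ N (f ∘ (false ∷_)) (g ∘ (false ∷_))) (∑-+ N (f ∘ (true ∷_)) (g ∘ (true ∷_)))) (eq (∑ N (f ∘ (false ∷_))) (∑ N (g ∘ (false ∷_))) (∑ N (f ∘ (true ∷_))) (∑ N (g ∘ (true ∷_))))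
  where eq : ∀ a b c d → a + b + (c + d) ≡ a + c + (b + d)
        eq = solve-∀

∑-* : ∀ N c (f : Vec Bool N → ℕ) → ∑ N (λ w → c * f w) ≡ c * ∑ N f
∑-* zero    c f = refl
∑-* (suc N) c f = trans (cong₂ _+_ (∑-* N c (f ∘ (false ∷_))) (∑-* N c (f ∘ (true ∷_)))) (sym (*-distribˡ-+ c (∑ N (f ∘ (false ∷_))) _))

∑-const : ∀ N c → ∑ N (λ _ → c) ≡ 2 ^ N * c
∑-const zero    c = sym (+-identityʳ c)
∑-const (suc N) c = trans (cong₂ _+_ (∑-const N c) (∑-const N c)) (eq (2 ^ N) c)
  where eq : ∀ a c → a * c + a * c ≡ 2 * a * c
        eq = solve-∀

∑-split : ∀ M N (g : Vec Bool M → Vec Bool N → ℕ) → ∑ (M + N) (λ w → g (Vec.take M w) (Vec.drop M w)) ≡ ∑ M (λ u → ∑ N (g u))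
∑-split zero    N g = refl
∑-split (suc M) N g = cong₂ _+_ (∑-split M N (λ u → g (false ∷ u))) (∑-split M N (λ u → g (true ∷ u)))

-- The distribution of the picked hedge

first : ∀ {A : Set} → List A → (A → ℕ) → ℕ
first []      f = 0
first (x ∷ _) f = f x

∑pick : ∀ {A : Set} m → List A → (A → ℕ) → ℕ
∑pick m xs f = ∑ m (λ u → first (pick u xs) f)

split-balanced : ∀ {A : Set} (xs : List A) a b → length a ≤ length b → length b ≤ suc (length a) →
  let p = List.foldl (λ p x → proj₂ p , x ∷ proj₁ p) (a , b) xs in
  length (proj₁ p) ≤ length (proj₂ p) × length (proj₂ p) ≤ suc (length (proj₁ p))
split-balanced []       a b p q = p , q
split-balanced (x ∷ xs) a b p q = split-balanced xs b (x ∷ a) q (s≤s p)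

split-sum : ∀ {A : Set} (f : A → ℕ) xs a b →
  let p = List.foldl (λ p x → proj₂ p , x ∷ proj₁ p) (a , b) xs in
  Σˡ (proj₁ p) f + Σˡ (proj₂ p) f ≡ Σˡ xs f + (Σˡ a f + Σˡ b f)
split-sum f []       a b = refl
split-sum f (x ∷ xs) a b = trans (split-sum f xs b (x ∷ a)) (eq (Σˡ xs f) (f x) (Σˡ a f) (Σˡ b f))
  where eq : ∀ s x a b → s + (b + (x + a)) ≡ x + s + (a + b)
        eq = solve-∀

pick-single : ∀ {A : Set} {m} (u : Vec Bool m) (x : A) → pick u (x ∷ []) ≡ x ∷ []
pick-single []      x = refl
pick-single (b ∷ u) x = pick-single u x

hasTwo-true : ∀ {A : Set} (xs : List A) → 2 ≤ length xs → hasTwo xs ≡ true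
hasTwo-true (_ ∷ [])     (s≤s ())
hasTwo-true (_ ∷ _ ∷ xs) _ = refl

module _ {A : Set} where

  ∑pick-step : ∀ m (xs : List A) f → 2 ≤ length xs →
    ∑pick (suc m) xs f ≡ ∑pick m (proj₂ (split xs)) f + ∑pick m (proj₁ (split xs)) f
  ∑pick-step m xs f le rewrite hasTwo-true xs le = refl

  ∑pick-single : ∀ m (x : A) f → ∑pick m (x ∷ []) f ≡ 2 ^ m * f x
  ∑pick-single m x f = trans (∑-cong m (λ u → cong (λ ys → first ys f) (pick-single u x))) (∑-const m (f x))

  split-total : ∀ (xs : List A) → length (proj₁ (split xs)) + length (proj₂ (split xs)) ≡ length xs
  split-total xs = trans (split-length xs [] []) (+-identityʳ _)

  split-lower : ∀ (xs : List A) c → 2 * c ≤ length xs → c ≤ length (proj₁ (split xs)) × c ≤ length (proj₂ (split xs))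
  split-lower xs c le = lower , ≤-trans lower p
    where
      a = length (proj₁ (split xs)); b = length (proj₂ (split xs))
      p = proj₁ (split-balanced xs [] [] z≤n z≤n)
      q = proj₂ (split-balanced xs [] [] z≤n z≤n)
      lower : c ≤ a
      lower with c ≤? a
      ... | yes l = l
      ... | no ¬l = ⊥-elim (<-irrefl refl (begin-strict
            length xs      ≡⟨ sym (split-total xs) ⟩
            a + b          ≤⟨ +-monoʳ-≤ a q ⟩
            a + suc a      <⟨ n<1+n _ ⟩
            suc (a + suc a) ≡⟨ eq a ⟩
            2 * suc a      ≤⟨ *-monoʳ-≤ 2 (≰⇒> ¬l) ⟩
            2 * c          ≤⟨ le ⟩
            length xs      ∎))
        where
          open ≤-Reasoning
          eq : ∀ a → suc (a + suc a) ≡ 2 * suc a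
          eq = solve-∀

  split-upper : ∀ (xs : List A) c → length xs ≤ 2 * c → length (proj₁ (split xs)) ≤ c × length (proj₂ (split xs)) ≤ c
  split-upper xs c le = ≤-trans p upper , upper
    where
      a = length (proj₁ (split xs)); b = length (proj₂ (split xs))
      p = proj₁ (split-balanced xs [] [] z≤n z≤n)
      q = proj₂ (split-balanced xs [] [] z≤n z≤n)
      upper : b ≤ c
      upper with b ≤? c
      ... | yes l = l
      ... | no ¬l = ⊥-elim (<-irrefl refl (begin-strict
            length xs      ≤⟨ le ⟩
            2 * c          <⟨ n<1+n _ ⟩
            suc (2 * c)    ≡⟨ eq c ⟩
            c + suc c      ≤⟨ +-mono-≤ (s≤s⁻¹ (≤-trans (≰⇒> ¬l) q)) (≰⇒> ¬l) ⟩
            a + b          ≡⟨ split-total xs ⟩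
            length xs      ∎))
        where
          open ≤-Reasoning
          eq : ∀ c → suc (2 * c) ≡ c + suc c
          eq = solve-∀

  -- Up to a factor of two, the picked element is uniformly distributed.
  ∑pick-bounds : ∀ d m (xs : List A) f → 2 ^ d ≤ length xs → length xs ≤ 2 * 2 ^ d → suc d ≤ m →
    2 ^ m * Σˡ xs f ≤ 2 * 2 ^ d * ∑pick m xs f × 2 ^ d * ∑pick m xs f ≤ 2 ^ m * Σˡ xs f
  ∑pick-bounds zero m [] f () le dm
  ∑pick-bounds zero m (x ∷ []) f ge le dm rewrite ∑pick-single m x f =
    ≤-trans (≤-reflexive (cong (2 ^ m *_) (+-identityʳ (f x)))) (m≤n*m _ 2) ,
    ≤-reflexive (trans (+-identityʳ _) (cong (2 ^ m *_) (sym (+-identityʳ (f x)))))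
  ∑pick-bounds zero (suc m) (x ∷ y ∷ []) f ge le dm rewrite ∑pick-single m x f | ∑pick-single m y f =
    ≤-reflexive (eq (2 ^ m) (f x) (f y)) , ≤-trans (≤-reflexive (eq′ (2 ^ m) (f x) (f y))) (*-monoˡ-≤ _ (m≤n*m (2 ^ m) 2))
    where
      eq : ∀ a x y → 2 * a * (x + (y + 0)) ≡ 2 * 1 * (a * y + a * x)
      eq = solve-∀
      eq′ : ∀ a x y → 1 * (a * y + a * x) ≡ a * (x + (y + 0))
      eq′ = solve-∀
  ∑pick-bounds zero m (x ∷ y ∷ z ∷ xs) f ge (s≤s (s≤s ())) dm
  ∑pick-bounds (suc d) (suc m) xs f ge le (s≤s dm)
    rewrite ∑pick-step m xs f (≤-trans (*-monoʳ-≤ 2 (m^n>0 2 d)) ge) =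
    (begin
      2 * 2 ^ m * Σˡ xs f                 ≡⟨ cong (2 * 2 ^ m *_) (sym sums) ⟩
      2 * 2 ^ m * (Σˡ a f + Σˡ b f)       ≡⟨ eq₁ (2 ^ m) (Σˡ a f) (Σˡ b f) ⟩
      2 * (2 ^ m * Σˡ a f + 2 ^ m * Σˡ b f) ≤⟨ *-monoʳ-≤ 2 (+-mono-≤ (proj₁ ihA) (proj₁ ihB)) ⟩
      2 * (2 * 2 ^ d * ∑pick m a f + 2 * 2 ^ d * ∑pick m b f) ≡⟨ eq₂ (2 ^ d) (∑pick m a f) (∑pick m b f) ⟩
      2 * (2 * 2 ^ d) * (∑pick m b f + ∑pick m a f) ∎) ,
    (begin
      2 * 2 ^ d * (∑pick m b f + ∑pick m a f) ≡⟨ eq₃ (2 ^ d) (∑pick m a f) (∑pick m b f) ⟩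
      2 * (2 ^ d * ∑pick m a f + 2 ^ d * ∑pick m b f) ≤⟨ *-monoʳ-≤ 2 (+-mono-≤ (proj₂ ihA) (proj₂ ihB)) ⟩
      2 * (2 ^ m * Σˡ a f + 2 ^ m * Σˡ b f) ≡⟨ sym (eq₁ (2 ^ m) (Σˡ a f) (Σˡ b f)) ⟩
      2 * 2 ^ m * (Σˡ a f + Σˡ b f)       ≡⟨ cong (2 * 2 ^ m *_) sums ⟩
      2 * 2 ^ m * Σˡ xs f                 ∎)
    where
      open ≤-Reasoning
      a = proj₁ (split xs)
      b = proj₂ (split xs)
      sums : Σˡ a f + Σˡ b f ≡ Σˡ xs f
      sums = trans (split-sum f xs [] []) (+-identityʳ _)
      ihA = ∑pick-bounds d m a f (proj₁ (split-lower xs (2 ^ d) ge)) (proj₁ (split-upper xs (2 * 2 ^ d) le)) dm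
      ihB = ∑pick-bounds d m b f (proj₂ (split-lower xs (2 ^ d) ge)) (proj₂ (split-upper xs (2 * 2 ^ d) le)) dm
      eq₁ : ∀ m a b → 2 * m * (a + b) ≡ 2 * (m * a + m * b)
      eq₁ = solve-∀
      eq₂ : ∀ d a b → 2 * (2 * d * a + 2 * d * b) ≡ 2 * (2 * d) * (b + a)
      eq₂ = solve-∀
      eq₃ : ∀ d a b → 2 * d * (b + a) ≡ 2 * (d * a + d * b)
      eq₃ = solve-∀

  ∑pick-const : ∀ m (xs : List A) c → 1 ≤ length xs → ∑pick m xs (λ _ → c) ≡ 2 ^ m * c
  ∑pick-const zero    (x ∷ xs)       c le = sym (+-identityʳ c)
  ∑pick-const (suc m) (x ∷ [])       c le = ∑pick-single (suc m) x (λ _ → c)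
  ∑pick-const (suc m) xs@(_ ∷ _ ∷ _) c le =
    trans (cong₂ _+_ (∑pick-const m (proj₂ (split xs)) c (proj₂ ge)) (∑pick-const m (proj₁ (split xs)) c (proj₁ ge))) (eq (2 ^ m) c)
    where
      ge = split-lower xs 1 (s≤s (s≤s z≤n))
      eq : ∀ a c → a * c + a * c ≡ 2 * a * c
      eq = solve-∀

  first-+ : ∀ (xs : List A) f g → first xs (λ x → f x + g x) ≡ first xs f + first xs g
  first-+ []      f g = refl
  first-+ (_ ∷ _) f g = refl

  first-* : ∀ (xs : List A) c f → first xs (λ x → c * f x) ≡ c * first xs f
  first-* []      c f = sym (*-zeroʳ c)
  first-* (_ ∷ _) c f = refl

  first-mono : ∀ (xs : List A) {f g} → (∀ {x} → x ∈ˡ xs → f x ≤ g x) → first xs f ≤ first xs g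
  first-mono []      le = z≤n
  first-mono (_ ∷ _) le = le (here refl)

  split-∈ : ∀ (xs : List A) a b {x} →
    let p = List.foldl (λ p x → proj₂ p , x ∷ proj₁ p) (a , b) xs in
    x ∈ˡ proj₁ p ⊎ x ∈ˡ proj₂ p → x ∈ˡ xs ⊎ x ∈ˡ a ⊎ x ∈ˡ b
  split-∈ []       a b p = inj₂ p
  split-∈ (y ∷ ys) a b p with split-∈ ys b (y ∷ a) p
  ... | inj₁ q                     = inj₁ (there q)
  ... | inj₂ (inj₁ q)              = inj₂ (inj₂ q)
  ... | inj₂ (inj₂ (here refl))    = inj₁ (here refl)
  ... | inj₂ (inj₂ (there q))      = inj₂ (inj₁ q)

  pick-∈ : ∀ {m} (u : Vec Bool m) (xs : List A) {x} → x ∈ˡ pick u xs → x ∈ˡ xs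
  pick-∈ []      xs p = p
  pick-∈ (b ∷ u) xs p = halve-∈ b xs (pick-∈ u (halve b xs) p)
    where
      clean : ∀ {xs : List A} {x} → x ∈ˡ xs ⊎ x ∈ˡ [] ⊎ x ∈ˡ [] → x ∈ˡ xs
      clean (inj₁ q) = q
      clean (inj₂ (inj₁ ()))
      clean (inj₂ (inj₂ ()))
      halve-∈ : ∀ b (xs : List A) {x} → x ∈ˡ halve b xs → x ∈ˡ xs
      halve-∈ b     xs p with hasTwo xs
      halve-∈ b     xs p | false = p
      halve-∈ true  xs p | true  = clean (split-∈ xs [] [] (inj₁ p))
      halve-∈ false xs p | true  = clean (split-∈ xs [] [] (inj₂ p))

-- The last bound shows that one random bit per hedge suffices for the choice among the hedges.
dyadic : ∀ x → 1 ≤ x → ∃[ d ] 2 ^ d ≤ x × x ≤ 2 * 2 ^ d × suc d ≤ x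
dyadic (suc zero)    _ = 0 , ≤-refl , s≤s z≤n , ≤-refl
dyadic (suc (suc x)) _ with d , p , q , r ← dyadic (suc x) (s≤s z≤n) with suc (suc x) ≤? 2 * 2 ^ d
... | yes l = d , m≤n⇒m≤1+n p , l , m≤n⇒m≤1+n r
... | no ¬l = suc d , <⇒≤ (≰⇒> ¬l) , ≤-trans (s≤s q) (≤-trans (+-mono-≤ (m^n>0 2 (suc d)) ≤-refl) (≤-reflexive (cong (2 ^ suc d +_) (sym (+-identityʳ _))))) , s≤s r

allPairs-++⁻ : ∀ {A : Set} {R : A → A → Set} xs {ys} → AllPairs R (xs ++ ys) →
  AllPairs R xs × AllPairs R ys × (∀ {x y} → x ∈ˡ xs → y ∈ˡ ys → R x y)
allPairs-++⁻ []       ds       = [] , ds , λ ()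
allPairs-++⁻ (x ∷ xs) (d ∷ ds) with p , q , r ← allPairs-++⁻ xs ds =
  Allₚ.++⁻ˡ xs d ∷ p , q , λ { (here refl) y∈ → All.lookup (Allₚ.++⁻ʳ xs d) y∈ ; (there x∈) y∈ → r x∈ y∈ }

-- Any block outside the window `ys` will do. It makes the last part of the cut `isolate ys`
-- non-empty.
other-block : ∀ {n} (xs ys zs : List (Subset n)) → AllPairs Disjoint (xs ++ (ys ++ zs)) → length ys < length (xs ++ (ys ++ zs)) →
  ∃[ Z ] Z ∈ˡ (xs ++ (ys ++ zs)) × (∀ {B} → B ∈ˡ ys → Disjoint Z B)
other-block (Z ∷ xs) ys zs (d ∷ _) _ = Z , here refl , λ B∈ → All.lookup d (Anyₚ.++⁺ʳ xs (Anyₚ.++⁺ˡ B∈))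
other-block [] ys (Z ∷ zs) ds _ = Z , Anyₚ.++⁺ʳ ys (here refl) ,
  λ B∈ p q → proj₂ (proj₂ (allPairs-++⁻ ys ds)) B∈ (here refl) q p
other-block [] ys [] ds lt = ⊥-elim (<-irrefl (sym (cong length (Listₚ.++-identityʳ ys))) lt)

-- The summand h * ℓ accounts for the last, incomplete group.
consecutive-sums : ∀ {A : Set} (d : A → ℕ) (xs₀ : List A) h ℓ → 1 ≤ h →
  (∀ xs ys zs → xs₀ ≡ xs ++ (ys ++ zs) → length ys ≡ h → ℓ ≤ Σˡ ys d) →
  ∀ fuel pre suf → length suf ≤ fuel → xs₀ ≡ pre ++ suf → length suf * ℓ ≤ h * Σˡ suf d + h * ℓ
consecutive-sums d xs₀ h ℓ 1≤h H fuel pre suf fl eq with length suf ≤? h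
... | yes l = ≤-trans (*-monoˡ-≤ ℓ l) (m≤n+m _ _)
consecutive-sums d xs₀ h ℓ 1≤h H zero    pre []  fl eq | no ¬l = contradiction z≤n ¬l
consecutive-sums d xs₀ h ℓ 1≤h H (suc fuel) pre suf fl eq | no ¬l = begin
  length suf * ℓ                                   ≡⟨ cong (_* ℓ) len ⟩
  (h + length zs) * ℓ                              ≡⟨ *-distribʳ-+ ℓ h (length zs) ⟩
  h * ℓ + length zs * ℓ                            ≤⟨ +-mono-≤ (*-monoʳ-≤ h (H pre ys zs (trans eq (cong (pre ++_) (sym whole))) len-ys))
                                                               (consecutive-sums d xs₀ h ℓ 1≤h H fuel (pre ++ ys) zs shorter
                                                                 (trans eq (trans (cong (pre ++_) (sym whole)) (sym (Listₚ.++-assoc pre ys zs))))) ⟩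
  h * Σˡ ys d + (h * Σˡ zs d + h * ℓ)              ≡⟨ eq′ h (Σˡ ys d) (Σˡ zs d) (h * ℓ) ⟩
  h * (Σˡ ys d + Σˡ zs d) + h * ℓ                  ≡⟨ cong (λ s → h * s + h * ℓ) (trans (sym (Σˡ-++ ys zs d)) (cong (λ s → Σˡ s d) whole)) ⟩
  h * Σˡ suf d + h * ℓ                             ∎
  where
    open ≤-Reasoning
    ys = List.take h suf
    zs = List.drop h suf
    whole : ys ++ zs ≡ suf
    whole = Listₚ.take++drop≡id h suf
    len-ys : length ys ≡ h
    len-ys = trans (Listₚ.length-take h suf) (m≤n⇒m⊓n≡m (<⇒≤ (≰⇒> ¬l)))
    len : length suf ≡ h + length zs
    len = trans (cong length (sym whole)) (trans (Listₚ.length-++ ys) (cong (_+ length zs) len-ys))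
    shorter : length zs ≤ fuel
    shorter = s≤s⁻¹ (≤-trans (≤-trans (+-monoˡ-≤ (length zs) 1≤h) (≤-reflexive (sym len))) fl)
    eq′ : ∀ h a b c → h * a + (h * b + c) ≡ h * (a + b) + c
    eq′ = solve-∀

-- (1 − r / (q + r))ᵉ (1 + e r / (q + r)) ≤ 1, without division.
bernoulli : ∀ q r e → q ^ e * (q + r + e * r) ≤ (q + r) ^ e * (q + r)
bernoulli q r zero    = ≤-reflexive (eq q r)
  where eq : ∀ q r → 1 * (q + r + 0 * r) ≡ 1 * (q + r)
        eq = solve-∀
bernoulli q r (suc e) = begin
  q * q ^ e * (q + r + suc e * r)               ≡⟨ eq₁ q r e (q ^ e) ⟩
  q ^ e * (q * (q + r + suc e * r))             ≤⟨ *-monoʳ-≤ (q ^ e) (m≤m+n _ (r * (r + e * r))) ⟩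
  q ^ e * (q * (q + r + suc e * r) + r * (r + e * r)) ≡⟨ eq₂ q r e (q ^ e) ⟩
  (q + r) * (q ^ e * (q + r + e * r))           ≤⟨ *-monoʳ-≤ (q + r) (bernoulli q r e) ⟩
  (q + r) * ((q + r) ^ e * (q + r))             ≡⟨ sym (*-assoc (q + r) _ (q + r)) ⟩
  (q + r) * (q + r) ^ e * (q + r)               ∎
  where
    open ≤-Reasoning
    eq₁ : ∀ q r e x → q * x * (q + r + suc e * r) ≡ x * (q * (q + r + suc e * r))
    eq₁ = solve-∀
    eq₂ : ∀ q r e x → x * (q * (q + r + suc e * r) + r * (r + e * r)) ≡ (q + r) * (x * (q + r + e * r))
    eq₂ = solve-∀

anyᵇ : ∀ {A : Set} → (A → Bool) → List A → Bool
anyᵇ p []       = false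
anyᵇ p (x ∷ xs) = p x ∨ anyᵇ p xs

anyᵇ-≥ : ∀ {A : Set} (p : A → Bool) {xs x} → x ∈ˡ xs → ⟨ p x ⟩ ≤ ⟨ anyᵇ p xs ⟩
anyᵇ-≥ p {y ∷ ys} (here refl) with p y
... | true  = ≤-refl
... | false = z≤n
anyᵇ-≥ p {y ∷ ys} (there x∈) with p y
... | true  = ⟨⟩≤1 _
... | false = anyᵇ-≥ p x∈

anyᵇ-elim : ∀ {A : Set} (p : A → Bool) xs → anyᵇ p xs ≡ true → ∃[ x ] x ∈ˡ xs × p x ≡ true
anyᵇ-elim p (x ∷ xs) e with p x in q
... | true  = x , here refl , q
... | false with y , y∈ , r ← anyᵇ-elim p xs e = y , there y∈ , r

-- The success probability of one trial

module _ {n : ℕ} (k j : ℕ) (hs₀ : List (Hedge n)) where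

  accepts : State n → Bool
  accepts st = Maybe.is-just (candidate k j hs₀ (proj₁ st))

  -- The descendants of one state alone, on the same bits as the whole level. `leads-levels` finds
  -- them again among the states of the actual search.
  leads : ∀ {m} lv → Vec Bool (lv * m) → State n → Bool
  leads         zero     w st = accepts st
  leads {m = m} (suc lv) w st = anyᵇ (leads lv (Vec.drop m w)) (expand k (Vec.take m w) st [])

  successes : ∀ m lv → State n → ℕ
  successes m lv st = ∑ (lv * m) (λ w → ⟨ leads lv w st ⟩)

  successes-step : ∀ m lv st → successes m (suc lv) st ≡
    ∑ m (λ u → ∑ (lv * m) (λ v → ⟨ anyᵇ (leads lv v) (expand k u st []) ⟩))
  successes-step m lv st = ∑-split m (lv * m) (λ u v → ⟨ anyᵇ (leads lv v) (expand k u st []) ⟩)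

  first-∑ : ∀ {A : Set} N (xs : List A) (g : A → Vec Bool N → ℕ) → ∑ N (λ v → first xs (λ x → g x v)) ≡ first xs (λ x → ∑ N (g x))
  first-∑ N []      g = trans (∑-const N 0) (*-zeroʳ (2 ^ N))
  first-∑ N (_ ∷ _) g = refl

  any-contractHead : ∀ bl b rest hs (p : State n → Bool) →
    ⟨ anyᵇ p (contractHead k bl b rest hs []) ⟩ ≡ first hs (λ h → ⟨ p (contract bl (components h) , b , rest) ⟩)
  any-contractHead bl b rest []      p = refl
  any-contractHead bl b rest (h ∷ _) p with p (contract bl (components h) , b , rest)
  ... | true  = refl
  ... | false = refl

-- The run of the search that follows an optimum cut P: a large hedge is
-- deleted if P cuts it and contracted otherwise, and no random contraction
-- hits a hedge cut by P.
module Success {n k : ℕ} (2≤k : 2 ≤ k) (m : ℕ) (hs₀ : List (Hedge n)) (P : Fin n → Fin k)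
  (P-onto : StrictlySurjective _≡_ P) (ℓ j : ℕ) (value : Σˡ hs₀ (cuts P) ≡ ℓ)
  (optimal : ∀ {k′} → k′ ≡ k → (f : Fin n → Fin k′) → StrictlySurjective _≡_ f → ℓ ≤ Σˡ hs₀ (cuts f))
  (ℓ≤j : ℓ ≤ j) where

  -- Blocks respect `P`, and `deleted` counts the deleted hedges, all cut by `P`. The field
  -- `accounted` says that for every cut that still respects the blocks, the hedges it cuts are
  -- deleted or present: those dropped or contracted lie inside blocks. It allows other cuts than
  -- `P` to be compared with ℓ.
  record Good (st : State n) : Set where
    constructor good
    field
      partition : IsPartition (proj₁ st)
      coarser   : Coarser P (proj₁ st)
      few       : length (proj₂ (proj₂ st)) ≤ m
      deleted   : ℕ
      total     : deleted + Σˡ (proj₂ (proj₂ st)) (cuts P) ≡ ℓ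
      budget    : Σˡ (proj₂ (proj₂ st)) (cuts P) ≤ proj₁ (proj₂ st)
      accounted : ∀ {k′} (f : Fin n → Fin k′) → Coarser f (proj₁ st) →
                  Σˡ hs₀ (cuts f) ≤ deleted + Σˡ (proj₂ (proj₂ st)) (cuts f)
  open Good

  -- Every part of `P` contains a vertex, and blocks that respect `P` cannot contain vertices of two
  -- parts.
  blocks≥k : ∀ {bl} → IsPartition bl → Coarser P bl → k ≤ length bl
  blocks≥k {bl} V c = Finₚ.injective⇒≤ {f = index} inj
    where
      vertex : Fin k → Fin n
      vertex i = proj₁ (P-onto i)
      block∈ : ∀ i → proj₁ (covers V (vertex i)) ∈ˡ bl
      block∈ i = proj₁ (proj₂ (covers V (vertex i)))
      index : Fin k → Fin (length bl)
      index i = Any.index (block∈ i)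
      inj : ∀ {i i′} → index i ≡ index i′ → i ≡ i′
      inj {i} {i′} e = trans (sym (proj₂ (P-onto i))) (trans
        (c (block∈ i) (proj₂ (proj₂ (covers V (vertex i))))
          (subst (vertex i′ ∈_) (trans (Anyₚ.lookup-index (block∈ i′)) (trans (cong (List.lookup bl) (sym e)) (sym (Anyₚ.lookup-index (block∈ i)))))
            (proj₂ (proj₂ (covers V (vertex i′))))))
        (proj₂ (P-onto i′)))

  trivial-cuts : ∀ {k′ bl} (f : Fin n → Fin k′) → IsPartition bl → Coarser f bl → ∀ h → Trivial k bl h → cuts f h ≡ 0
  trivial-cuts f V c h t = cuts-constant {h = h} (trivial-constant V (hedge-nonempty h) c t)

  contracted-cuts : ∀ {k′} bl (f : Fin n → Fin k′) h → Coarser f (contract bl (components h)) → cuts f h ≡ 0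
  contracted-cuts bl f h c = cuts-constant {h = h} (All.tabulate λ A∈ {u} {v} p q →
    let F , F∈ , i = contract-⊇ bl (components h) A∈ in c F∈ (i p) (i q))

  good-contract : ∀ {bl b hs rest h} → Good (bl , b , hs) → cuts P h ≡ 0 → length rest ≤ m →
    Σˡ hs (cuts P) ≡ Σˡ rest (cuts P) →
    (∀ {k′} (f : Fin n → Fin k′) → Coarser f bl → cuts f h ≡ 0 → Σˡ hs (cuts f) ≡ Σˡ rest (cuts f)) →
    Good (contract bl (components h) , b , rest)
  good-contract {bl} {b} {hs} {rest} {h} g c l eqP eqf = good
    (contract-partition (partition g) (hedge-nonempty h))
    (coarser-contract P (coarser g) (uncut-constant {h = h} (uncut h c)))
    l (deleted g) (trans (cong (deleted g +_) (sym eqP)) (total g))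
    (subst (_≤ b) eqP (budget g))
    (λ f cf → let cf′ = coarser-refines f (refines-contract bl (components h)) cf in
      subst (λ s → Σˡ hs₀ (cuts f) ≤ deleted g + s) (eqf f cf′ (contracted-cuts bl f h cf)) (accounted g f cf′))
    where
      uncut : ∀ h → cuts P h ≡ 0 → ¬ IsCutBy h P
      uncut h e p with cut? P h
      uncut h () p | yes _
      ... | no ¬p = ¬p p

  good-delete : ∀ {bl b hs rest h} → Good (bl , suc b , hs) → cuts P h ≡ 1 → length rest ≤ m →
    SameSum k bl hs (h ∷ rest) → Good (bl , b , rest)
  good-delete {bl} {b} {hs} {rest} {h} g c l eq = good (partition g) (coarser g) l (suc (deleted g))
    (trans (sym (+-suc (deleted g) _)) (trans (cong (deleted g +_) (sym eqP)) (total g)))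
    (s≤s⁻¹ (subst (_≤ suc b) eqP (budget g)))
    (λ f cf → ≤-trans (accounted g f cf) (≤-trans (+-monoʳ-≤ (deleted g)
      (≤-trans (≤-reflexive (eq (cuts f) (trivial-cuts f (partition g) cf))) (+-monoˡ-≤ (Σˡ rest (cuts f)) (⟨⟩≤1 _))))
      (≤-reflexive (+-suc (deleted g) _))))
    where
      eqP : Σˡ hs (cuts P) ≡ suc (Σˡ rest (cuts P))
      eqP = trans (eq (cuts P) (trivial-cuts P (partition g) (coarser g))) (cong (_+ Σˡ rest (cuts P)) c)

  good-rest : ∀ {bl b hs rest} → Good (bl , b , hs) → length rest ≤ m → SameSum k bl hs rest → Good (bl , b , rest)
  good-rest {bl} {b} {hs} {rest} g l eq = good (partition g) (coarser g) l (deleted g)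
    (trans (cong (deleted g +_) (sym eqP)) (total g)) (subst (_≤ b) eqP (budget g))
    (λ f cf → subst (λ s → Σˡ hs₀ (cuts f) ≤ deleted g + s) (eq (cuts f) (trivial-cuts f (partition g) cf)) (accounted g f cf))
    where eqP = eq (cuts P) (trivial-cuts P (partition g) (coarser g))

  1≤k : 1 ≤ k
  1≤k = ≤-trans (s≤s z≤n) 2≤k

  -- With no hedge left, `accounted` shows that every cut that respects the blocks cuts at most the
  -- ℓ deleted hedges. The coarsening may thus merge arbitrary blocks and need not recover `P`.
  good-accepts : ∀ {bl b} → Good (bl , b , []) → accepts k j hs₀ (bl , b , []) ≡ true
  good-accepts {bl} {b} g with k ≤ᵇ length bl in e
  ... | false = ⊥-elim (subst T e (≤⇒≤ᵇ (blocks≥k (partition g) (coarser g))))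
  ... | true with count (List.map (cutTest (coarsen k bl)) hs₀) ≤ᵇ j in e′
  ...   | true  = refl
  ...   | false = ⊥-elim (subst T e′ (≤⇒≤ᵇ (≤-trans (≤-reflexive count-cuts) (≤-trans (accounted g f f-coarser)
            (≤-trans (≤-reflexive (total g)) ℓ≤j)))))
    where
      U  = unions (proj₁ (surplus bl 1≤k e)) (proj₁ (proj₂ (surplus bl 1≤k e)))
      Os = proj₂ (mergeParts bl U)
      V′ : IsPartition (merge bl U)
      V′ = merge-partition (partition g) (surplus-nonempty bl 1≤k e (partition g))
      f = isolate Os
      f-coarser : Coarser f bl
      f-coarser = coarser-refines f (refines-merge bl U) (isolate-coarser V′ Os there)
      count-map : ∀ hs → count (List.map (cutTest (merge bl U)) hs) ≡ Σˡ hs (cuts f)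
      count-map []       = refl
      count-map (h ∷ hs) rewrite cutTest-cut V′ h with does (cut? f h)
      ... | true  = cong suc (count-map hs)
      ... | false = count-map hs
      count-cuts : count (List.map (cutTest (coarsen k bl)) hs₀) ≡ Σˡ hs₀ (cuts f)
      count-cuts = trans (cong (λ Y → count (List.map (cutTest Y) hs₀)) (coarsen-merge bl 1≤k e)) (count-map hs₀)

  finished-leads : ∀ {bl b} → Good (bl , b , []) → ∀ lv (w : Vec Bool (lv * m)) → leads k j hs₀ lv w (bl , b , []) ≡ true
  finished-leads g zero     w = good-accepts g
  finished-leads g (suc lv) w rewrite finished-leads g lv (Vec.drop m w) = refl

  module Small {bl b hs rest} (g : Good (bl , b , hs)) (small : ∀ {h} → h ∈ˡ rest → ¬ Trivial k bl h × ¬ Large k bl h)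
    (same : SameSum k bl hs rest) where

    degree-of : Subset n → ℕ
    degree-of B = Σˡ rest (λ h → ⟨ touches (components h) B ⟩)

    N = length bl
    ℓ′ = Σˡ rest (cuts P)

    -- Isolating the blocks ys is a k-cut, so it is not better than P.
    window : ∀ xs ys zs → bl ≡ xs ++ (ys ++ zs) → suc (length ys) ≡ k → ℓ′ ≤ Σˡ ys degree-of
    window xs ys zs eq lys = ≤-trans (+-cancelˡ-≤ (deleted g) ℓ′ _ cheaper) (≤-trans touched (≤-reflexive (Σˡ-swap rest ys (λ h B → ⟨ touches (components h) B ⟩))))
      where
        f = isolate ys
        V = partition g
        ⊆bl : ∀ {B} → B ∈ˡ (xs ++ (ys ++ zs)) → B ∈ˡ bl
        ⊆bl = subst (_ ∈ˡ_) (sym eq)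
        ys⊆ : ∀ {B} → B ∈ˡ ys → B ∈ˡ bl
        ys⊆ B∈ = ⊆bl (Anyₚ.++⁺ʳ xs (Anyₚ.++⁺ˡ B∈))
        cf : Coarser f bl
        cf = isolate-coarser V ys ys⊆
        parts = allPairs-++⁻ xs (subst (AllPairs Disjoint) eq (IsPartition.disjoint V))
        parts′ = allPairs-++⁻ ys (proj₁ (proj₂ parts))
        long : length ys < length (xs ++ (ys ++ zs))
        long = subst (λ bl′ → length ys < length bl′) eq (≤-trans (≤-reflexive lys) (blocks≥k V (coarser g)))
        onto : StrictlySurjective _≡_ f
        onto with Z , Z∈ , dis ← other-block xs ys zs (subst (AllPairs Disjoint) eq (IsPartition.disjoint V)) long with u , p ← nonempty V (⊆bl Z∈) =
          isolate-surjective ys (proj₁ parts′) (All.tabulate (λ B∈ → nonempty V (ys⊆ B∈))) u (λ B∈ q → dis B∈ p q)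
        cheaper : deleted g + ℓ′ ≤ deleted g + Σˡ rest (cuts f)
        cheaper = begin
          deleted g + ℓ′                    ≡⟨ cong (deleted g +_) (sym (same (cuts P) (trivial-cuts P V (coarser g)))) ⟩
          deleted g + Σˡ hs (cuts P)        ≡⟨ total g ⟩
          ℓ                                 ≤⟨ optimal lys f onto ⟩
          Σˡ hs₀ (cuts f)                   ≤⟨ accounted g f cf ⟩
          deleted g + Σˡ hs (cuts f)        ≡⟨ cong (deleted g +_) (same (cuts f) (trivial-cuts f V cf)) ⟩
          deleted g + Σˡ rest (cuts f)      ∎
          where open ≤-Reasoning
        touched : Σˡ rest (cuts f) ≤ Σˡ rest (λ h → Σˡ ys (λ B → ⟨ touches (components h) B ⟩))
        touched = Σˡ-mono rest (λ {h} _ → isolate-cuts ys h)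

    r : Hedge n → ℕ
    r = reduction k bl

    degrees : Σˡ bl degree-of ≤ 2 * Σˡ rest r
    degrees = begin
      Σˡ bl degree-of                                                  ≡⟨ Σˡ-swap bl rest (λ B h → ⟨ touches (components h) B ⟩) ⟩
      Σˡ rest (λ h → Σˡ bl (λ B → ⟨ touches (components h) B ⟩))       ≤⟨ Σˡ-mono rest (λ {h} _ → bound h) ⟩
      Σˡ rest (λ h → 2 * r h)                                          ≡⟨ Σˡ-* rest 2 r ⟩
      2 * Σˡ rest r                                                    ∎
      where
        open ≤-Reasoning
        bound : ∀ h → Σˡ bl (λ B → ⟨ touches (components h) B ⟩) ≤ 2 * r h
        bound h = ≤-trans (m+n≤o⇒m≤o∸n _ (contract-touches (partition g) (hedge-nonempty h)))
                    (≤-reflexive (sym (*-distribˡ-∸ 2 (length bl) (length (contract bl (components h))))))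

    uncutReduction : Hedge n → ℕ
    uncutReduction h = (1 ∸ cuts P h) * r h

    reductions : Σˡ rest r ≡ Σˡ rest uncutReduction + Σˡ rest (λ h → cuts P h * r h)
    reductions = trans (Σˡ-cong rest split-r) (Σˡ-+ rest uncutReduction (λ h → cuts P h * r h))
      where
        split-r : ∀ h → r h ≡ (1 ∸ cuts P h) * r h + cuts P h * r h
        split-r h with does (cut? P h)
        ... | true  = sym (+-identityʳ _)
        ... | false = sym (trans (+-identityʳ _) (+-identityʳ _))

    -- Each of the ℓ′ hedges that `P` cuts fails to be large and so removes less than N / (8k)
    -- blocks.
    cut-reductions : Σˡ rest (λ h → cuts P h * r h) * (k * 8) ≤ ℓ′ * N
    cut-reductions = begin
      Σˡ rest (λ h → cuts P h * r h) * (k * 8)       ≡⟨ *-comm _ (k * 8) ⟩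
      k * 8 * Σˡ rest (λ h → cuts P h * r h)         ≡⟨ sym (Σˡ-* rest (k * 8) (λ h → cuts P h * r h)) ⟩
      Σˡ rest (λ h → k * 8 * (cuts P h * r h))       ≤⟨ Σˡ-mono rest (λ {h} h∈ → each h (<⇒≤ (≰⇒> (proj₂ (small h∈))))) ⟩
      Σˡ rest (λ h → N * cuts P h)                   ≡⟨ Σˡ-* rest N (cuts P) ⟩
      N * ℓ′                                         ≡⟨ *-comm N ℓ′ ⟩
      ℓ′ * N                                         ∎
      where
        open ≤-Reasoning
        each : ∀ h → r h * (k * 8) ≤ N → k * 8 * (cuts P h * r h) ≤ N * cuts P h
        each h le = ≤-trans (≤-reflexive (eq (k * 8) (cuts P h) (r h))) (*-monoˡ-≤ (cuts P h) le)
          where eq : ∀ a c r → a * (c * r) ≡ r * a * c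
                eq = solve-∀

    h₀ = pred k

    suc-h₀ : suc h₀ ≡ k
    suc-h₀ = suc-pred k {{>-nonZero 1≤k}}

    -- The N blocks are divided into groups of k - 1, each of degree sum at least ℓ′. The incomplete
    -- last group costs at most one more total degree sum, since a full window fits into the N
    -- blocks: a factor 2. Passing from degrees to removed blocks gives the other factor 2.
    average : N * ℓ′ ≤ 4 * k * Σˡ rest r
    average = begin
      N * ℓ′                                   ≤⟨ consecutive-sums degree-of bl h₀ ℓ′ (s≤s⁻¹ (subst (2 ≤_) (sym suc-h₀) 2≤k)) window′ N [] bl ≤-refl refl ⟩
      h₀ * Σˡ bl degree-of + h₀ * ℓ′           ≤⟨ +-monoʳ-≤ _ (*-monoʳ-≤ h₀ first-window) ⟩
      h₀ * Σˡ bl degree-of + h₀ * Σˡ bl degree-of ≤⟨ +-mono-≤ (*-mono-≤ h₀≤k degrees) (*-mono-≤ h₀≤k degrees) ⟩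
      k * (2 * Σˡ rest r) + k * (2 * Σˡ rest r) ≡⟨ eq k (Σˡ rest r) ⟩
      4 * k * Σˡ rest r                        ∎
      where
        open ≤-Reasoning
        eq : ∀ k r → k * (2 * r) + k * (2 * r) ≡ 4 * k * r
        eq = solve-∀
        h₀≤k : h₀ ≤ k
        h₀≤k = pred[n]≤n {k}
        window′ : ∀ xs ys zs → bl ≡ xs ++ (ys ++ zs) → length ys ≡ h₀ → ℓ′ ≤ Σˡ ys degree-of
        window′ xs ys zs eq l = window xs ys zs eq (trans (cong suc l) suc-h₀)
        first-window : ℓ′ ≤ Σˡ bl degree-of
        first-window = ≤-trans (window′ [] (List.take h₀ bl) (List.drop h₀ bl) (sym (Listₚ.take++drop≡id h₀ bl))
            (trans (Listₚ.length-take h₀ bl) (m≤n⇒m⊓n≡m (≤-trans h₀≤k (blocks≥k (partition g) (coarser g))))))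
          (≤-trans (m≤m+n _ (Σˡ (List.drop h₀ bl) degree-of))
            (≤-reflexive (trans (sym (Σˡ-++ (List.take h₀ bl) _ degree-of)) (cong (λ xs → Σˡ xs degree-of) (Listₚ.take++drop≡id h₀ bl)))))

    -- Twice `average`, minus `cut-reductions`: the threshold 8k is chosen such that the cut hedges
    -- use up only one of the two copies of N ℓ′.
    progress : N * ℓ′ ≤ k * 8 * Σˡ rest uncutReduction
    progress = +-cancelʳ-≤ (N * ℓ′) _ _ (begin
      N * ℓ′ + N * ℓ′                                    ≤⟨ +-mono-≤ average average ⟩
      4 * k * Σˡ rest r + 4 * k * Σˡ rest r              ≡⟨ cong (λ s → 4 * k * s + 4 * k * s) reductions ⟩
      4 * k * (a + c) + 4 * k * (a + c)                  ≡⟨ eq k a c ⟩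
      k * 8 * a + c * (k * 8)                            ≤⟨ +-monoʳ-≤ (k * 8 * a) cut-reductions ⟩
      k * 8 * a + ℓ′ * N                                 ≡⟨ cong (k * 8 * a +_) (*-comm ℓ′ N) ⟩
      k * 8 * a + N * ℓ′                                 ∎)
      where
        open ≤-Reasoning
        a = Σˡ rest uncutReduction
        c = Σˡ rest (λ h → cuts P h * r h)
        eq : ∀ k a c → 4 * k * (a + c) + 4 * k * (a + c) ≡ k * 8 * a + c * (k * 8)
        eq = solve-∀

    -- By `bernoulli`, a lower bound for N · (N / q)^(16k), where q blocks remain after contracting
    -- an uncut hedge; a cut hedge gains nothing. It is linear in the removed blocks, so its mean
    -- can be computed.
    gain : Hedge n → ℕ
    gain h = (1 ∸ cuts P h) * (N + 16 * k * r h)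

    -- The term N lost with cut hedges is made up for by the term in `r` of the others, by
    -- `progress`. The 8k there becomes 16k because the pick is uniform only up to a factor of two.
    expected-gain : 1 ≤ length rest → length rest ≤ m → N * 2 ^ m ≤ ∑pick m rest gain
    expected-gain ge le with d , d≤ , ≤d , sd ← dyadic (length rest) ge = +-cancelʳ-≤ (N * ∑pick m rest (cuts P)) _ _ (begin
      N * 2 ^ m + N * ∑pick m rest (cuts P)                          ≤⟨ +-monoʳ-≤ (N * 2 ^ m) losses ⟩
      N * 2 ^ m + 16 * k * ∑pick m rest uncutReduction               ≡⟨ sym identity ⟩
      ∑pick m rest gain + N * ∑pick m rest (cuts P)                  ∎)
      where
        open ≤-Reasoning
        D = 2 ^ d
        bounds-u = proj₁ (∑pick-bounds d m rest uncutReduction d≤ ≤d (≤-trans sd le))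
        bounds-c = proj₂ (∑pick-bounds d m rest (cuts P) d≤ ≤d (≤-trans sd le))
        losses : N * ∑pick m rest (cuts P) ≤ 16 * k * ∑pick m rest uncutReduction
        losses = *-cancelˡ-≤ D {{m^n≢0 2 d}} (begin
          D * (N * ∑pick m rest (cuts P))                  ≡⟨ eq₁ D N (∑pick m rest (cuts P)) ⟩
          N * (D * ∑pick m rest (cuts P))                  ≤⟨ *-monoʳ-≤ N bounds-c ⟩
          N * (2 ^ m * ℓ′)                                 ≡⟨ eq₁ N (2 ^ m) ℓ′ ⟩
          2 ^ m * (N * ℓ′)                                 ≤⟨ *-monoʳ-≤ (2 ^ m) progress ⟩
          2 ^ m * (k * 8 * Σˡ rest uncutReduction)         ≡⟨ eq₁ (2 ^ m) (k * 8) _ ⟩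
          k * 8 * (2 ^ m * Σˡ rest uncutReduction)         ≤⟨ *-monoʳ-≤ (k * 8) bounds-u ⟩
          k * 8 * (2 * D * ∑pick m rest uncutReduction)    ≡⟨ eq₂ k D (∑pick m rest uncutReduction) ⟩
          D * (16 * k * ∑pick m rest uncutReduction)       ∎)
          where
            eq₁ : ∀ a b c → a * (b * c) ≡ b * (a * c)
            eq₁ = solve-∀
            eq₂ : ∀ k d x → k * 8 * (2 * d * x) ≡ d * (16 * k * x)
            eq₂ = solve-∀
        pointwise : ∀ h → gain h + N * cuts P h ≡ N + 16 * k * uncutReduction h
        pointwise h with does (cut? P h)
        ... | true  = eq N (16 * k)
          where eq : ∀ N e → 0 + N * 1 ≡ N + e * 0
                eq = solve-∀
        ... | false = eq N (16 * k) (r h)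
          where eq : ∀ N e r → (N + e * r + 0) + N * 0 ≡ N + e * (r + 0)
                eq = solve-∀
        ∑pick-+ : ∀ f g → ∑pick m rest (λ h → f h + g h) ≡ ∑pick m rest f + ∑pick m rest g
        ∑pick-+ f g = trans (∑-cong m (λ u → first-+ (pick u rest) f g)) (∑-+ m (λ u → first (pick u rest) f) (λ u → first (pick u rest) g))
        ∑pick-* : ∀ c f → ∑pick m rest (λ h → c * f h) ≡ c * ∑pick m rest f
        ∑pick-* c f = trans (∑-cong m (λ u → first-* (pick u rest) c f)) (∑-* m c (λ u → first (pick u rest) f))
        first-cong : ∀ {f g : Hedge n → ℕ} xs → (∀ h → f h ≡ g h) → first xs f ≡ first xs g
        first-cong []      e = refl
        first-cong (x ∷ _) e = e x
        identity : ∑pick m rest gain + N * ∑pick m rest (cuts P) ≡ N * 2 ^ m + 16 * k * ∑pick m rest uncutReduction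
        identity = begin-equality
          ∑pick m rest gain + N * ∑pick m rest (cuts P)               ≡⟨ cong (∑pick m rest gain +_) (sym (∑pick-* N (cuts P))) ⟩
          ∑pick m rest gain + ∑pick m rest (λ h → N * cuts P h)       ≡⟨ sym (∑pick-+ gain (λ h → N * cuts P h)) ⟩
          ∑pick m rest (λ h → gain h + N * cuts P h)                  ≡⟨ ∑-cong m (λ u → first-cong (pick u rest) pointwise) ⟩
          ∑pick m rest (λ h → N + 16 * k * uncutReduction h)          ≡⟨ ∑pick-+ (λ _ → N) (λ h → 16 * k * uncutReduction h) ⟩
          ∑pick m rest (λ _ → N) + ∑pick m rest (λ h → 16 * k * uncutReduction h) ≡⟨ cong₂ _+_ (trans (∑pick-const m rest N ge) (*-comm (2 ^ m) N)) (∑pick-* (16 * k) uncutReduction) ⟩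
          N * 2 ^ m + 16 * k * ∑pick m rest uncutReduction            ∎

module _ {n k : ℕ} (2≤k : 2 ≤ k) (m : ℕ) (hs₀ : List (Hedge n)) (P : Fin n → Fin k)
  (P-onto : StrictlySurjective _≡_ P) (ℓ j : ℕ) (value : Σˡ hs₀ (cuts P) ≡ ℓ)
  (optimal : ∀ {k′} → k′ ≡ k → (f : Fin n → Fin k′) → StrictlySurjective _≡_ f → ℓ ≤ Σˡ hs₀ (cuts f))
  (ℓ≤j : ℓ ≤ j) where

  open Success 2≤k m hs₀ P P-onto ℓ j value optimal ℓ≤j

  private
    E = 16 * k

    S : ℕ → State n → ℕ
    S = successes k j hs₀ m

  -- By induction, contracting an uncut hedge to q blocks succeeds with probability at least q^(-E),
  -- and N^(E + 1) q^(-E) is at least the gain. Its mean is at least N, so one factor N can be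
  -- cancelled.
  success-small : ∀ lv {bl b hs rest} → (g : Good (bl , b , hs)) →
    (∀ {h} → h ∈ˡ rest → ¬ Trivial k bl h × ¬ Large k bl h) → SameSum k bl hs rest → 1 ≤ length rest → length rest ≤ m →
    (∀ {h} → h ∈ˡ rest → cuts P h ≡ 0 →
      2 ^ (lv * m) ≤ S lv (contract bl (components h) , b , rest) * length (contract bl (components h)) ^ E) →
    2 ^ (m + lv * m) ≤ ∑pick m rest (λ h → S lv (contract bl (components h) , b , rest)) * length bl ^ E
  success-small lv {bl} {b} {hs} {rest} g small same ge le ih = *-cancelʳ-≤ _ _ N {{>-nonZero N≥1}} (begin
    2 ^ (m + lv * m) * N                             ≡⟨ cong (_* N) (^-distribˡ-+-* 2 m (lv * m)) ⟩
    2 ^ m * M * N                                    ≡⟨ eq₁ (2 ^ m) M N ⟩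
    M * (N * 2 ^ m)                                  ≤⟨ *-monoʳ-≤ M (expected-gain ge le) ⟩
    M * ∑pick m rest gain                            ≡⟨ sym (∑-* m M (λ u → first (pick u rest) gain)) ⟩
    ∑ m (λ u → M * first (pick u rest) gain)         ≤⟨ ∑-mono m per-pick ⟩
    ∑ m (λ u → N ^ E * N * first (pick u rest) X)    ≡⟨ ∑-* m (N ^ E * N) (λ u → first (pick u rest) X) ⟩
    N ^ E * N * ∑pick m rest X                       ≡⟨ eq₂ (N ^ E) N (∑pick m rest X) ⟩
    ∑pick m rest X * N ^ E * N                       ∎)
    where
      open ≤-Reasoning
      open Small g small same
      M = 2 ^ (lv * m)
      X : Hedge n → ℕ
      X h = S lv (contract bl (components h) , b , rest)
      N≥1 : 1 ≤ N
      N≥1 = ≤-trans 1≤k (blocks≥k (Good.partition g) (Good.coarser g))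
      eq₁ : ∀ a b c → a * b * c ≡ b * (c * a)
      eq₁ = solve-∀
      eq₂ : ∀ a b c → a * b * c ≡ c * a * b
      eq₂ = solve-∀
      pointwise : ∀ {h} → h ∈ˡ rest → M * gain h ≤ N ^ E * N * X h
      pointwise {h} h∈ with cuts P h in e
      ... | suc c rewrite 0∸n≡0 c = ≤-trans (≤-reflexive (*-zeroʳ M)) z≤n
      ... | zero = begin
        M * (1 * (N + E * r h))                ≡⟨ cong (M *_) (*-identityˡ _) ⟩
        M * (N + E * r h)                      ≤⟨ *-monoˡ-≤ (N + E * r h) (ih h∈ e) ⟩
        X h * q ^ E * (N + E * r h)            ≡⟨ *-assoc (X h) (q ^ E) _ ⟩
        X h * (q ^ E * (N + E * r h))          ≡⟨ cong (λ N → X h * (q ^ E * (N + E * r h))) (sym q+r) ⟩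
        X h * (q ^ E * (q + r h + E * r h))    ≤⟨ *-monoʳ-≤ (X h) (bernoulli q (r h) E) ⟩
        X h * ((q + r h) ^ E * (q + r h))      ≡⟨ cong (λ N → X h * (N ^ E * N)) q+r ⟩
        X h * (N ^ E * N)                      ≡⟨ *-comm (X h) _ ⟩
        N ^ E * N * X h                        ∎
        where
          q = length (contract bl (components h))
          q+r : q + r h ≡ N
          q+r = m+[n∸m]≡n (contract-length (Good.partition g) (hedge-nonempty h))
      per-pick : ∀ u → M * first (pick u rest) gain ≤ N ^ E * N * first (pick u rest) X
      per-pick u = begin
        M * first (pick u rest) gain                    ≡⟨ sym (first-* (pick u rest) M gain) ⟩
        first (pick u rest) (λ h → M * gain h)          ≤⟨ first-mono (pick u rest) (λ h∈ → pointwise (pick-∈ u rest h∈)) ⟩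
        first (pick u rest) (λ h → N ^ E * N * X h)     ≡⟨ first-* (pick u rest) (N ^ E * N) X ⟩
        N ^ E * N * first (pick u rest) X               ∎

  -- The child that agrees with `P` exists whatever the bits of this level are, so the probability
  -- is inherited undiminished. If `P` cuts the hedge, the remaining budget is positive because it
  -- covers all hedges that are still to be cut.
  success-large : ∀ lv {bl b hs F rest h} → Good (bl , b , hs) → ¬ Trivial k bl h → F ≡ contract bl (components h) →
    isNonEmpty F ≡ true → SameSum k bl hs (h ∷ rest) → length rest ≤ m → length bl + b ≤ suc lv →
    (∀ {bl b hs} → Good (bl , b , hs) → length bl + b ≤ lv → 2 ^ (lv * m) ≤ S lv (bl , b , hs) * length bl ^ E) →
    2 ^ (m + lv * m) ≤ ∑ m (λ u → ∑ (lv * m) (λ v →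
      ⟨ anyᵇ (leads k j hs₀ lv v) (expandClassified k u bl b (F , rest) []) ⟩)) * length bl ^ E
  success-large lv {bl} {b} {hs} {F} {rest} {h} g nt refl ne same l le ih with cuts P h in e
  ... | zero = follow (F , b , rest) here-child (length F ^ E) (^-monoˡ-≤ E (<⇒≤ (≰⇒> nt)))
                 (ih (good-contract {h = h} g e l (trans (same (cuts P) (trivial-cuts P (Good.partition g) (Good.coarser g))) (cong (_+ Σˡ rest (cuts P)) e))
                       (λ f c z → trans (same (cuts f) (trivial-cuts f (Good.partition g) c)) (cong (_+ Σˡ rest (cuts f)) z)))
                   (s≤s⁻¹ (≤-trans (+-monoˡ-≤ b (≰⇒> nt)) le)))
    where
      open ≤-Reasoning
      here-child : ∀ (u : Vec Bool m) → (F , b , rest) ∈ˡ expandClassified k u bl b (F , rest) []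
      here-child u rewrite ne = here refl
      follow : ∀ st → (∀ u → st ∈ˡ expandClassified k u bl b (F , rest) []) → ∀ x → x ≤ length bl ^ E → 2 ^ (lv * m) ≤ S lv st * x →
        2 ^ (m + lv * m) ≤ ∑ m (λ u → ∑ (lv * m) (λ v → ⟨ anyᵇ (leads k j hs₀ lv v) (expandClassified k u bl b (F , rest) []) ⟩)) * length bl ^ E
      follow st child x x≤ i = begin
        2 ^ (m + lv * m)                   ≡⟨ ^-distribˡ-+-* 2 m (lv * m) ⟩
        2 ^ m * 2 ^ (lv * m)               ≤⟨ *-monoʳ-≤ (2 ^ m) i ⟩
        2 ^ m * (S lv st * x)              ≡⟨ sym (*-assoc (2 ^ m) _ x) ⟩
        2 ^ m * S lv st * x                ≤⟨ *-mono-≤ (≤-trans (≤-reflexive (sym (∑-const m (S lv st)))) (∑-mono m (λ u → ∑-mono (lv * m) (λ v → anyᵇ-≥ (leads k j hs₀ lv v) (child u))))) x≤ ⟩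
        _                                  ∎
  success-large lv {bl} {zero} {hs} {F} {rest} {h} g nt refl ne same l le ih | suc c =
    ⊥-elim (<-irrefl refl (≤-trans (s≤s z≤n) (≤-trans (≤-reflexive (sym (trans (same (cuts P) (trivial-cuts P (Good.partition g) (Good.coarser g))) (cong (_+ Σˡ rest (cuts P)) e)))) (Good.budget g))))
  success-large lv {bl} {suc b} {hs} {F} {rest} {h} g nt refl ne same l le ih | suc c = begin
        2 ^ (m + lv * m)                   ≡⟨ ^-distribˡ-+-* 2 m (lv * m) ⟩
        2 ^ m * 2 ^ (lv * m)               ≤⟨ *-monoʳ-≤ (2 ^ m) (ih (good-delete g e1 l same) (s≤s⁻¹ (≤-trans (≤-reflexive (sym (+-suc (length bl) b))) le))) ⟩
        2 ^ m * (S lv st * length bl ^ E)  ≡⟨ sym (*-assoc (2 ^ m) _ (length bl ^ E)) ⟩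
        2 ^ m * S lv st * length bl ^ E    ≤⟨ *-monoˡ-≤ (length bl ^ E) (≤-trans (≤-reflexive (sym (∑-const m (S lv st)))) (∑-mono m (λ u → ∑-mono (lv * m) (λ v → anyᵇ-≥ (leads k j hs₀ lv v) (child u))))) ⟩
        _                                  ∎
    where
      open ≤-Reasoning
      st : State n
      st = bl , b , rest
      e1 : cuts P h ≡ 1
      e1 = ≤-antisym (⟨⟩≤1 _) (subst (1 ≤_) (sym e) (s≤s z≤n))
      child : ∀ (u : Vec Bool m) → st ∈ˡ expandClassified k u bl (suc b) (F , rest) []
      child u rewrite ne = there (here refl)

  -- Each level removes a block or a unit of the budget until no nontrivial hedge remains; from then
  -- on the state is only carried along. This is why m + n levels suffice for a trial.
  success : ∀ lv {bl b hs} → Good (bl , b , hs) → length bl + b ≤ lv → 2 ^ (lv * m) ≤ S lv (bl , b , hs) * length bl ^ E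
  success zero {bl} {b} g le = ⊥-elim (<-irrefl refl (≤-trans 1≤k (≤-trans (blocks≥k (Good.partition g) (Good.coarser g)) (≤-trans (m≤m+n (length bl) b) le))))
  success (suc lv) {bl} {b} {hs} g le rewrite successes-step k j hs₀ m lv (bl , b , hs)
    with classify k bl hs | classify-classified k bl hs | classify-length k bl hs
  ... | F , rest | oneLarge nt lg eq ne same | l′ = success-large lv g nt eq ne same (≤-trans l′ (Good.few g)) le (success lv)
  ... | _ , r ∷ rest | allSmall small same | l′ = ≤-trans
      (success-small lv g small same (s≤s z≤n) (≤-trans l′ (Good.few g))
        (λ {h} h∈ e → success lv
          (good-contract {h = h} g e (≤-trans l′ (Good.few g)) (same (cuts P) (trivial-cuts P (Good.partition g) (Good.coarser g)))
            (λ f c _ → same (cuts f) (trivial-cuts f (Good.partition g) c)))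
          (s≤s⁻¹ (≤-trans (+-monoˡ-≤ b (≰⇒> (proj₁ (small h∈)))) le))))
      (≤-reflexive (cong (_* length bl ^ E) (sym (∑-cong m (λ u → trans
        (∑-cong (lv * m) (λ v → any-contractHead k j hs₀ bl b (r ∷ rest) (pick u (r ∷ rest)) (leads k j hs₀ lv v)))
        (first-∑ k j hs₀ (lv * m) (pick u (r ∷ rest)) (λ h v → ⟨ leads k j hs₀ lv v (contract bl (components h) , b , r ∷ rest) ⟩)))))))
  ... | _ , [] | allSmall small same | l′ = begin
      2 ^ (m + lv * m)                                ≡⟨ ^-distribˡ-+-* 2 m (lv * m) ⟩
      2 ^ m * 2 ^ (lv * m)                            ≡⟨ cong (2 ^ m *_) (sym (trans (∑-const (lv * m) 1) (*-identityʳ _))) ⟩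
      2 ^ m * ∑ (lv * m) (λ _ → 1)                    ≡⟨ sym (∑-const m _) ⟩
      ∑ m (λ u → ∑ (lv * m) (λ v → 1))                ≡⟨ ∑-cong m (λ u → ∑-cong (lv * m) (λ v → sym (always v))) ⟩
      count′                                          ≤⟨ m≤m*n count′ (length bl ^ E) {{m^n≢0 (length bl) E {{>-nonZero N≥1}}}} ⟩
      count′ * length bl ^ E                          ∎
    where
      open ≤-Reasoning
      g′ = good-rest g z≤n same
      N≥1 = ≤-trans 1≤k (blocks≥k (Good.partition g) (Good.coarser g))
      count′ = ∑ m (λ u → ∑ (lv * m) (λ v → ⟨ anyᵇ (leads k j hs₀ lv v) ((bl , b , []) ∷ []) ⟩))
      always : ∀ v → ⟨ anyᵇ (leads k j hs₀ lv v) ((bl , b , []) ∷ []) ⟩ ≡ 1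
      always v rewrite finished-leads g′ lv v = refl

  good-initial : length hs₀ ≤ m → Good (singles n , j , hs₀)
  good-initial l = good (singles-partition n) (λ B∈ p q → cong P (singles-∈ B∈ p q)) l 0 value
    (≤-trans (≤-reflexive value) ℓ≤j) (λ f _ → ≤-refl)

  success-initial : length hs₀ ≤ m → j ≤ m → 2 ^ ((m + n) * m) ≤ S (m + n) (singles n , j , hs₀) * n ^ E
  success-initial l j≤m = subst (λ N → 2 ^ ((m + n) * m) ≤ S (m + n) (singles n , j , hs₀) * N ^ E) (singles-length n)
    (success (m + n) (good-initial l) (≤-trans (≤-reflexive (trans (cong (_+ j) (singles-length n)) (+-comm n j))) (+-monoˡ-≤ n j≤m)))

-- From one successful branch to the failure probability of a stage

module _ {n : ℕ} (k j : ℕ) (hs : List (Hedge n)) where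

  contractHead-acc : ∀ (bl : List (Subset n)) b rest cur {acc} {st : State n} → st ∈ˡ acc → st ∈ˡ contractHead k bl b rest cur acc
  contractHead-acc bl b rest []      p = p
  contractHead-acc bl b rest (_ ∷ _) p = there p

  contractHead-new : ∀ (bl : List (Subset n)) b rest cur acc {st : State n} → st ∈ˡ contractHead k bl b rest cur [] → st ∈ˡ contractHead k bl b rest cur acc
  contractHead-new bl b rest (_ ∷ _) acc (here refl) = here refl

  expand-acc : ∀ {m} (u : Vec Bool m) (bl : List (Subset n)) b c {acc} {st : State n} → st ∈ˡ acc → st ∈ˡ expandClassified k u bl b c acc
  expand-acc u bl b (F , rest) p with isNonEmpty F | isPositive b | isNonEmpty rest
  ... | true  | true  | _     = there (there p)
  ... | true  | false | _     = there p
  ... | false | _     | true  = contractHead-acc bl b rest (pick u rest) p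
  ... | false | _     | false = there p

  expand-new : ∀ {m} (u : Vec Bool m) (bl : List (Subset n)) b c acc {st : State n} → st ∈ˡ expandClassified k u bl b c [] → st ∈ˡ expandClassified k u bl b c acc
  expand-new u bl b (F , rest) acc p with isNonEmpty F | isPositive b | isNonEmpty rest
  expand-new u bl b (F , rest) acc (here refl)         | true | true  | _ = here refl
  expand-new u bl b (F , rest) acc (there (here refl)) | true | true  | _ = there (here refl)
  expand-new u bl b (F , rest) acc (here refl)         | true | false | _ = here refl
  expand-new u bl b (F , rest) acc p                   | false | _ | true = contractHead-new bl b rest (pick u rest) acc p
  expand-new u bl b (F , rest) acc (here refl)         | false | _ | false = here refl

  level-∈ : ∀ {m} (u : Vec Bool m) {fs} {st st′ : State n} → st ∈ˡ fs → st′ ∈ˡ expand k u st [] → st′ ∈ˡ level k u fs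
  level-∈ u {(bl , b , gs) ∷ fs} (here refl) p = expand-new u bl b (classify k bl gs) (level k u fs) p
  level-∈ u {(bl , b , gs) ∷ fs} (there q)   p = expand-acc u bl b (classify k bl gs) (level-∈ u q p)

  leads-levels : ∀ {m} lv (w : Vec Bool (lv * m)) {fs} {st : State n} → st ∈ˡ fs → leads k j hs lv w st ≡ true →
    ∃[ st′ ] st′ ∈ˡ levels k lv w fs × accepts k j hs st′ ≡ true
  leads-levels zero w st∈ e = _ , st∈ , e
  leads-levels {m} (suc lv) w {st = st} st∈ e
    with st′ , p , q ← anyᵇ-elim (leads k j hs lv (Vec.drop m w)) (expand k (Vec.take m w) st []) e =
    leads-levels lv (Vec.drop m w) (level-∈ (Vec.take m w) st∈ p) q

  scan-accepts : ∀ r {fs st} → st ∈ˡ fs → accepts k j hs st ≡ true → Maybe.is-just (scan k j hs r fs) ≡ true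
  scan-accepts r {st ∷ fs} (here refl) e with Maybe.is-just (scan k j hs r fs) in q
  ... | true  = q
  ... | false = e
  scan-accepts r {st ∷ fs} (there p) e with Maybe.is-just (scan k j hs r fs) in q
  ... | true  = q
  ... | false with trans (sym q) (scan-accepts r p e)
  ...   | ()

  scan-keeps : ∀ r fs → Maybe.is-just r ≡ true → Maybe.is-just (scan k j hs r fs) ≡ true
  scan-keeps r []        e = e
  scan-keeps r (st ∷ fs) e with Maybe.is-just (scan k j hs r fs) in q
  ... | true  = q
  ... | false with trans (sym q) (scan-keeps r fs e)
  ...   | ()

  trials-keeps : ∀ {m} lv R (w : Vec Bool (R * (lv * m))) r → Maybe.is-just r ≡ true → Maybe.is-just (trials k lv R w j hs r) ≡ true
  trials-keeps lv zero    w r e = e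
  trials-keeps {m} lv (suc R) w r e = trials-keeps lv R (Vec.drop (lv * m) w) _
    (scan-keeps r (levels k lv (Vec.take (lv * m) w) (initial j hs)) e)

  failed : Maybe (List Bool) → ℕ
  failed r = ⟨ not (Maybe.is-just r) ⟩

  failed-just : ∀ r → Maybe.is-just r ≡ true → failed r ≡ 0
  failed-just (just _) e = refl

  -- Trials read disjoint segments of the tape, so the numbers of failing strings multiply. A result
  -- once found is kept by all later trials.
  trials-failures : ∀ m lv R → ∑ (R * (lv * m)) (λ w → failed (trials k lv R w j hs nothing)) ≤
    ∑ (lv * m) (λ w → ⟨ not (leads k j hs lv w (singles n , j , hs)) ⟩) ^ R
  trials-failures m lv zero    = ≤-refl
  trials-failures m lv (suc R) = begin
    ∑ (lv * m + R * (lv * m)) (λ w → failed (trials k lv R (Vec.drop (lv * m) w) j hs (once (Vec.take (lv * m) w))))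
      ≡⟨ ∑-split (lv * m) (R * (lv * m)) (λ u v → failed (trials k lv R v j hs (once u))) ⟩
    ∑ (lv * m) (λ u → ∑ (R * (lv * m)) (λ v → failed (trials k lv R v j hs (once u))))
      ≤⟨ ∑-mono (lv * m) (λ u → ∑-mono (R * (lv * m)) (λ v → per-trial u v)) ⟩
    ∑ (lv * m) (λ u → ∑ (R * (lv * m)) (λ v → ⟨ not (lead u) ⟩ * failed (trials k lv R v j hs nothing)))
      ≡⟨ ∑-cong (lv * m) (λ u → trans (∑-* (R * (lv * m)) ⟨ not (lead u) ⟩ (λ v → failed (trials k lv R v j hs nothing))) (*-comm _ rest)) ⟩
    ∑ (lv * m) (λ u → rest * ⟨ not (lead u) ⟩)
      ≡⟨ ∑-* (lv * m) rest (λ u → ⟨ not (lead u) ⟩) ⟩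
    rest * ∑ (lv * m) (λ u → ⟨ not (lead u) ⟩)
      ≤⟨ *-monoˡ-≤ f (trials-failures m lv R) ⟩
    f ^ R * f
      ≡⟨ *-comm (f ^ R) f ⟩
    f ^ suc R ∎
    where
      open ≤-Reasoning
      f = ∑ (lv * m) (λ w → ⟨ not (leads k j hs lv w (singles n , j , hs)) ⟩)
      rest = ∑ (R * (lv * m)) (λ v → failed (trials k lv R v j hs nothing))
      once : Vec Bool (lv * m) → Maybe (List Bool)
      once u = scan k j hs nothing (levels k lv u (initial j hs))
      lead : Vec Bool (lv * m) → Bool
      lead u = leads k j hs lv u (singles n , j , hs)
      per-trial : ∀ u v → failed (trials k lv R v j hs (once u)) ≤ ⟨ not (lead u) ⟩ * failed (trials k lv R v j hs nothing)
      per-trial u v with once u in eo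
      ... | just bs = ≤-trans (≤-reflexive (failed-just _ (trials-keeps lv R v (just bs) refl))) z≤n
      ... | nothing with lead u in el
      ...   | false = ≤-reflexive (sym (+-identityʳ _))
      ...   | true with st , st∈ , a ← leads-levels lv u {initial j hs} (here refl) el
        with trans (sym (cong Maybe.is-just eo)) (scan-accepts nothing st∈ a)
      ...     | ()

-- Every result comes from a partition

module _ {n k m s W : ℕ} (I : Invariant {n} k m s W) (1≤k : 1 ≤ k) (j : ℕ) (hs : List (Hedge n)) where

  open Invariant I

  Result : Maybe (List Bool) → Set
  Result nothing   = ⊤
  Result (just bs) = ∃[ bl ] IsPartition bl × (k ≤ᵇ length bl) ≡ true × bs ≡ List.map (cutTest (coarsen k bl)) hs × count bs ≤ j

  candidate-result : ∀ bl → IsPartition bl → Result (candidate k j hs bl)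
  candidate-result bl V with k ≤ᵇ length bl in e
  ... | false = tt
  ... | true with count (List.map (cutTest (coarsen k bl)) hs) ≤ᵇ j in e′
  ...   | false = tt
  ...   | true  = bl , V , e , refl , ≤ᵇ⇒≤ _ j (subst T (sym e′) tt)

  scan-result : ∀ r {fs} → All (Bounded s) fs → Result r → Result (scan k j hs r fs)
  scan-result r []             p = p
  scan-result r {st ∷ fs} (ok ∷ oks) p with Maybe.is-just (scan k j hs r fs)
  ... | true  = scan-result r oks p
  ... | false = candidate-result (proj₁ st) (proj₁ ok)

  trials-result : Inv (initial j hs) → ∀ lv R (w : Vec Bool (R * (lv * m))) r → Result r → Result (trials k lv R w j hs r)
  trials-result i lv zero    w r p = p
  trials-result i lv (suc R) w r p = trials-result i lv R (Vec.drop (lv * m) w) _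
    (scan-result r (proj₁ (inv-bound (inv-levels I lv (Vec.take (lv * m) w) i))) p)

module _ {n : ℕ} where

  unions-elim : ∀ (R : Subset n) Rs {u} → u ∈ unions R Rs → ∃[ C′ ] C′ ∈ˡ (R ∷ Rs) × u ∈ C′
  unions-elim R []        p = R , here refl , p
  unions-elim R (R′ ∷ Rs) p with unions-elim (R ∪ R′) Rs p
  ... | C′ , there C∈ , q = C′ , there (there C∈) , q
  ... | _ , here refl , q with x∈p∪q⁻ R R′ q
  ...   | inj₁ r = R , here refl , r
  ...   | inj₂ r = R′ , there (here refl) , r

  unions-all : ∀ (R : Subset n) Rs {C′ u} → C′ ∈ˡ (R ∷ Rs) → u ∈ C′ → u ∈ unions R Rs
  unions-all R Rs        (here refl)         p = unions-⊇ R Rs p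
  unions-all R (R′ ∷ Rs) (there (here refl)) p = unions-⊇ (R ∪ R′) Rs (x∈p∪q⁺ {p = R} (inj₂ p))
  unions-all R (R′ ∷ Rs) (there (there C∈))  p = unions-all (R ∪ R′) Rs (there C∈) p

  kept-length : ∀ (A : Subset n) xs ys → (∀ {B} → B ∈ˡ xs → meets A B ≡ false) → (∀ {B} → B ∈ˡ ys → meets A B ≡ true) →
    length (proj₂ (mergeParts (xs ++ ys) A)) ≡ length xs
  kept-length A (B ∷ xs) ys p q rewrite p {B} (here refl) = cong suc (kept-length A xs ys (p ∘ there) q)
  kept-length A []       [] p q = refl
  kept-length A []       (B ∷ ys) p q rewrite q {B} (here refl) = kept-length A [] ys p (q ∘ there)

  -- The union of the surplus blocks meets precisely these blocks, by disjointness, so exactly the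
  -- first k - 1 blocks are kept beside it.
  coarsen-kept : ∀ {k bl} (1≤k : 1 ≤ k) (le : (k ≤ᵇ length bl) ≡ true) → IsPartition bl →
    let U = unions (proj₁ (surplus bl 1≤k le)) (proj₁ (proj₂ (surplus bl 1≤k le))) in
    suc (length (proj₂ (mergeParts bl U))) ≡ k
  coarsen-kept {k} {bl} 1≤k le V = trans (cong suc (begin
      length (proj₂ (mergeParts bl U))                  ≡⟨ cong (λ bl → length (proj₂ (mergeParts bl U))) (sym whole) ⟩
      length (proj₂ (mergeParts (xs ++ (R ∷ Rs)) U))    ≡⟨ kept-length U xs (R ∷ Rs) apart inside-U ⟩
      length xs                                         ≡⟨ trans (Listₚ.length-take (pred k) bl) (m≤n⇒m⊓n≡m (≤-trans (pred[n]≤n {k}) (≤ᵇ⇒≤ k (length bl) (subst T (sym le) tt)))) ⟩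
      pred k                                            ∎)) (suc-pred k {{>-nonZero 1≤k}})
    where
      open ≡-Reasoning
      R  = proj₁ (surplus bl 1≤k le)
      Rs = proj₁ (proj₂ (surplus bl 1≤k le))
      U  = unions R Rs
      xs = List.take (pred k) bl
      whole : xs ++ (R ∷ Rs) ≡ bl
      whole = trans (cong (xs ++_) (sym (proj₂ (proj₂ (surplus bl 1≤k le))))) (Listₚ.take++drop≡id (pred k) bl)
      ds = proj₂ (proj₂ (allPairs-++⁻ xs (subst (AllPairs Disjoint) (sym whole) (IsPartition.disjoint V))))
      apart : ∀ {B} → B ∈ˡ xs → meets U B ≡ false
      apart {B} B∈ with meets U B in e
      ... | false = refl
      ... | true with u , p , q ← meets-elim U B e with C′ , C∈ , r ← unions-elim R Rs p = ⊥-elim (ds B∈ C∈ q r)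
      inside-U : ∀ {B} → B ∈ˡ (R ∷ Rs) → meets U B ≡ true
      inside-U {B} B∈ with u , p ← nonempty V (subst (B ∈ˡ_) whole (Anyₚ.++⁺ʳ xs B∈)) = meets-intro (unions-all R Rs B∈ p) p

-- Cut-sets of hedge graphs

size-map : ∀ {A : Set} {m} (b : A → Bool) (hs : Vec A m) → ∣ Vec.map b hs ∣ ≡ Σˡ (Vec.toList hs) (λ h → ⟨ b h ⟩)
size-map b []       = refl
size-map b (h ∷ hs) with b h
... | true  = cong suc (size-map b hs)
... | false = size-map b hs

size-count : ∀ {m} (C′ : Subset m) → ∣ C′ ∣ ≡ count (Vec.toList C′)
size-count []          = refl
size-count (true ∷ C′)  = cong suc (size-count C′)
size-count (false ∷ C′) = size-count C′

cutSubset : ∀ (G : HedgeGraph) {k} → (Fin (HedgeGraph.n G) → Fin k) → Subset (HedgeGraph.m G)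
cutSubset G f = Vec.map (λ h → does (cut? f h)) (hedges G)

module _ (G : HedgeGraph) {k : ℕ} where

  cutSubset-∈ : ∀ (f : Fin (HedgeGraph.n G) → Fin k) (b : Hedge (HedgeGraph.n G) → Bool) → (∀ h → b h ≡ does (cut? f h)) → ∀ i →
    i ∈ Vec.map b (hedges G) → IsCutBy (Vec.lookup (hedges G) i) f
  cutSubset-∈ f b e i i∈ with cut? f (Vec.lookup (hedges G) i) | trans (sym (trans (Vecₚ.lookup-map i b (hedges G)) (e _))) (Vecₚ.[]=⇒lookup i∈)
  ... | yes p | _ = p
  ... | no _  | ()

  ∈-cutSubset : ∀ (f : Fin (HedgeGraph.n G) → Fin k) (b : Hedge (HedgeGraph.n G) → Bool) → (∀ h → b h ≡ does (cut? f h)) → ∀ i →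
    IsCutBy (Vec.lookup (hedges G) i) f → i ∈ Vec.map b (hedges G)
  ∈-cutSubset f b e i p = Vecₚ.lookup⇒[]= i _ (trans (Vecₚ.lookup-map i b (hedges G)) (trans (e _) (yes-true (cut? f (Vec.lookup (hedges G) i)))))
    where
      yes-true : (d : Dec (IsCutBy (Vec.lookup (hedges G) i) f)) → does d ≡ true
      yes-true (yes _) = refl
      yes-true (no ¬p) = ⊥-elim (¬p p)

  isKCutSet : ∀ {k′} → k′ ≡ k → (f : Fin (HedgeGraph.n G) → Fin k′) → StrictlySurjective _≡_ f → (b : Hedge (HedgeGraph.n G) → Bool) →
    (∀ h → b h ≡ does (cut? f h)) → IsKCutSet G k (Vec.map b (hedges G))
  isKCutSet refl f onto b e = record { part = f ; nonEmpty = onto } , λ i → mk⇔ (cutSubset-∈ f b e i) (∈-cutSubset f b e i)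

  kCutSet-size : ∀ {C′} → (p : IsKCutSet G k C′) → Σˡ (Vec.toList (hedges G)) (cuts (part (proj₁ p))) ≡ ∣ C′ ∣
  kCutSet-size {C′} (P , iff) = trans (sym (size-map (λ h → does (cut? (part P) h)) (hedges G))) (cong ∣_∣ (sym C≡))
    where
      bit : ∀ i → Vec.lookup C′ i ≡ does (cut? (part P) (Vec.lookup (hedges G) i))
      bit i with Vec.lookup C′ i in e | cut? (part P) (Vec.lookup (hedges G) i)
      ... | true  | yes _ = refl
      ... | false | no _  = refl
      ... | true  | no ¬p = ⊥-elim (¬p (Equivalence.to (iff i) (Vecₚ.lookup⇒[]= i C′ e)))
      ... | false | yes p with trans (sym e) (Vecₚ.[]=⇒lookup (Equivalence.from (iff i) p))
      ...   | ()
      C≡ : C′ ≡ cutSubset G (part P)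
      C≡ = trans (sym (Vecₚ.tabulate∘lookup C′)) (trans (Vecₚ.tabulate-cong (λ i → trans (bit i) (sym (Vecₚ.lookup-map i _ (hedges G))))) (Vecₚ.tabulate∘lookup _))

  result-cutSet : ∀ (bl : List (Subset (HedgeGraph.n G))) → IsPartition bl → 1 ≤ k → (k ≤ᵇ length bl) ≡ true →
    IsKCutSet G k (Vec.map (cutTest (coarsen k bl)) (hedges G))
  result-cutSet bl V 1≤k le = subst (λ Y → IsKCutSet G k (Vec.map (cutTest Y) (hedges G))) (sym (coarsen-merge bl 1≤k le))
    (isKCutSet (coarsen-kept 1≤k le V) (isolate Os) onto (cutTest (merge bl U)) (cutTest-cut V′))
    where
      U = unions (proj₁ (surplus bl 1≤k le)) (proj₁ (proj₂ (surplus bl 1≤k le)))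
      Os = proj₂ (mergeParts bl U)
      V′ : IsPartition (merge bl U)
      V′ = merge-partition V (surplus-nonempty bl 1≤k le V)
      onto : StrictlySurjective _≡_ (isolate Os)
      onto with u , p ← nonempty V′ (here refl) =
        isolate-surjective Os (AllPairs.tail (IsPartition.disjoint V′)) (All.tabulate (nonempty V′ ∘ there)) u
          (λ O∈ q → All.lookup (AllPairs.head (IsPartition.disjoint V′)) O∈ p q)

encodeMaybe-result : ∀ {A : Set} {m} (b : A → Bool) (hs : Vec A m) →
  encodeMaybe (just (List.map b (Vec.toList hs))) ≡ encodeResult (Vec.map b hs)
encodeMaybe-result b hs rewrite sym (Vecₚ.toList-map b hs) =
  cong₂ cons (cong encodeList (sym (Vecₚ.toList-map encodeBool (Vec.map b hs)))) (cong encodeℕ (sym (size-count (Vec.map b hs))))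

-- Random computations

-- All computation paths at once, as a well-founded tree that branches on the random bit. A common
-- time bound arises by taking maxima, so termination can be shown without counting steps.
data Terminates (Q : Store → Set) : Config → Set where
  stop : ∀ {σ} → Q σ → Terminates Q ([] , σ)
  go   : ∀ {c K σ} → (∀ b → Terminates Q (step b (c ∷ K , σ))) → Terminates Q (c ∷ K , σ)

module _ {Q : Store → Set} where

  terminates-⟶ : ∀ {γ γ′ t} → γ ⟶⟨ t ⟩ γ′ → Terminates Q γ′ → Terminates Q γ
  terminates-⟶ done       τ = τ
  terminates-⟶ (next e r) τ = go λ b → subst (Terminates Q) (sym (e b)) (terminates-⟶ r τ)

  run-[] : ∀ {N σ} (w : Vec Bool N) → run ([] , σ) w ≡ ([] , σ)
  run-[] []      = refl
  run-[] (b ∷ w) = run-[] w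

  halts-within : ∀ {γ} → Terminates Q γ → ∃[ N ] (∀ {M} → N ≤ M → (w : Vec Bool M) → Halted (run γ w))
  halts-within (stop q) = 0 , λ _ w → subst Halted (sym (run-[] w)) halted
  halts-within (go f) with N₀ , h₀ ← halts-within (f false) | N₁ , h₁ ← halts-within (f true) =
    suc (N₀ ⊔ N₁) , λ { (s≤s le) (false ∷ w) → h₀ (≤-trans (m≤m⊔n N₀ N₁) le) w
                      ; (s≤s le) (true ∷ w)  → h₁ (≤-trans (m≤n⊔m N₀ N₁) le) w }

  terminates-halts : ∀ {γ} → Terminates Q γ → AlwaysHalts γ
  terminates-halts τ with N , h ← halts-within τ = N , h ≤-refl

  terminates-sound : ∀ {γ} → Terminates Q γ → ∀ {N} (w : Vec Bool N) → Halted (run γ w) → Q (proj₂ (run γ w))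
  terminates-sound (stop q) w h = subst (Q ∘ proj₂) (sym (run-[] w)) q
  terminates-sound (go f) (b ∷ w) h = terminates-sound (f b) w h
  terminates-sound (go f) []      ()

-- The expected time is at most x / Y.
record Time≤ (γ : Config) (x Y : ℕ) : Set where
  constructor timed
  field total-time : ∀ N → Y * ∑ N (time γ) ≤ x * 2 ^ N
open Time≤

time-stop : ∀ {σ x Y} → Time≤ ([] , σ) x Y
time-stop {σ} {x} {Y} = timed λ N →
  ≤-trans (≤-reflexive (trans (cong (Y *_) (trans (∑-cong N zero-time) (trans (∑-const N 0) (*-zeroʳ (2 ^ N))))) (*-zeroʳ Y))) z≤n
  where
    zero-time : ∀ {N} (w : Vec Bool N) → time ([] , σ) w ≡ 0
    zero-time []      = refl
    zero-time (_ ∷ _) = refl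

∑-suc : ∀ N (f : Vec Bool N → ℕ) → ∑ N (λ w → suc (f w)) ≡ 2 ^ N + ∑ N f
∑-suc N f = trans (∑-+ N (λ _ → 1) f) (cong (_+ ∑ N f) (trans (∑-const N 1) (*-identityʳ _)))

time-mono : ∀ {γ x x′ Y} → x ≤ x′ → Time≤ γ x Y → Time≤ γ x′ Y
time-mono le τ = timed λ N → ≤-trans (total-time τ N) (*-monoˡ-≤ (2 ^ N) le)

-- One step plus the mean of both continuations. Over the common denominator 2Y the mean of two
-- fractions is the sum of their numerators.
time-step : ∀ {c K σ x₀ x₁ Y} → Time≤ (step false (c ∷ K , σ)) x₀ Y → Time≤ (step true (c ∷ K , σ)) x₁ Y →
  Time≤ (c ∷ K , σ) (x₀ + x₁ + 2 * Y) (2 * Y)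
time-step {c} {K} {σ} {x₀} {x₁} {Y} τ₀ τ₁ = timed bound
  where
    open ≤-Reasoning
    f₀ f₁ : ∀ {N} → Vec Bool N → ℕ
    f₀ = time (step false (c ∷ K , σ))
    f₁ = time (step true (c ∷ K , σ))
    eq₁ : ∀ Y p a b → 2 * Y * ((p + a) + (p + b)) ≡ 2 * (Y * a + Y * b) + 2 * Y * (2 * p)
    eq₁ = solve-∀
    eq₂ : ∀ x y Y p → 2 * (x * p + y * p) + 2 * Y * (2 * p) ≡ (x + y + 2 * Y) * (2 * p)
    eq₂ = solve-∀
    bound : ∀ N → 2 * Y * ∑ N (time (c ∷ K , σ)) ≤ (x₀ + x₁ + 2 * Y) * 2 ^ N
    bound zero    = ≤-trans (≤-reflexive (*-zeroʳ (2 * Y))) z≤n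
    bound (suc N) = begin
      2 * Y * (∑ N (λ w → suc (f₀ w)) + ∑ N (λ w → suc (f₁ w)))   ≡⟨ cong₂ (λ a b → 2 * Y * (a + b)) (∑-suc N f₀) (∑-suc N f₁) ⟩
      2 * Y * ((2 ^ N + ∑ N f₀) + (2 ^ N + ∑ N f₁))               ≡⟨ eq₁ Y (2 ^ N) (∑ N f₀) (∑ N f₁) ⟩
      2 * (Y * ∑ N f₀ + Y * ∑ N f₁) + 2 * Y * (2 * 2 ^ N)         ≤⟨ +-monoˡ-≤ _ (*-monoʳ-≤ 2 (+-mono-≤ (total-time τ₀ N) (total-time τ₁ N))) ⟩
      2 * (x₀ * 2 ^ N + x₁ * 2 ^ N) + 2 * Y * (2 * 2 ^ N)         ≡⟨ eq₂ x₀ x₁ Y (2 ^ N) ⟩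
      (x₀ + x₁ + 2 * Y) * (2 * 2 ^ N)                             ∎

time-halve : ∀ {γ x Y} → Time≤ γ (2 * x) (2 * Y) → Time≤ γ x Y
time-halve {γ} {x} {Y} τ = timed λ N →
  *-cancelˡ-≤ 2 (≤-trans (≤-reflexive (sym (*-assoc 2 Y _))) (≤-trans (total-time τ N) (≤-reflexive (*-assoc 2 x _))))

time-⟶ : ∀ {γ γ′ t x Y} → γ ⟶⟨ t ⟩ γ′ → Time≤ γ′ x Y → Time≤ γ (x + t * Y) Y
time-⟶ done τ = time-mono (m≤m+n _ _) τ
time-⟶ {c ∷ K , σ} {t = suc t} {x} {Y} (next e r) τ =
  time-halve (time-mono (≤-reflexive (eq x t Y)) (time-step (at false) (at true)))
  where
    at : ∀ b → Time≤ (step b (c ∷ K , σ)) (x + t * Y) Y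
    at b = subst (λ γ → Time≤ γ (x + t * Y) Y) (sym (e b)) (time-⟶ r τ)
    eq : ∀ x t Y → (x + t * Y) + (x + t * Y) + 2 * Y ≡ 2 * (x + suc t * Y)
    eq = solve-∀

-- From time B on, E has probability at least x / Y.
record Likely (E : Config → Set) (γ : Config) (B x Y : ℕ) : Set where
  constructor likely
  field event : ∀ N → B ≤ N → Σ[ S ∈ (Vec Bool N → Bool) ] (∀ w → S w ≡ true → E (run γ w)) × x * 2 ^ N ≤ Y * ∑ N (λ w → ⟨ S w ⟩)
open Likely

module _ {E : Config → Set} where

  likely-never : ∀ {γ B Y} → Likely E γ B 0 Y
  likely-never = likely λ N _ → (λ _ → false) , (λ _ ()) , z≤n

  likely-stop : ∀ {σ B Y} → E ([] , σ) → Likely E ([] , σ) B Y Y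
  likely-stop {σ} {Y = Y} e = likely λ N _ → (λ _ → true) , (λ w _ → subst E (sym (run-[] {λ _ → ⊤} w)) e) ,
    ≤-reflexive (cong (Y *_) (sym (trans (∑-const N 1) (*-identityʳ _))))

  likely-mono : ∀ {γ B B′ x x′ Y} → B ≤ B′ → x′ ≤ x → Likely E γ B x Y → Likely E γ B′ x′ Y
  likely-mono leB lex l = likely λ N le → let S , p , q = event l N (≤-trans leB le) in
    S , p , ≤-trans (*-monoˡ-≤ (2 ^ N) lex) q

  likely-step : ∀ {c K σ B x₀ x₁ Y} → Likely E (step false (c ∷ K , σ)) B x₀ Y → Likely E (step true (c ∷ K , σ)) B x₁ Y →
    Likely E (c ∷ K , σ) (suc B) (x₀ + x₁) (2 * Y)
  likely-step {c} {K} {σ} {B} {x₀} {x₁} {Y} l₀ l₁ = likely λ { (suc N) (s≤s le) →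
    let S₀ , p₀ , q₀ = event l₀ N le
        S₁ , p₁ , q₁ = event l₁ N le in
    (λ { (false ∷ w) → S₀ w ; (true ∷ w) → S₁ w }) , (λ { (false ∷ w) → p₀ w ; (true ∷ w) → p₁ w }) , (begin
      (x₀ + x₁) * (2 * 2 ^ N)                                     ≡⟨ eq₁ x₀ x₁ (2 ^ N) ⟩
      2 * (x₀ * 2 ^ N + x₁ * 2 ^ N)                               ≤⟨ *-monoʳ-≤ 2 (+-mono-≤ q₀ q₁) ⟩
      2 * (Y * ∑ N (λ w → ⟨ S₀ w ⟩) + Y * ∑ N (λ w → ⟨ S₁ w ⟩))   ≡⟨ eq₂ Y (∑ N (λ w → ⟨ S₀ w ⟩)) (∑ N (λ w → ⟨ S₁ w ⟩)) ⟩
      2 * Y * (∑ N (λ w → ⟨ S₀ w ⟩) + ∑ N (λ w → ⟨ S₁ w ⟩))       ∎) }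
    where
      open ≤-Reasoning
      eq₁ : ∀ x y p → (x + y) * (2 * p) ≡ 2 * (x * p + y * p)
      eq₁ = solve-∀
      eq₂ : ∀ Y a b → 2 * (Y * a + Y * b) ≡ 2 * Y * (a + b)
      eq₂ = solve-∀

  likely-halve : ∀ {γ B x Y} → Likely E γ B (2 * x) (2 * Y) → Likely E γ B x Y
  likely-halve {x = x} {Y} l = likely λ N le → let S , p , q = event l N le in S , p ,
    *-cancelˡ-≤ 2 (≤-trans (≤-reflexive (sym (*-assoc 2 x _))) (≤-trans q (≤-reflexive (*-assoc 2 Y _))))

  likely-⟶ : ∀ {γ γ′ t B x Y} → γ ⟶⟨ t ⟩ γ′ → Likely E γ′ B x Y → Likely E γ (t + B) x Y
  likely-⟶ {t = t} {B} done l = likely-mono (m≤n+m B t) ≤-refl l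
  likely-⟶ {c ∷ K , σ} {t = suc t} {B} {x} {Y} (next e r) l =
    likely-halve (likely-mono ≤-refl (≤-reflexive (cong (x +_) (+-identityʳ x))) (likely-step (at false) (at true)))
    where
      at : ∀ b → Likely E (step b (c ∷ K , σ)) (t + B) x Y
      at b = subst (λ γ → Likely E γ (t + B) x Y) (sym (e b)) (likely-⟶ r l)

∑-∷ʳ : ∀ N (f : Vec Bool (suc N) → ℕ) → ∑ (suc N) f ≡ ∑ N (λ w → f (w Vec.∷ʳ false)) + ∑ N (λ w → f (w Vec.∷ʳ true))
∑-∷ʳ zero    f = refl
∑-∷ʳ (suc N) f = trans (cong₂ _+_ (∑-∷ʳ N (f ∘ (false ∷_))) (∑-∷ʳ N (f ∘ (true ∷_))))
  (eq (∑ N (λ w → f (false ∷ (w Vec.∷ʳ false)))) (∑ N (λ w → f (false ∷ (w Vec.∷ʳ true)))) (∑ N (λ w → f (true ∷ (w Vec.∷ʳ false)))) (∑ N (λ w → f (true ∷ (w Vec.∷ʳ true)))))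
  where eq : ∀ a b c d → a + b + (c + d) ≡ a + c + (b + d)
        eq = solve-∀

-- Each tossed bit is put in front of the earlier ones, so the search reads the bits in reverse
-- order. Counts of bit strings are not affected.
∑-reverse : ∀ N (f : Vec Bool N → ℕ) → ∑ N (f ∘ Vec.reverse) ≡ ∑ N f
∑-reverse zero    f = refl
∑-reverse (suc N) f = trans (cong₂ _+_ (half false) (half true)) (sym (∑-∷ʳ N f))
  where
    half : ∀ b → ∑ N (λ w → f (Vec.reverse (b ∷ w))) ≡ ∑ N (λ w → f (w Vec.∷ʳ b))
    half b = trans (∑-cong N (λ w → cong f (Vecₚ.reverse-∷ b w))) (∑-reverse N (λ w → f (w Vec.∷ʳ b)))

tossOne : Cmd
tossOne = toss 7 ⨾ 6 ≔ consᵉ 7 6 ⨾ 5 ≔ tlᵉ 5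

record Tossed (σ : Store) (tape : List Bool) (σ′ : Store) : Set where
  field
    tape-is : σ′ 6 ≡ encodeBits tape
    counter : σ′ 5 ≡ nil
    same    : ∀ x → x ≢ 5 → x ≢ 6 → x ≢ 7 → σ′ x ≡ σ x
open Tossed

afterToss : Store → Bool → Store
afterToss σ b = ((σ [ 7 ↦ encodeBool b ]) [ 6 ↦ cons (encodeBool b) (σ 6) ]) [ 5 ↦ tl (σ 5) ]

toss-before : ∀ {K σ z} → σ 5 ≡ encodeℕ (suc z) → (while 5 tossOne ∷ K , σ) ⟶⟨ 2 ⟩
  (toss 7 ∷ (6 ≔ consᵉ 7 6 ⨾ 5 ≔ tlᵉ 5) ∷ while 5 tossOne ∷ K , σ)
toss-before {K} {σ} e = next (λ b → trans (step-while b) (cong (λ v → ifTree v (tossOne ∷ while 5 tossOne ∷ K) K , σ) e)) (next (λ _ → refl) done)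

toss-after : ∀ {K σ} b → step b (toss 7 ∷ (6 ≔ consᵉ 7 6 ⨾ 5 ≔ tlᵉ 5) ∷ K , σ) ⟶⟨ 3 ⟩ (K , afterToss σ b)
toss-after b = next (λ _ → refl) (next (λ _ → refl) (next (λ _ → refl) done))

toss-end : ∀ {K σ} → σ 5 ≡ nil → (while 5 tossOne ∷ K , σ) ⟶⟨ 1 ⟩ (K , σ)
toss-end {K} {σ} e = next (λ b → trans (step-while b) (cong (λ v → ifTree v (tossOne ∷ while 5 tossOne ∷ K) K , σ) e)) done

afterToss-tape : ∀ {σ acc} b → σ 6 ≡ encodeBits acc → afterToss σ b 6 ≡ encodeBits (b ∷ acc)
afterToss-tape b e = cong (cons (encodeBool b)) e

tossed-step : ∀ {σ tape σ′} b → Tossed (afterToss σ b) tape σ′ → Tossed σ tape σ′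
tossed-step {σ} b t = record
  { tape-is = tape-is t
  ; counter = counter t
  ; same = λ x p q r → trans (same t x p q r)
      (trans (upd-other ((σ [ 7 ↦ encodeBool b ]) [ 6 ↦ cons (encodeBool b) (σ 6) ]) 5 _ p)
        (trans (upd-other (σ [ 7 ↦ encodeBool b ]) 6 _ q) (upd-other σ 7 _ r))) }

tossed-none : ∀ {σ acc} → σ 5 ≡ nil → σ 6 ≡ encodeBits acc → Tossed σ acc σ
tossed-none e e′ = record { tape-is = e′ ; counter = e ; same = λ _ _ _ _ → refl }

module _ {K : List Cmd} where

  terminates-toss : ∀ {Q} z {σ acc} → σ 5 ≡ encodeℕ z → σ 6 ≡ encodeBits acc →
    (∀ (v : Vec Bool z) {σ′} → Tossed σ (Vec.toList v List.ʳ++ acc) σ′ → Terminates Q (K , σ′)) →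
    Terminates Q (while 5 tossOne ∷ K , σ)
  terminates-toss zero    e e′ k = terminates-⟶ (toss-end e) (k [] (tossed-none e e′))
  terminates-toss (suc z) {σ} e e′ k = terminates-⟶ (toss-before {z = z} e) (go λ b → terminates-⟶ (toss-after b)
    (terminates-toss z (cong tl e) (afterToss-tape {σ} b e′) (λ v t → k (b ∷ v) (tossed-step {σ} b t))))

  time-toss : ∀ z {σ acc} (X : Vec Bool z → ℕ) → σ 5 ≡ encodeℕ z → σ 6 ≡ encodeBits acc →
    (∀ (v : Vec Bool z) {σ′} → Tossed σ (Vec.toList v List.ʳ++ acc) σ′ → Time≤ (K , σ′) (X v) 1) →
    Time≤ (while 5 tossOne ∷ K , σ) (∑ z X + (1 + 6 * z) * 2 ^ z) (2 ^ z)
  time-toss zero    {σ} X e e′ k = time-⟶ (toss-end e) (k [] (tossed-none e e′))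
  time-toss (suc z) {σ} {acc} X e e′ k = time-mono (≤-reflexive (eq (∑ z (X ∘ (false ∷_))) (∑ z (X ∘ (true ∷_))) z (2 ^ z)))
    (time-⟶ (toss-before {z = z} e) (time-step (branch false) (branch true)))
    where
      branch : ∀ b → Time≤ (step b (toss 7 ∷ (6 ≔ consᵉ 7 6 ⨾ 5 ≔ tlᵉ 5) ∷ while 5 tossOne ∷ K , σ))
                 (∑ z (X ∘ (b ∷_)) + (1 + 6 * z) * 2 ^ z + 3 * 2 ^ z) (2 ^ z)
      branch b = time-⟶ (toss-after b) (time-toss z (X ∘ (b ∷_)) (cong tl e) (afterToss-tape {σ} b e′) (λ v t → k (b ∷ v) (tossed-step {σ} b t)))
      eq : ∀ a b z p → (a + (1 + 6 * z) * p + 3 * p) + (b + (1 + 6 * z) * p + 3 * p) + 2 * p + 2 * (2 * p) ≡ a + b + (1 + 6 * suc z) * (2 * p)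
      eq = solve-∀

  likely-toss : ∀ {E} z {σ acc B Y} (X : Vec Bool z → ℕ) → σ 5 ≡ encodeℕ z → σ 6 ≡ encodeBits acc →
    (∀ (v : Vec Bool z) {σ′} → Tossed σ (Vec.toList v List.ʳ++ acc) σ′ → Likely E (K , σ′) B (X v) Y) →
    Likely E (while 5 tossOne ∷ K , σ) (1 + 6 * z + B) (∑ z X) (2 ^ z * Y)
  likely-toss {E} zero {σ} {B = B} {Y} X e e′ k =
    subst (Likely E (while 5 tossOne ∷ K , σ) (1 + B) (X [])) (sym (+-identityʳ Y)) (likely-⟶ (toss-end e) (k [] (tossed-none e e′)))
  likely-toss {E} (suc z) {σ} {acc} {B} {Y} X e e′ k =
    subst₂ (λ B Y → Likely E (while 5 tossOne ∷ K , σ) B (∑ (suc z) X) Y) (eq z B) (sym (*-assoc 2 (2 ^ z) Y))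
      (likely-⟶ (toss-before {z = z} e) (likely-step (branch false) (branch true)))
    where
      branch : ∀ b → Likely E (step b (toss 7 ∷ (6 ≔ consᵉ 7 6 ⨾ 5 ≔ tlᵉ 5) ∷ while 5 tossOne ∷ K , σ)) (3 + (1 + 6 * z + B)) (∑ z (X ∘ (b ∷_))) (2 ^ z * Y)
      branch b = likely-⟶ (toss-after b) (likely-toss z (X ∘ (b ∷_)) (cong tl e) (afterToss-tape {σ} b e′) (λ v t → k (b ∷ v) (tossed-step {σ} b t)))
      eq : ∀ z B → 2 + suc (3 + (1 + 6 * z + B)) ≡ 1 + 6 * suc z + B
      eq = solve-∀

-- Programs for the data of a stage and for its search

encodeInstance : ∀ {n} → ℕ → List (Hedge n) → Tree
encodeInstance {n} k hs = cons (encodeℕ n) (cons (encodeℕ k) (encodeHedges hs))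

-- Of the exponent 20k, the part 16k compensates the success probability n^(-16k) of a trial. The
-- part 4k pushes the failure probability of the stage below the growth of the time from one stage
-- to the next.
numberOfTrials : ℕ → ℕ → ℕ
numberOfTrials n k = (n ^ 20) ^ k

polyPow : ℕ → Poly
polyPow zero    = con 1
polyPow (suc e) = size ⊗ polyPow e

polyPow-≥ : ∀ {n s} e → n ≤ s → n ^ e ≤ ⟦ polyPow e ⟧ᵖ s
polyPow-≥ zero    le = ≤-refl
polyPow-≥ (suc e) le = *-mono-≤ le (polyPow-≥ e le)

abstract
  numberOfTrialsP : Σ[ e ∈ Tm 9 ] Σ[ p ∈ Poly ] ∀ {n s w} → n ≤ s → ∀ {k} → 1 ≤ k → k ≤ s → (∀ i → i ≤ 20 * k → n ^ i ≤ suc w) →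
    ∀ (hs : List (Hedge n)) (ρ : Vec Tree 8) → (encodeInstance k hs ∷ ρ) ⊢ e ⇓ encodeℕ (numberOfTrials n k) ⟨ p ∣ s , w ⟩
  numberOfTrialsP = _ , _ , λ {n} {s} {w} n≤s {k} 1≤k k≤s pw hs ρ →
    powR (polyPow 20) size
      (powR size (con 20) (hdR v0) (litR 20) n≤s ≤-refl (λ i i≤ → pw i (≤-trans i≤ (m≤m*n 20 k {{>-nonZero 1≤k}}))))
      (hdR (tlR v0)) (polyPow-≥ 20 n≤s) k≤s
      (λ i i≤ → subst (_≤ suc w) (sym (^-*-assoc n 20 i)) (pw (20 * i) (*-monoʳ-≤ 20 i≤)))

abstract
  numberOfLevelsP : Σ[ e ∈ Tm 2 ] Σ[ p ∈ Poly ] ∀ {n s w} (hs : List (Hedge n)) → length hs ≤ s →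
    (encodeℕ n ∷ encodeHedges hs ∷ []) ⊢ e ⇓ encodeℕ (length hs + n) ⟨ p ∣ s , w ⟩
  numberOfLevelsP = _ , _ , λ {n} {s} {w} hs len →
      foldR size {w} v1 v0 (*-monoˡ-≤ (suc w) (length-map≤ hs len))
        (castLoop hs (loop (List.map encodeHedge hs) n))
    where
      loop : ∀ {ρ : Vec Tree 2} {s w} ts i →
        Loop ρ (consᵗ nilᵗ (varᵗ (suc zero))) (con 1 ⊕ con 1 ⊕ con 3) s w ts (encodeℕ i) (encodeℕ (length ts + i))
      loop []       i = []
      loop (t ∷ ts) i = consR nilR v1 ∷ loop-end (cong encodeℕ (+-suc (length ts) i)) (loop ts (suc i))
      castLoop : ∀ {n i s w} {ρ : Vec Tree 2} {b r ts a} (hs : List (Hedge n)) →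
        Loop ρ b r s w ts a (encodeℕ (length (List.map encodeHedge hs) + i)) → Loop ρ b r s w ts a (encodeℕ (length hs + i))
      castLoop {i = i} hs l = loop-end (cong (λ x → encodeℕ (x + i)) (Listₚ.length-map encodeHedge hs)) l

numberOfBits : ℕ → ℕ → ℕ → ℕ
numberOfBits n m k = numberOfTrials n k * ((m + n) * m)

v8 : ∀ {t₀ t₁ t₂ t₃ t₄ t₅ t₆ t₇ t₈ s w} → (t₀ ∷ t₁ ∷ t₂ ∷ t₃ ∷ t₄ ∷ t₅ ∷ t₆ ∷ t₇ ∷ t₈ ∷ []) ⊢ _ ⇓ t₈ ⟨ con 1 ∣ s , w ⟩
v8 = varR (Fin.fromℕ 8)

abstract
  numberOfBitsP : Σ[ e ∈ Tm 9 ] Σ[ p ∈ Poly ] ∀ {n s w m} (hs : List (Hedge n)) → length hs ≡ m → m + n ≤ s → ∀ {k} →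
    numberOfTrials n k ≤ suc w → ∀ y₁ y₂ y₃ y₄ y₅ y₆ y₇ →
    (encodeInstance k hs ∷ y₁ ∷ y₂ ∷ y₃ ∷ y₄ ∷ y₅ ∷ y₆ ∷ y₇ ∷ encodeℕ (numberOfTrials n k) ∷ []) ⊢ e ⇓ encodeℕ (numberOfBits n m k) ⟨ p ∣ s , w ⟩
  numberOfBitsP = _ , _ , λ { {n} {s} {w} hs refl le {k} R≤ y₁ y₂ y₃ y₄ y₅ y₆ y₇ →
    multN (con 1) (size ⊗ size) {0} (num-ℕ _) (num-ℕ _) v8
      (multN size size {w} (num-ℕ _) (num-map encodeHedge hs)
        (callR (hdR v0 ∷R tlR (tlR v0) ∷R []R) (rule numberOfLevelsP hs (≤-trans (m≤m+n _ n) le)))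
        (tlR (tlR v0))
        (*-monoˡ-≤ (suc w) le) (≤-trans (≤-trans (m≤m+n _ n) le) (m≤m*n s (suc w))))
      (≤-trans (≤-reflexive (*-identityʳ _)) (≤-trans R≤ (≤-reflexive (sym (*-identityˡ (suc w))))))
      (≤-trans (*-mono-≤ le (≤-trans (m≤m+n _ n) le)) (≤-reflexive (sym (*-identityʳ _)))) }

abstract
  searchP : Σ[ e ∈ Tm 9 ] Σ[ p ∈ Poly ] ∀ {n s w₁ w m} (hs : List (Hedge n)) → length hs ≡ m → m + n ≤ s → ∀ {k} → 1 ≤ k → k ≤ s → ∀ {j} → j ≤ s →
    (I : Invariant {n} k m s w₁) → Invariant.Inv I (initial j hs) → numberOfTrials n k * suc w₁ ≤ suc w → (u : Vec Bool (numberOfBits n m k)) →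
    ∀ y₁ y₂ y₄ y₅ y₇ →
    (encodeInstance k hs ∷ y₁ ∷ y₂ ∷ encodeℕ j ∷ y₄ ∷ y₅ ∷ u ▹ nil ∷ y₇ ∷ encodeℕ (numberOfTrials n k) ∷ []) ⊢ e ⇓
      encodeMaybe (trials k (m + n) (numberOfTrials n k) u j hs nothing) ⟨ p ∣ s , w ⟩
  searchP = _ , _ , λ { {n} {s} hs refl le {k} 1≤k k≤s {j} j≤s I i R≤ u y₁ y₂ y₄ y₅ y₇ →
    callR (hdR (tlR v0) ∷R v3 ∷R tlR (tlR v0) ∷R
           callR (hdR v0 ∷R tlR (tlR v0) ∷R []R) (rule numberOfLevelsP hs (≤-trans (m≤m+n _ n) le)) ∷R
           consR (consR (callR (hdR v0 ∷R []R) (rule singlesP n (≤-trans (m≤n+m n _) le))) (consR v3 (tlR (tlR v0)))) nilR ∷R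
           v6 ∷R v8 ∷R []R)
      (rule trialsP (≤-trans (m≤n+m n _) le) 1≤k k≤s j≤s hs refl (≤-trans (m≤m+n _ n) le) (length hs + n) le I i (numberOfTrials n k) R≤ u) }

-- The algorithm.  Register 0 holds the input, 1 the result, 2 a list as long
-- as the number of remaining stages, 3 the number j of hedges that may be
-- deleted in the current stage, 4 the number of random bits of a stage, 5 the
-- number of bits still to be tossed, 6 the bits, 7 the last bit, and 8 the
-- number of trials of a stage.

set : Var → Tm 9 → Cmd
set x e = comp e (registers 0 9) 9 ⨾ x ≔ varᵉ 9

conclude : Cmd
-- Register 5 is `nil` after the tosses, so the second command increments the unary number j.
-- Success empties register 2, which ends the loop over the stages.
conclude = set 1 (proj₁ searchP) ⨾ 3 ≔ consᵉ 5 3 ⨾ if 1 (2 ≔ nilᵉ) (2 ≔ tlᵉ 2)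

stage : Cmd
stage = 5 ≔ varᵉ 4 ⨾ 6 ≔ nilᵉ ⨾ while 5 tossOne ⨾ conclude

algorithm : Cmd
algorithm = set 8 (proj₁ numberOfTrialsP) ⨾ set 4 (proj₁ numberOfBitsP) ⨾
  -- One element more than there are hedges: j runs through 0, ..., m.
  set 2 (consᵗ nilᵗ (tlᵗ (tlᵗ (varᵗ zero)))) ⨾ while 2 stage ⨾ 0 ≔ varᵉ 1

contents : Store → Vec Tree 9
contents σ = σ 0 ∷ σ 1 ∷ σ 2 ∷ σ 3 ∷ σ 4 ∷ σ 5 ∷ σ 6 ∷ σ 7 ∷ σ 8 ∷ []

contents-holds : ∀ σ → Holds (registers 0 9) (contents σ) σ
contents-holds σ = mkHolds λ
  { zero → refl ; (suc zero) → refl ; (suc (suc zero)) → refl ; (suc (suc (suc zero))) → refl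
  ; (suc (suc (suc (suc zero)))) → refl ; (suc (suc (suc (suc (suc zero))))) → refl
  ; (suc (suc (suc (suc (suc (suc zero)))))) → refl ; (suc (suc (suc (suc (suc (suc (suc zero))))))) → refl
  ; (suc (suc (suc (suc (suc (suc (suc (suc zero)))))))) → refl }

set-⟶ : ∀ x e σ {v c} K → ⟦ e ⟧ (contents σ) ≡ v → cost e (contents σ) ≤ c → x < 9 →
  ∃[ σ′ ] (set x e ∷ K , σ) ⟶⟨ 2 + c ⟩ (K , σ′) × σ′ x ≡ v × (∀ y → y < 9 → y ≢ x → σ′ y ≡ σ y)
set-⟶ x e σ {c = c} K refl le x<9
  with σ₁ , r₁ , e₁ , q₁ ← comp-correct e (mkBelow (registers-below 0 9)) (contents-holds σ) ((x ≔ varᵉ 9) ∷ K) =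
  σ₁ [ x ↦ σ₁ 9 ] , ⟶-mono (seq-⟶ r₁ (next (λ _ → refl) done)) (≤-trans (s≤s (+-monoˡ-≤ 1 le)) (≤-reflexive (cong suc (+-comm c 1)))) ,
  trans (upd-same σ₁ x _) e₁ , λ y y<9 y≢x → trans (upd-other σ₁ x _ y≢x) (q₁ y<9)

-- Execution of the stages

module Run {n : ℕ} (k m : ℕ) (hs : List (Hedge n)) (len : length hs ≡ m) (1≤k : 1 ≤ k) where

  R = numberOfTrials n k
  Z = numberOfBits n m k

  result : ℕ → Vec Bool Z → Maybe (List Bool)
  result j u = trials k (m + n) R u j hs nothing

  record AtStage (j : ℕ) (rem : List Tree) (σ : Store) : Set where
    field
      at₀ : σ 0 ≡ encodeInstance k hs
      at₁ : σ 1 ≡ nil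
      at₂ : σ 2 ≡ encodeList rem
      at₃ : σ 3 ≡ encodeℕ j
      at₄ : σ 4 ≡ encodeℕ Z
      at₈ : σ 8 ≡ encodeℕ R
  open AtStage

  SearchCost : ℕ → ℕ → Set
  SearchCost j c = ∀ (u : Vec Bool Z) y₁ y₂ y₄ y₅ y₇ →
    let ρ = encodeInstance k hs ∷ y₁ ∷ y₂ ∷ encodeℕ j ∷ y₄ ∷ y₅ ∷ u ▹ nil ∷ y₇ ∷ encodeℕ R ∷ [] in
    ⟦ proj₁ searchP ⟧ ρ ≡ encodeMaybe (result j u) × cost (proj₁ searchP) ρ ≤ c

  final : List Cmd
  final = (0 ≔ varᵉ 1) ∷ []

  ready : Store → Store
  ready σ = (σ [ 5 ↦ σ 4 ]) [ 6 ↦ nil ]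

  enter-stage : ∀ {j t rem σ K} → AtStage j (t ∷ rem) σ →
    (while 2 stage ∷ K , σ) ⟶⟨ 6 ⟩ (while 5 tossOne ∷ conclude ∷ while 2 stage ∷ K , ready σ)
  enter-stage {σ = σ} {K} a = next (λ b → trans (step-while b) (cong (λ v → ifTree v (stage ∷ while 2 stage ∷ K) K , σ) (at₂ a)))
    (next (λ _ → refl) (next (λ _ → refl) (next (λ _ → refl) (next (λ _ → refl) (next (λ _ → refl) done)))))

  leave : ∀ {σ} → σ 2 ≡ nil → (while 2 stage ∷ final , σ) ⟶⟨ 2 ⟩ ([] , σ [ 0 ↦ σ 1 ])
  leave {σ} e = next (λ b → trans (step-while b) (cong (λ v → ifTree v (stage ∷ while 2 stage ∷ final) final , σ) e)) (next (λ _ → refl) done)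

  Concluded : ℕ → List Tree → Maybe (List Bool) → Store → Set
  Concluded j rem nothing   σ = AtStage (suc j) rem σ
  Concluded j rem (just bs) σ = σ 2 ≡ nil × σ 1 ≡ encodeMaybe (just bs)

  ▹-bits : ∀ {z} (u : Vec Bool z) → encodeBits (Vec.toList u) ≡ u ▹ nil
  ▹-bits []      = refl
  ▹-bits (b ∷ u) = cong (cons (encodeBool b)) (▹-bits u)

  conclude-⟶ : ∀ {j c t rem σ σ′} K (u : Vec Bool Z) → SearchCost j c → AtStage j (t ∷ rem) σ → Tossed (ready σ) (Vec.toList u) σ′ →
    ∃[ σ″ ] (conclude ∷ K , σ′) ⟶⟨ 7 + c ⟩ (K , σ″) × Concluded j rem (result j u) σ″
  conclude-⟶ {j} {c} {t} {rem} {σ} {σ′} K u sc a τ = branches (result j u) e₁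
    where
      s₀ : ∀ x → x ≢ 5 → x ≢ 6 → x ≢ 7 → σ′ x ≡ σ x
      s₀ x p q r = trans (Tossed.same τ x p q r) (trans (upd-other (σ [ 5 ↦ σ 4 ]) 6 nil q) (upd-other σ 5 (σ 4) p))
      f₀ = trans (s₀ 0 (λ ()) (λ ()) (λ ())) (at₀ a)
      f₂ = trans (s₀ 2 (λ ()) (λ ()) (λ ())) (at₂ a)
      f₃ = trans (s₀ 3 (λ ()) (λ ()) (λ ())) (at₃ a)
      f₄ = trans (s₀ 4 (λ ()) (λ ()) (λ ())) (at₄ a)
      f₈ = trans (s₀ 8 (λ ()) (λ ()) (λ ())) (at₈ a)
      ρ≡ : contents σ′ ≡ encodeInstance k hs ∷ σ′ 1 ∷ σ′ 2 ∷ encodeℕ j ∷ σ′ 4 ∷ σ′ 5 ∷ u ▹ nil ∷ σ′ 7 ∷ encodeℕ R ∷ []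
      ρ≡ = cong₂ _∷_ f₀ (cong (λ v → σ′ 1 ∷ σ′ 2 ∷ v) (cong₂ _∷_ f₃ (cong (λ v → σ′ 4 ∷ σ′ 5 ∷ v)
             (cong₂ _∷_ (trans (Tossed.tape-is τ) (▹-bits u)) (cong (λ v → σ′ 7 ∷ v) (cong (_∷ []) f₈))))))
      vc = sc u (σ′ 1) (σ′ 2) (σ′ 4) (σ′ 5) (σ′ 7)
      st = set-⟶ 1 (proj₁ searchP) σ′ ((3 ≔ consᵉ 5 3 ⨾ if 1 (2 ≔ nilᵉ) (2 ≔ tlᵉ 2)) ∷ K)
             (trans (cong ⟦ proj₁ searchP ⟧ ρ≡) (proj₁ vc)) (≤-trans (≤-reflexive (cong (cost (proj₁ searchP)) ρ≡)) (proj₂ vc)) (s≤s (s≤s z≤n))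
      σ₁ = proj₁ st
      r₁ = proj₁ (proj₂ st)
      e₁ = proj₁ (proj₂ (proj₂ st))
      q₁ = proj₂ (proj₂ (proj₂ st))
      σ₂ : Store
      σ₂ = σ₁ [ 3 ↦ cons (σ₁ 5) (σ₁ 3) ]
      k₃ : σ₂ 3 ≡ encodeℕ (suc j)
      k₃ = cong₂ cons (trans (q₁ 5 (s≤s (s≤s (s≤s (s≤s (s≤s (s≤s z≤n)))))) (λ ())) (Tossed.counter τ))
                      (trans (q₁ 3 (s≤s (s≤s (s≤s (s≤s z≤n)))) (λ ())) f₃)
      k₂ : σ₂ 2 ≡ cons t (encodeList rem)
      k₂ = trans (q₁ 2 (s≤s (s≤s (s≤s z≤n))) (λ ())) f₂
      before : ∀ {γ} → ((if 1 (2 ≔ nilᵉ) (2 ≔ tlᵉ 2) ∷ K) , σ₂) ⟶⟨ 2 ⟩ γ → (conclude ∷ K , σ′) ⟶⟨ 7 + c ⟩ γ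
      before r = ⟶-mono (seq-⟶ r₁ (next (λ _ → refl) (next (λ _ → refl) r))) (≤-reflexive (cong suc (trans (+-comm (2 + c) 4) refl)))
      branch : ∀ b {v} → σ₂ 1 ≡ v → step b (if 1 (2 ≔ nilᵉ) (2 ≔ tlᵉ 2) ∷ K , σ₂) ≡ (ifTree v (2 ≔ nilᵉ) (2 ≔ tlᵉ 2) ∷ K , σ₂)
      branch b e = trans (step-if {1} b) (cong (λ v → ifTree v (2 ≔ nilᵉ) (2 ≔ tlᵉ 2) ∷ K , σ₂) e)
      branches : ∀ r → σ₁ 1 ≡ encodeMaybe r → ∃[ σ″ ] (conclude ∷ K , σ′) ⟶⟨ 7 + c ⟩ (K , σ″) × Concluded j rem r σ″
      branches nothing e = σ₂ [ 2 ↦ tl (σ₂ 2) ] , before (next (λ b → branch b e) (next (λ _ → refl) done)) , record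
        { at₀ = trans (q₁ 0 (s≤s z≤n) (λ ())) f₀
        ; at₁ = e
        ; at₂ = cong tl k₂
        ; at₃ = k₃
        ; at₄ = trans (q₁ 4 (s≤s (s≤s (s≤s (s≤s (s≤s z≤n))))) (λ ())) f₄
        ; at₈ = trans (q₁ 8 (s≤s (s≤s (s≤s (s≤s (s≤s (s≤s (s≤s (s≤s (s≤s z≤n))))))))) (λ ())) f₈ }
      branches (just bs) e = σ₂ [ 2 ↦ nil ] , before (next (λ b → branch b e) (next (λ _ → refl) done)) , refl , e

  reversed : ∀ {σ σ′} (v : Vec Bool Z) → Tossed σ (Vec.toList v List.ʳ++ []) σ′ → Tossed σ (Vec.toList (Vec.reverse v)) σ′
  reversed {σ} {σ′} v = subst (λ ts → Tossed σ ts σ′) (sym (Vecₚ.toList-reverse v))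

  ready-counter : ∀ {j rem σ} → AtStage j rem σ → ready σ 5 ≡ encodeℕ Z
  ready-counter a = at₄ a

  module _ {Q : Store → Set} (Q-none : ∀ {σ} → σ 0 ≡ nil → Q σ) (Q-some : ∀ {σ} j u bs → result j u ≡ just bs → σ 0 ≡ encodeMaybe (just bs) → Q σ)
    (sc : ∀ j → ∃[ c ] SearchCost j c) where

    terminates-stages : ∀ rem j {σ} → AtStage j rem σ → Terminates Q (while 2 stage ∷ final , σ)
    terminates-stages []        j a = terminates-⟶ (leave (at₂ a)) (stop (Q-none (at₁ a)))
    terminates-stages (t ∷ rem) j {σ} a = terminates-⟶ (enter-stage a) (terminates-toss Z {acc = []} (ready-counter a) refl after)
      where
        after : ∀ (v : Vec Bool Z) {σ′} → Tossed (ready σ) (Vec.toList v List.ʳ++ []) σ′ → Terminates Q (conclude ∷ while 2 stage ∷ final , σ′)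
        after v {σ′} τ with σ″ , r , c ← conclude-⟶ (while 2 stage ∷ final) (Vec.reverse v) (proj₂ (sc j)) a (reversed {σ′ = σ′} v τ)
          with result j (Vec.reverse v) in e
        ... | nothing = terminates-⟶ r (terminates-stages rem (suc j) c)
        ... | just bs = terminates-⟶ r (terminates-⟶ (leave (proj₁ c)) (stop (Q-some j (Vec.reverse v) bs e (proj₂ c))))

  failureSum : ℕ → ℕ
  failureSum j = ∑ Z (λ u → failed k j hs (result j u))

  -- The time x of the later stages is paid only for the strings on which this stage fails. The
  -- constant 16 collects 6 steps to enter, 1 to end the tossing, 7 to conclude and 2 to leave.
  time-stage : ∀ {c j t rem σ x} → SearchCost j c → AtStage j (t ∷ rem) σ →
    (∀ {σ′} → AtStage (suc j) rem σ′ → Time≤ (while 2 stage ∷ final , σ′) x 1) →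
    Time≤ (while 2 stage ∷ final , σ) (failureSum j * x + (16 + c + 6 * Z) * 2 ^ Z) (2 ^ Z)
  time-stage {c} {j} {t} {rem} {σ} {x} sc a next-stage = time-mono (≤-reflexive total)
      (time-⟶ (enter-stage a) (time-toss Z {acc = []} X (ready-counter a) refl after))
    where
      X : Vec Bool Z → ℕ
      X v = failed k j hs (result j (Vec.reverse v)) * x + (9 + c)
      after : ∀ (v : Vec Bool Z) {σ′} → Tossed (ready σ) (Vec.toList v List.ʳ++ []) σ′ → Time≤ (conclude ∷ while 2 stage ∷ final , σ′) (X v) 1
      after v {σ′} τ with σ″ , r , ccl ← conclude-⟶ (while 2 stage ∷ final) (Vec.reverse v) sc a (reversed {σ′ = σ′} v τ)
        with result j (Vec.reverse v)
      ... | nothing = time-mono (≤-trans (+-monoʳ-≤ x (≤-trans (≤-reflexive (*-identityʳ (7 + c))) (m≤n+m (7 + c) 2)))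
                        (≤-reflexive (cong (_+ (9 + c)) (sym (+-identityʳ x)))))
                      (time-⟶ r (next-stage ccl))
      ... | just bs = time-mono (≤-reflexive (trans (cong (2 +_) (*-identityʳ (7 + c))) refl)) (time-⟶ r (time-⟶ {x = 0} (leave (proj₁ ccl)) time-stop))
      total : ∑ Z X + (1 + 6 * Z) * 2 ^ Z + 6 * 2 ^ Z ≡ failureSum j * x + (16 + c + 6 * Z) * 2 ^ Z
      total = trans (cong (λ s → s + (1 + 6 * Z) * 2 ^ Z + 6 * 2 ^ Z) sum-X) (eq (failureSum j * x) c Z (2 ^ Z))
        where
          sum-X : ∑ Z X ≡ failureSum j * x + 2 ^ Z * (9 + c)
          sum-X = trans (∑-reverse Z (λ u → failed k j hs (result j u) * x + (9 + c)))
            (trans (∑-+ Z (λ u → failed k j hs (result j u) * x) (λ _ → 9 + c))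
              (cong₂ _+_ (trans (∑-cong Z (λ u → *-comm (failed k j hs (result j u)) x)) (trans (∑-* Z x (λ u → failed k j hs (result j u))) (*-comm x (failureSum j))))
                         (∑-const Z (9 + c))))
          eq : ∀ s c Z p → s + p * (9 + c) + (1 + 6 * Z) * p + 6 * p ≡ s + (16 + c + 6 * Z) * p
          eq = solve-∀

  module _ {E : Config → Set} where

    -- For the stages before ℓ: they never end the run, so they delay the event by a bounded time
    -- and leave its probability as it is.
    likely-skip : ∀ {c j t rem σ B x Y} → SearchCost j c → AtStage j (t ∷ rem) σ → (∀ u → result j u ≡ nothing) →
      (∀ {σ′} → AtStage (suc j) rem σ′ → Likely E (while 2 stage ∷ final , σ′) B x Y) →
      Likely E (while 2 stage ∷ final , σ) (14 + c + 6 * Z + B) (2 ^ Z * x) (2 ^ Z * Y)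
    likely-skip {c} {j} {t} {rem} {σ} {B} {x} {Y} sc a none next-stage = likely-mono (≤-reflexive (eq c Z B)) (≤-reflexive (sym (∑-const Z x)))
        (likely-⟶ (enter-stage a) (likely-toss Z {acc = []} (λ _ → x) (ready-counter a) refl after))
      where
        after : ∀ (v : Vec Bool Z) {σ′} → Tossed (ready σ) (Vec.toList v List.ʳ++ []) σ′ → Likely E (conclude ∷ while 2 stage ∷ final , σ′) (7 + c + B) x Y
        after v {σ′} τ with σ″ , r , ccl ← conclude-⟶ (while 2 stage ∷ final) (Vec.reverse v) sc a (reversed {σ′ = σ′} v τ)
          rewrite none (Vec.reverse v) = likely-⟶ r (next-stage ccl)
        eq : ∀ c Z B → 6 + (1 + 6 * Z + (7 + c + B)) ≡ 14 + c + 6 * Z + B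
        eq = solve-∀

    likely-stage : ∀ {c j t rem σ} → SearchCost j c → AtStage j (t ∷ rem) σ →
      (∀ {σ} u bs → result j u ≡ just bs → σ 0 ≡ encodeMaybe (just bs) → E ([] , σ)) →
      Likely E (while 2 stage ∷ final , σ) (16 + c + 6 * Z) (2 ^ Z ∸ failureSum j) (2 ^ Z * 1)
    likely-stage {c} {j} {t} {rem} {σ} sc a found = likely-mono (≤-reflexive (eq c Z)) enough
        (likely-⟶ (enter-stage a) (likely-toss Z {acc = []} X (ready-counter a) refl after))
      where
        X : Vec Bool Z → ℕ
        X v = 1 ∸ failed k j hs (result j (Vec.reverse v))
        after : ∀ (v : Vec Bool Z) {σ′} → Tossed (ready σ) (Vec.toList v List.ʳ++ []) σ′ → Likely E (conclude ∷ while 2 stage ∷ final , σ′) (9 + c) (X v) 1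
        after v {σ′} τ with σ″ , r , ccl ← conclude-⟶ (while 2 stage ∷ final) (Vec.reverse v) sc a (reversed {σ′ = σ′} v τ)
          with result j (Vec.reverse v) in e
        ... | nothing = likely-never
        ... | just bs = likely-mono (≤-reflexive (trans (+-comm (7 + c) 2) refl)) ≤-refl
                          (likely-⟶ {B = 2} r (likely-⟶ {B = 0} (leave (proj₁ ccl)) (likely-stop (found (Vec.reverse v) bs e (proj₂ ccl)))))
        enough : 2 ^ Z ∸ failureSum j ≤ ∑ Z X
        enough = m≤n+o⇒m∸n≤o (2 ^ Z) (failureSum j) (≤-reflexive (sym (begin-equality
          failureSum j + ∑ Z X                                                               ≡⟨ cong (failureSum j +_) (∑-reverse Z (λ u → 1 ∸ failed k j hs (result j u))) ⟩
          failureSum j + ∑ Z (λ u → 1 ∸ failed k j hs (result j u))                          ≡⟨ sym (∑-+ Z (λ u → failed k j hs (result j u)) (λ u → 1 ∸ failed k j hs (result j u))) ⟩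
          ∑ Z (λ u → failed k j hs (result j u) + (1 ∸ failed k j hs (result j u)))          ≡⟨ ∑-cong Z (λ u → m+[n∸m]≡n (⟨⟩≤1 (not (Maybe.is-just (result j u))))) ⟩
          ∑ Z (λ _ → 1)                                                                      ≡⟨ trans (∑-const Z 1) (*-identityʳ _) ⟩
          2 ^ Z                                                                              ∎)))
          where open ≤-Reasoning
        eq : ∀ c Z → 6 + (1 + 6 * Z + (9 + c)) ≡ 16 + c + 6 * Z
        eq = solve-∀

  startStore : Store
  startStore = (λ _ → nil) [ 0 ↦ encodeInstance k hs ]

  initialize : ∀ {s w} → n ≤ s → m + n ≤ s → k ≤ s → (∀ i → i ≤ 20 * k → n ^ i ≤ suc w) →
    ∃[ σ ] start algorithm (encodeInstance k hs) ⟶⟨ 19 + (⟦ proj₁ (proj₂ numberOfTrialsP) ⟧ᵖ s * suc w + ⟦ proj₁ (proj₂ numberOfBitsP) ⟧ᵖ s * suc w) ⟩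
             (while 2 stage ∷ final , σ) × AtStage 0 (nil ∷ List.map encodeHedge hs) σ
  initialize {s} {w} n≤s le k≤s pw
    with judge val₁ cst₁ ← rule numberOfTrialsP n≤s 1≤k k≤s pw hs (nil ∷ nil ∷ nil ∷ nil ∷ nil ∷ nil ∷ nil ∷ nil ∷ [])
    with σ₁ , r₁ , e₁ , q₁ ← set-⟶ 8 (proj₁ numberOfTrialsP) startStore
           ((set 4 (proj₁ numberOfBitsP) ⨾ set 2 (consᵗ nilᵗ (tlᵗ (tlᵗ (varᵗ zero)))) ⨾ while 2 stage ⨾ 0 ≔ varᵉ 1) ∷ []) val₁ cst₁ (s≤s (s≤s (s≤s (s≤s (s≤s (s≤s (s≤s (s≤s (s≤s z≤n)))))))))
    with ρ≡ ← cong₂ _∷_ (q₁ 0 (s≤s z≤n) (λ ())) (cong (λ v → σ₁ 1 ∷ σ₁ 2 ∷ σ₁ 3 ∷ σ₁ 4 ∷ σ₁ 5 ∷ σ₁ 6 ∷ σ₁ 7 ∷ v) (cong (_∷ []) e₁))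
    with judge val₂ cst₂ ← rule numberOfBitsP {n} {s} {w} hs len le {k} (subst (_≤ suc w) (sym (^-*-assoc n 20 k)) (pw (20 * k) ≤-refl))
                             (σ₁ 1) (σ₁ 2) (σ₁ 3) (σ₁ 4) (σ₁ 5) (σ₁ 6) (σ₁ 7)
    with σ₂ , r₂ , e₂ , q₂ ← set-⟶ 4 (proj₁ numberOfBitsP) σ₁ ((set 2 (consᵗ nilᵗ (tlᵗ (tlᵗ (varᵗ zero)))) ⨾ while 2 stage ⨾ 0 ≔ varᵉ 1) ∷ [])
           (trans (cong ⟦ proj₁ numberOfBitsP ⟧ ρ≡) val₂) (≤-trans (≤-reflexive (cong (cost (proj₁ numberOfBitsP)) ρ≡)) cst₂) (s≤s (s≤s (s≤s (s≤s (s≤s z≤n)))))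
    with σ₃ , r₃ , e₃ , q₃ ← set-⟶ 2 (consᵗ nilᵗ (tlᵗ (tlᵗ (varᵗ zero)))) σ₂ {c = 9} ((while 2 stage ⨾ 0 ≔ varᵉ 1) ∷ [])
           refl ≤-refl (s≤s (s≤s (s≤s z≤n))) =
    σ₃ , ⟶-mono (seq-⟶ r₁ (seq-⟶ r₂ (seq-⟶ r₃ (next {t = 0} (λ _ → refl) done))))
           (≤-reflexive (eq (⟦ proj₁ (proj₂ numberOfTrialsP) ⟧ᵖ s * suc w) (⟦ proj₁ (proj₂ numberOfBitsP) ⟧ᵖ s * suc w))) ,
    record
      { at₀ = trans (q₃ 0 (s≤s z≤n) (λ ())) f₀
      ; at₁ = trans (q₃ 1 (s≤s (s≤s z≤n)) (λ ())) (trans (q₂ 1 (s≤s (s≤s z≤n)) (λ ())) (q₁ 1 (s≤s (s≤s z≤n)) (λ ())))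
      ; at₂ = trans e₃ (cong (cons nil) (cong (tl ∘ tl) f₀))
      ; at₃ = trans (q₃ 3 l₃ (λ ())) (trans (q₂ 3 l₃ (λ ())) (q₁ 3 l₃ (λ ())))
      ; at₄ = trans (q₃ 4 (s≤s (s≤s (s≤s (s≤s (s≤s z≤n))))) (λ ())) e₂
      ; at₈ = trans (q₃ 8 l₈ (λ ())) (trans (q₂ 8 l₈ (λ ())) e₁)
      }
    where
      l₃ : 3 < 9
      l₃ = s≤s (s≤s (s≤s (s≤s z≤n)))
      l₈ : 8 < 9
      l₈ = s≤s (s≤s (s≤s (s≤s (s≤s (s≤s (s≤s (s≤s (s≤s z≤n))))))))
      f₀ = trans (q₂ 0 (s≤s z≤n) (λ ())) (q₁ 0 (s≤s z≤n) (λ ()))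
      eq : ∀ a b → suc (2 + a + suc (2 + b + suc (11 + 1))) ≡ 19 + (a + b)
      eq = solve-∀

-- Binomial coefficients and the logarithm

bin-C : ∀ a b → bin a b ≡ (a + b) C b
bin-C zero    b       = sym (nCn≡1 b)
bin-C (suc a) zero    = sym (trans (nCk≡nC[n∸k] {n = suc a + 0} z≤n) (nCn≡1 (suc a + 0)))
bin-C (suc a) (suc b) = begin-equality
  bin a (suc b) + bin (suc a) b                    ≡⟨ cong₂ _+_ (bin-C a (suc b)) (bin-C (suc a) b) ⟩
  (a + suc b) C suc b + (suc a + b) C b            ≡⟨ cong (λ x → (a + suc b) C suc b + x C b) (sym (+-suc a b)) ⟩
  (a + suc b) C suc b + (a + suc b) C b            ≡⟨ +-comm ((a + suc b) C suc b) _ ⟩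
  (a + suc b) C b + (a + suc b) C suc b            ≡⟨ nCk+nC[k+1]≡[n+1]C[k+1] (a + suc b) b ⟩
  suc (a + suc b) C suc b                          ∎
  where open ≤-Reasoning

bin-suc-left : ∀ a b → bin a b ≤ bin (suc a) b
bin-suc-left a zero    = ≤-reflexive (bin-zero a)
bin-suc-left a (suc b) = m≤m+n (bin a (suc b)) _

bin-monoˡ : ∀ b {a a′} → a ≤ a′ → bin a b ≤ bin a′ b
bin-monoˡ b {a} {a′} le with m≤n⇒∃[o]m+o≡n le
... | o , refl = go′ o
  where
    go′ : ∀ o → bin a b ≤ bin (a + o) b
    go′ zero    = ≤-reflexive (cong (λ x → bin x b) (sym (+-identityʳ a)))
    go′ (suc o) = ≤-trans (go′ o) (≤-trans (bin-suc-left (a + o) b) (≤-reflexive (cong (λ x → bin x b) (sym (+-suc a o)))))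

-- The quotient of the two binomial coefficients is (a + b + 1) / (b + 1). This is the growth of the
-- time from one stage to the next.
bin-suc-right : ∀ a b → bin a (suc b) ≤ suc a * bin a b
bin-suc-right zero    b = ≤-refl
bin-suc-right (suc a) b = begin
  bin a (suc b) + bin (suc a) b            ≤⟨ +-monoˡ-≤ _ (bin-suc-right a b) ⟩
  suc a * bin a b + bin (suc a) b          ≤⟨ +-monoˡ-≤ _ (*-monoʳ-≤ (suc a) (bin-suc-left a b)) ⟩
  suc a * bin (suc a) b + bin (suc a) b    ≡⟨ +-comm (suc a * bin (suc a) b) _ ⟩
  suc (suc a) * bin (suc a) b              ∎
  where open ≤-Reasoning

bin-step-right : ∀ a b → bin a b ≤ bin a (suc b)
bin-step-right zero    b = ≤-refl
bin-step-right (suc a) b = m≤n+m (bin (suc a) b) (bin a (suc b))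

bin-monoʳ : ∀ a b d → bin a b ≤ bin a (b + d)
bin-monoʳ a b zero    = ≤-reflexive (cong (bin a) (sym (+-identityʳ b)))
bin-monoʳ a b (suc d) = ≤-trans (bin-monoʳ a b d) (≤-trans (bin-step-right a (b + d)) (≤-reflexive (cong (bin a) (sym (+-suc b d)))))

-- (1 + 1/i)ⁱ ≤ 4, since (1 − 1/(i + 1))ʲ ≥ 1 − j/(i + 1) ≥ 1/2 for j = ⌈ i / 2 ⌉.

bernoulli-below : ∀ i j d → suc i ≡ j + d → suc i ^ j * d ≤ i ^ j * suc i
bernoulli-below i zero    d e = ≤-reflexive (trans (*-identityˡ d) (trans (sym e) (sym (*-identityˡ _))))
bernoulli-below i (suc j) d e = begin
  suc i * suc i ^ j * d             ≡⟨ eq₁ (suc i) (suc i ^ j) d ⟩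
  suc i ^ j * (suc i * d)           ≤⟨ *-monoʳ-≤ (suc i ^ j) (≤-trans (+-monoˡ-≤ (i * d) d≤i) (≤-reflexive (sym (*-suc i d)))) ⟩
  suc i ^ j * (i * suc d)           ≡⟨ eq₂ (suc i ^ j) i (suc d) ⟩
  i * (suc i ^ j * suc d)           ≤⟨ *-monoʳ-≤ i (bernoulli-below i j (suc d) (trans e (sym (+-suc j d)))) ⟩
  i * (i ^ j * suc i)               ≡⟨ sym (*-assoc i _ _) ⟩
  i * i ^ j * suc i                 ∎
  where
    open ≤-Reasoning
    d≤i : d ≤ i
    d≤i = ≤-trans (m≤n+m d j) (≤-reflexive (sym (suc-injective e)))
    eq₁ : ∀ a b c → a * b * c ≡ b * (a * c)
    eq₁ = solve-∀
    eq₂ : ∀ a b c → a * (b * c) ≡ b * (a * c)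
    eq₂ = solve-∀

half-power : ∀ i j d → suc i ≡ j + d → j ≤ d → suc i ^ j ≤ 2 * i ^ j
half-power i j d e le = *-cancelʳ-≤ _ _ (suc i) (begin
  suc i ^ j * suc i            ≡⟨ cong (suc i ^ j *_) e ⟩
  suc i ^ j * (j + d)          ≤⟨ *-monoʳ-≤ (suc i ^ j) (+-monoˡ-≤ d le) ⟩
  suc i ^ j * (d + d)          ≡⟨ *-distribˡ-+ (suc i ^ j) d d ⟩
  suc i ^ j * d + suc i ^ j * d ≤⟨ +-mono-≤ (bernoulli-below i j d e) (bernoulli-below i j d e) ⟩
  i ^ j * suc i + i ^ j * suc i ≡⟨ eq (i ^ j) (suc i) ⟩
  2 * i ^ j * suc i            ∎)
  where
    open ≤-Reasoning
    eq : ∀ a b → a * b + a * b ≡ 2 * a * b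
    eq = solve-∀

square-power : ∀ i j d → suc i ≡ j + d → j ≤ d → suc i ^ (j + j) ≤ 4 * i ^ (j + j)
square-power i j d e le = begin
  suc i ^ (j + j)                ≡⟨ ^-distribˡ-+-* (suc i) j j ⟩
  suc i ^ j * suc i ^ j          ≤⟨ *-mono-≤ (half-power i j d e le) (half-power i j d e le) ⟩
  2 * i ^ j * (2 * i ^ j)        ≡⟨ eq (i ^ j) ⟩
  4 * (i ^ j * i ^ j)            ≡⟨ cong (4 *_) (sym (^-distribˡ-+-* i j j)) ⟩
  4 * i ^ (j + j)                ∎
  where
    open ≤-Reasoning
    eq : ∀ a → 2 * a * (2 * a) ≡ 4 * (a * a)
    eq = solve-∀

halves : ∀ i → ∃[ j ] (i ≡ j + j ⊎ suc i ≡ j + j)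
halves zero    = 0 , inj₁ refl
halves (suc i) with halves i
... | j , inj₁ e = suc j , inj₂ (trans (cong (λ x → suc (suc x)) e) (cong suc (sym (+-suc j j))))
... | j , inj₂ e = j , inj₁ e

e≤4 : ∀ i → suc i ^ i ≤ 4 * i ^ i
e≤4 i with halves i
... | j , inj₁ e = subst (λ x → suc i ^ x ≤ 4 * i ^ x) (sym e) (square-power i j (suc j) (trans (cong suc e) (sym (+-suc j j))) (n≤1+n j))
... | j , inj₂ e = *-cancelʳ-≤ _ _ (suc i) (begin
  suc i ^ i * suc i            ≡⟨ *-comm (suc i ^ i) (suc i) ⟩
  suc i ^ suc i                ≡⟨ cong (suc i ^_) e ⟩
  suc i ^ (j + j)              ≤⟨ square-power i j j e ≤-refl ⟩
  4 * i ^ (j + j)              ≡⟨ cong (λ x → 4 * i ^ x) (sym e) ⟩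
  4 * (i * i ^ i)              ≤⟨ *-monoʳ-≤ 4 (*-monoˡ-≤ (i ^ i) (n≤1+n i)) ⟩
  4 * (suc i * i ^ i)          ≡⟨ eq (suc i) (i ^ i) ⟩
  4 * i ^ i * suc i            ∎)
  where
    open ≤-Reasoning
    eq : ∀ a b → 4 * (a * b) ≡ 4 * b * a
    eq = solve-∀

^-distribʳ-* : ∀ x y e → (x * y) ^ e ≡ x ^ e * y ^ e
^-distribʳ-* x y zero    = refl
^-distribʳ-* x y (suc e) = trans (cong (x * y *_) (^-distribʳ-* x y e)) (eq x y (x ^ e) (y ^ e))
  where eq : ∀ x y u v → x * y * (u * v) ≡ x * u * (y * v)
        eq = solve-∀

-- The only fact about e that the proof extracts from the logarithm: e ≤ 4. It turns L into a bound
-- on the number of times that a power of n can be divided by 4.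
<Exp-<4^ : ∀ x a → <Exp x a → x < 4 ^ a
<Exp-<4^ x a (i , lt) = *-cancelʳ-< (i ^ (i * a)) x (4 ^ a) (≤-trans lt (begin
  suc i ^ (i * a)              ≡⟨ sym (^-*-assoc (suc i) i a) ⟩
  (suc i ^ i) ^ a              ≤⟨ ^-monoˡ-≤ a (e≤4 i) ⟩
  (4 * i ^ i) ^ a              ≡⟨ ^-distribʳ-* 4 (i ^ i) a ⟩
  4 ^ a * (i ^ i) ^ a          ≡⟨ cong (4 ^ a *_) (^-*-assoc i i a) ⟩
  4 ^ a * i ^ (i * a)          ∎))
  where
    open ≤-Reasoning

half-probability : ∀ x y → x ≤ 2 * y → ½ ℚ.* (ℤ.+ x ℚ./ 1) ℚ.≤ ℤ.+ y ℚ./ 1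
half-probability x y le = ℚₚ.toℚᵘ-cancel-≤
  (ℚᵘₚ.≤-respˡ-≃ (ℚᵘₚ.≃-sym (ℚᵘₚ.≃-trans (ℚₚ.toℚᵘ-homo-* ½ (ℤ.+ x ℚ./ 1)) (ℚᵘₚ.*-congˡ {ℚ.toℚᵘ ½} (ℚₚ.toℚᵘ-fromℚᵘ (ℚᵘ.mkℚᵘ (ℤ.+ x) 0)))))
    (ℚᵘₚ.≤-respʳ-≃ (ℚᵘₚ.≃-sym (ℚₚ.toℚᵘ-fromℚᵘ (ℚᵘ.mkℚᵘ (ℤ.+ y) 0)))
      (ℚᵘ.*≤* (subst₂ ℤ._≤_ (lhs x) (rhs y) (ℤ.+≤+ le)))))
  where
    lhs : ∀ x → ℤ.+ x ≡ (ℤ.+ 1 ℤ.* ℤ.+ x) ℤ.* ℤ.+ 1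
    lhs x = sym (trans (ℤₚ.*-identityʳ _) (ℤₚ.*-identityˡ (ℤ.+ x)))
    rhs : ∀ y → ℤ.+ (2 * y) ≡ ℤ.+ y ℤ.* ℤ.+ 2
    rhs y = trans (cong ℤ.+_ (*-comm 2 y)) (ℤₚ.pos-* y 2)

0<½ : 0ℚ ℚ.< ½
0<½ = ℚ.*<* (ℤ.+<+ (s≤s z≤n))

-- The number of contractions of large hedges

module Contractions (k : ℕ) (1≤k : 1 ≤ k) where

  -- The potential r^(24k) of r blocks loses a factor 4 with each large contraction, so at most `a`
  -- of them are possible from here.
  Reach : ℕ → ℕ → Set
  Reach a r = r ^ (24 * k) < 4 ^ suc a

  reach-mono : ∀ {a r r′} → r′ ≤ r → Reach a r → Reach a r′
  reach-mono le p = ≤-trans (s≤s (^-monoˡ-≤ (24 * k) le)) p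

  -- A large contraction removes a fraction of at least 1 / (8k), so by Bernoulli the power with
  -- exponent 24k shrinks at least by the factor 1 + 24k / (8k) = 4.
  reach-step : ∀ {a r r′} → Reach a r → r ≤ (r ∸ r′) * (k * 8) → r′ < r → 1 ≤ r′ → ∃[ a′ ] a ≡ suc a′ × Reach a′ r′
  reach-step {a} {r} {r′} p large lt 1≤r′ = cases a (≤-trans (s≤s four) p)
    where
      open ≤-Reasoning
      e = 24 * k
      q+r = m+[n∸m]≡n (<⇒≤ lt)
      four : 4 * r′ ^ e ≤ r ^ e
      four = *-cancelʳ-≤ (4 * r′ ^ e) (r ^ e) r {{>-nonZero (≤-trans (s≤s z≤n) lt)}} (begin
        4 * r′ ^ e * r                              ≡⟨ eq₁ (r′ ^ e) r ⟩
        r′ ^ e * (r + 3 * r)                        ≤⟨ *-monoʳ-≤ (r′ ^ e) (+-monoʳ-≤ r (≤-trans (*-monoʳ-≤ 3 large) (≤-reflexive (eq₂ k (r ∸ r′))))) ⟩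
        r′ ^ e * (r + e * (r ∸ r′))                 ≡⟨ cong (λ x → r′ ^ e * (x + e * (r ∸ r′))) (sym q+r) ⟩
        r′ ^ e * (r′ + (r ∸ r′) + e * (r ∸ r′))     ≤⟨ bernoulli r′ (r ∸ r′) e ⟩
        (r′ + (r ∸ r′)) ^ e * (r′ + (r ∸ r′))       ≡⟨ cong (λ x → x ^ e * x) q+r ⟩
        r ^ e * r                                   ∎)
        where
          eq₁ : ∀ x r → 4 * x * r ≡ x * (r + 3 * r)
          eq₁ = solve-∀
          eq₂ : ∀ k d → 3 * (d * (k * 8)) ≡ 24 * k * d
          eq₂ = solve-∀
      cases : ∀ a → 4 * r′ ^ e < 4 ^ suc a → ∃[ a′ ] a ≡ suc a′ × Reach a′ r′
      cases zero    lt′ = ⊥-elim (<-irrefl refl (≤-trans lt′ (*-monoʳ-≤ 4 (m^n>0 r′ {{>-nonZero 1≤r′}} e))))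
      cases (suc a) lt′ = a , refl , *-cancelˡ-< 4 (r′ ^ e) (4 ^ suc a) lt′

  -- A crude bound from n ≤ 2^n. In contrast to L it does not involve `constant`.
  reach-linear : ∀ n → Reach (24 * k * n) n
  reach-linear n = begin-strict
    n ^ (24 * k)                ≤⟨ ^-monoˡ-≤ (24 * k) (n≤2^n n) ⟩
    (2 ^ n) ^ (24 * k)          ≡⟨ ^-*-assoc 2 n (24 * k) ⟩
    2 ^ (n * (24 * k))          ≡⟨ cong (2 ^_) (*-comm n (24 * k)) ⟩
    2 ^ (24 * k * n)            ≤⟨ ^-monoˡ-≤ (24 * k * n) {2} {4} (s≤s (s≤s z≤n)) ⟩
    4 ^ (24 * k * n)            <⟨ ^-monoʳ-< 4 (s≤s (s≤s z≤n)) (n<1+n (24 * k * n)) ⟩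
    4 ^ suc (24 * k * n)        ∎
    where open ≤-Reasoning

-- For termination it suffices that every contraction removes a block.
module Blocks where

  Enough : ℕ → ℕ → Set
  Enough a r = r ≤ suc a

  enough-step : ∀ {k a r r′} → Enough a r → r ≤ (r ∸ r′) * (k * 8) → r′ < r → 1 ≤ r′ → ∃[ a′ ] a ≡ suc a′ × Enough a′ r′
  enough-step {a = zero}  p _ lt ge = ⊥-elim (<-irrefl refl (≤-trans (s≤s ge) (≤-trans lt p)))
  enough-step {a = suc a} p _ lt ge = a , refl , s≤s⁻¹ (≤-trans lt p)

likely-ratio : ∀ {E γ B x Y x′ Y′} → 1 ≤ Y → x′ * Y ≤ Y′ * x → Likely E γ B x Y → Likely E γ B x′ Y′
likely-ratio {x = x} {Y} {x′} {Y′} 1≤Y le l = likely λ N B≤ → let S , p , q = Likely.event l N B≤ in S , p ,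
  *-cancelˡ-≤ Y {{>-nonZero 1≤Y}} (begin
    Y * (x′ * 2 ^ N)                       ≡⟨ eq₁ Y x′ (2 ^ N) ⟩
    x′ * Y * 2 ^ N                         ≤⟨ *-monoˡ-≤ (2 ^ N) le ⟩
    Y′ * x * 2 ^ N                         ≡⟨ *-assoc Y′ x _ ⟩
    Y′ * (x * 2 ^ N)                       ≤⟨ *-monoʳ-≤ Y′ q ⟩
    Y′ * (Y * ∑ N (λ w → ⟨ S w ⟩))         ≡⟨ eq₂ Y′ Y (∑ N (λ w → ⟨ S w ⟩)) ⟩
    Y * (Y′ * ∑ N (λ w → ⟨ S w ⟩))         ∎)
  where
    open ≤-Reasoning
    eq₁ : ∀ a b c → a * (b * c) ≡ b * a * c
    eq₁ = solve-∀
    eq₂ : ∀ a b c → a * (b * c) ≡ b * (a * c)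
    eq₂ = solve-∀

time-ratio : ∀ {γ y Y x} → 1 ≤ Y → y ≤ x * Y → Time≤ γ y Y → Time≤ γ x 1
time-ratio {γ} {y} {Y} {x} 1≤Y le τ = timed λ N → *-cancelˡ-≤ Y {{>-nonZero 1≤Y}} (begin
  Y * (1 * ∑ N (time γ))        ≡⟨ cong (Y *_) (*-identityˡ _) ⟩
  Y * ∑ N (time γ)              ≤⟨ Time≤.total-time τ N ⟩
  y * 2 ^ N                     ≤⟨ *-monoˡ-≤ (2 ^ N) le ⟩
  x * Y * 2 ^ N                 ≡⟨ eq x Y (2 ^ N) ⟩
  Y * (x * 2 ^ N)               ∎)
  where
    open ≤-Reasoning
    eq : ∀ a b c → a * b * c ≡ b * (a * c)
    eq = solve-∀

n^i≤ : ∀ n {i N} → i ≤ N → n ^ i ≤ suc (n ^ N)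
n^i≤ zero    {zero}  le = s≤s z≤n
n^i≤ zero    {suc i} le = z≤n
n^i≤ (suc n) le = m≤n⇒m≤1+n (^-monoʳ-≤ (suc n) le)

stagePoly initPoly : Poly
stagePoly = con 16 ⊕ con 3 ⊗ proj₁ (proj₂ searchP) ⊕ con 6 ⊗ size ⊗ size
initPoly  = con 19 ⊕ con 2 ⊗ proj₁ (proj₂ numberOfTrialsP) ⊕ con 2 ⊗ proj₁ (proj₂ numberOfBitsP)

-- The factor 3 stems from s ≤ n³ (m + 1), which turns a power of s into powers of n and m + 1. The
-- summand 47 leaves room for the exponents 20k of the number of trials and 24k of `Reach`.
totalDegree constant : ℕ
totalDegree = degree (stagePoly ⊕ initPoly)
constant    = 47 + 3 * totalDegree

-- Correctness and expected time on a given input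

module Instance (G : HedgeGraph) (k : ℕ) (2≤k : 2 ≤ k) where

  n₀ = HedgeGraph.n G
  m₀ = HedgeGraph.m G
  hs = Vec.toList (hedges G)

  len : length hs ≡ m₀
  len = Vecₚ.length-toList (hedges G)

  1≤k : 1 ≤ k
  1≤k = ≤-trans (s≤s z≤n) 2≤k

  open Run {n₀} k m₀ hs len 1≤k

  input≡ : encodeInput G k ≡ encodeInstance k hs
  input≡ = cong (λ t → cons (encodeℕ n₀) (cons (encodeℕ k) (encodeList t))) (Vecₚ.toList-map encodeHedge (hedges G))

  search-cost : ∀ {s w₁} → m₀ + n₀ ≤ s → k ≤ s → ∀ {j} → j ≤ s → (I : Invariant {n₀} k m₀ s w₁) → Invariant.Inv I (initial j hs) →
    SearchCost j (⟦ proj₁ (proj₂ searchP) ⟧ᵖ s * suc (R * suc w₁))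
  search-cost {w₁ = w₁} le k≤s j≤s I i u y₁ y₂ y₄ y₅ y₇ =
    let judge v c = rule searchP {w = R * suc w₁} hs len le 1≤k k≤s j≤s I i (n≤1+n _) u y₁ y₂ y₄ y₅ y₇ in v , c

  module General (j : ℕ) where

    s = m₀ + n₀ + k + j
    open Weights k m₀ Blocks.Enough ≤-trans (Blocks.enough-step {k})

    m+n≤s : m₀ + n₀ ≤ s
    m+n≤s = ≤-trans (m≤m+n _ k) (m≤m+n _ j)

    invariant : Invariant {n₀} k m₀ s (bin n₀ j)
    invariant = weightInvariant s (bin n₀ j) (≤-trans (m≤m+n m₀ n₀) m+n≤s)

    holds-initially : Invariant.Inv invariant (initial j hs)
    holds-initially = initial-weighted (n≤1+n n₀) (≤-reflexive len)

    some-cost : ∃[ c ] SearchCost j c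
    some-cost = _ , search-cost m+n≤s (≤-trans (m≤n+m k (m₀ + n₀)) (m≤m+n _ j)) (m≤n+m j (m₀ + n₀ + k)) invariant holds-initially

    cut-set : ∀ u bs → result j u ≡ just bs → ∃[ D ] encodeMaybe (just bs) ≡ encodeResult D × IsKCutSet G k D × ∣ D ∣ ≤ j
    cut-set u bs e with subst (Result invariant 1≤k j hs) e (trials-result invariant 1≤k j hs holds-initially (m₀ + n₀) R u nothing tt)
    ... | bl , V , le , refl , cnt = D , encodeMaybe-result (cutTest (coarsen k bl)) (hedges G) , result-cutSet G bl V 1≤k le ,
            ≤-trans (≤-reflexive (trans (size-count D) (cong count (Vecₚ.toList-map (cutTest (coarsen k bl)) (hedges G))))) cnt
      where D = Vec.map (cutTest (coarsen k bl)) (hedges G)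

  Correct : Store → Set
  Correct σ = σ 0 ≡ nil ⊎ ∃[ D ] σ 0 ≡ encodeResult D × IsKCutSet G k D

  stages-terminate : ∀ rem j {σ} → AtStage j rem σ → Terminates Correct (while 2 stage ∷ final , σ)
  stages-terminate rem j a = terminates-stages {Q = Correct} inj₁ (λ {σ} → correct {σ}) General.some-cost rem j a
    where
      correct : ∀ {σ} j u bs → result j u ≡ just bs → σ 0 ≡ encodeMaybe (just bs) → Correct σ
      correct j u bs e o with D , e′ , p , _ ← General.cut-set j u bs e = inj₂ (D , trans o e′ , p)

  initialized : ∀ {s w} → m₀ + n₀ + k ≤ s → n₀ ^ (20 * k) ≤ w →
    ∃[ σ ] start algorithm (encodeInstance k hs) ⟶⟨ 19 + (⟦ proj₁ (proj₂ numberOfTrialsP) ⟧ᵖ s * suc w + ⟦ proj₁ (proj₂ numberOfBitsP) ⟧ᵖ s * suc w) ⟩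
             (while 2 stage ∷ final , σ) × AtStage 0 (nil ∷ List.map encodeHedge hs) σ
  initialized {s} {w} s≥ w≥ = initialize {s} {w}
    (≤-trans (≤-trans (m≤n+m n₀ m₀) (m≤m+n (m₀ + n₀) k)) s≥) (≤-trans (m≤m+n (m₀ + n₀) k) s≥) (≤-trans (m≤n+m k (m₀ + n₀)) s≥)
    (λ i i≤ → ≤-trans (n^i≤ n₀ {i} {20 * k} i≤) (s≤s w≥))

  terminates-instance : Terminates Correct (start algorithm (encodeInstance k hs))
  terminates-instance = terminates-⟶ (proj₁ (proj₂ start-up)) (stages-terminate (nil ∷ List.map encodeHedge hs) 0 (proj₂ (proj₂ start-up)))
    where start-up = initialized {m₀ + n₀ + k} {n₀ ^ (20 * k)} ≤-refl ≤-refl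

  terminates : Terminates Correct (start algorithm (encodeInput G k))
  terminates = subst (λ t → Terminates Correct (start algorithm t)) (sym input≡) terminates-instance

  correct-output : ∀ γ → Halted γ → Correct (proj₂ γ) → output γ ≡ nil ⊎ (∃[ D ] Outputs γ D × IsKCutSet G k D)
  correct-output γ h (inj₁ e)           = inj₁ e
  correct-output γ h (inj₂ (D , e , p)) = inj₂ (D , (h , e) , p)

  sound : Sound algorithm G k
  sound N w h = correct-output (run (start algorithm (encodeInput G k)) w) h (terminates-sound terminates w h)

  module Bounds (ℓ L : ℕ) (C₀ : Subset m₀) (opt : IsOptimum G k C₀) (size≡ : ∣ C₀ ∣ ≡ ℓ)
    (ln : IsFloorLn (n₀ ^ (constant * k)) L) where

    P : Fin n₀ → Fin k
    P = part (proj₁ (proj₁ opt))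

    value≡ : Σˡ hs (cuts P) ≡ ℓ
    value≡ = trans (kCutSet-size G (proj₁ opt)) size≡

    optimal : ∀ {k′} → k′ ≡ k → (f : Fin n₀ → Fin k′) → StrictlySurjective _≡_ f → ℓ ≤ Σˡ hs (cuts f)
    optimal {k′} e f onto = ≤-trans (≤-reflexive (sym size≡)) (≤-trans
      (proj₂ opt (cutSubset G f) (isKCutSet G e f onto (λ h → does (cut? f h)) (λ h → refl)))
      (≤-reflexive (size-map (λ h → does (cut? f h)) (hedges G))))

    ℓ≤m : ℓ ≤ m₀
    ℓ≤m = ≤-trans (≤-reflexive (sym size≡)) (∣p∣≤n C₀)

    k≤n : k ≤ n₀
    k≤n = Finₚ.injective⇒≤ {f = λ i → proj₁ (nonEmpty (proj₁ (proj₁ opt)) i)} (λ {i} {i′} e →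
      trans (sym (proj₂ (nonEmpty (proj₁ (proj₁ opt)) i))) (trans (cong P e) (proj₂ (nonEmpty (proj₁ (proj₁ opt)) i′))))

    2≤n : 2 ≤ n₀
    2≤n = ≤-trans 2≤k k≤n

    instance
      n₀≢0 : NonZero n₀
      n₀≢0 = >-nonZero (≤-trans (s≤s z≤n) 2≤n)

    s : ℕ
    s = m₀ + n₀ + k

    open Contractions k 1≤k

    -- `L` grows with `constant`, and thus with the degrees of the programs, while the number of
    -- trials has to exceed 2 (L₀ + 1) n^(16k). The minimum with an explicit bound breaks this
    -- circle: n^(20k) trials are enough, whatever `constant` is.
    L₀ : ℕ
    L₀ = L ⊓ (24 * k * n₀)

    reach-L₀ : Reach L₀ n₀
    reach-L₀ with ⊓-sel L (24 * k * n₀)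
    ... | inj₁ e = subst (λ a → Reach a n₀) (sym e) (≤-trans
            (s≤s (^-monoʳ-≤ n₀ (*-monoˡ-≤ k (≤-trans (m≤m+n 24 23) (m≤m+n 47 (3 * totalDegree))))))
            (<Exp-<4^ (n₀ ^ (constant * k)) (suc L) (proj₂ ln)))
    ... | inj₂ e = subst (λ a → Reach a n₀) (sym e) (reach-linear n₀)

    open Weights k m₀ Reach (λ {a} {r} {r′} → reach-mono {a} {r} {r′}) (λ {a} {r} {r′} → reach-step {a} {r} {r′})

    W : ℕ → ℕ
    W j = bin L₀ j

    m+n≤s : m₀ + n₀ ≤ s
    m+n≤s = m≤m+n _ k

    m≤s : m₀ ≤ s
    m≤s = ≤-trans (m≤m+n m₀ n₀) m+n≤s

    k≤s : k ≤ s
    k≤s = m≤n+m k _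

    stage-cost : ∀ {j} → j ≤ m₀ → SearchCost j (⟦ proj₁ (proj₂ searchP) ⟧ᵖ s * suc (R * suc (W j)))
    stage-cost {j} j≤m = search-cost m+n≤s k≤s (≤-trans j≤m m≤s) (weightInvariant s (W j) m≤s)
      (initial-weighted {a = L₀} reach-L₀ (≤-reflexive len))

    R≡ : R ≡ n₀ ^ (20 * k)
    R≡ = ^-*-assoc n₀ 20 k

    R≥1 : 1 ≤ R
    R≥1 = subst (1 ≤_) (sym R≡) (m^n>0 n₀ (20 * k))

    base : ℕ
    base = ⟦ stagePoly ⟧ᵖ s * R

    base≥16 : 16 ≤ base
    base≥16 = ≤-trans (m≤m+n 16 _) (m≤m*n (⟦ stagePoly ⟧ᵖ s) R {{>-nonZero R≥1}})

    own-time : ℕ → ℕ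
    own-time j = 16 + ⟦ proj₁ (proj₂ searchP) ⟧ᵖ s * suc (R * suc (W j)) + 6 * Z

    own-time≤ : ∀ j → own-time j ≤ base * W j
    own-time≤ j = begin
      16 + p * suc (R * suc w) + 6 * Z                    ≤⟨ +-mono-≤ (+-mono-≤ (m≤m*n 16 (R * w) {{Rw≢0}}) (*-monoʳ-≤ p scale)) (*-monoʳ-≤ 6 Z≤) ⟩
      16 * (R * w) + p * (3 * (R * w)) + 6 * (s * s * (R * w)) ≡⟨ eq p (R * w) s ⟩
      (16 + (3 * p + 6 * (s * s))) * (R * w)              ≡⟨ sym (*-assoc (16 + (3 * p + 6 * (s * s))) R w) ⟩
      base * w                                            ∎
      where
        open ≤-Reasoning
        p = ⟦ proj₁ (proj₂ searchP) ⟧ᵖ s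
        w = W j
        w≥1 = bin≥1 L₀ j
        Rw≢0 : NonZero (R * w)
        Rw≢0 = >-nonZero (*-mono-≤ R≥1 w≥1)
        scale : suc (R * suc w) ≤ 3 * (R * w)
        scale = ≤-trans (+-mono-≤ (*-mono-≤ R≥1 w≥1) (*-monoʳ-≤ R (+-monoˡ-≤ w w≥1))) (≤-reflexive (eq′ R w))
          where eq′ : ∀ R w → R * w + R * (w + w) ≡ 3 * (R * w)
                eq′ = solve-∀
        Z≤ : Z ≤ s * s * (R * w)
        Z≤ = ≤-trans (*-monoʳ-≤ R (*-mono-≤ m+n≤s m≤s)) (≤-trans (m≤m*n (R * (s * s)) w {{>-nonZero w≥1}}) (≤-reflexive (eq″ R (s * s) w)))
          where eq″ : ∀ R t w → R * t * w ≡ t * (R * w)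
                eq″ = solve-∀
        eq : ∀ p x s → 16 * x + p * (3 * x) + 6 * (s * s * x) ≡ (16 + (3 * p + 6 * (s * s))) * x
        eq = solve-∀

    -- From k ≤ n one has 2 (24kn + 1) ≤ 50 n² ≤ 2⁶ n² ≤ n⁸ ≤ n^(4k), where the last step uses k ≥
    -- 2.
    L₀-bound : 2 * suc L₀ * n₀ ^ (16 * k) ≤ R
    L₀-bound = begin
      2 * suc L₀ * n₀ ^ (16 * k)                       ≤⟨ *-monoˡ-≤ _ (*-monoʳ-≤ 2 (s≤s (m⊓n≤n L (24 * k * n₀)))) ⟩
      2 * suc (24 * k * n₀) * n₀ ^ (16 * k)            ≤⟨ *-monoˡ-≤ _ (*-monoʳ-≤ 2 (+-mono-≤ (*-mono-≤ n≥1 n≥1) (≤-trans (*-monoˡ-≤ n₀ (*-monoʳ-≤ 24 k≤n)) (≤-reflexive (*-assoc 24 n₀ n₀))))) ⟩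
      2 * (n₀ * n₀ + 24 * (n₀ * n₀)) * n₀ ^ (16 * k)   ≤⟨ *-monoˡ-≤ _ (≤-trans (≤-reflexive (eq (n₀ * n₀))) (*-monoˡ-≤ (n₀ * n₀) (≤-trans (m≤m+n 50 14) (^-monoˡ-≤ 6 2≤n)))) ⟩
      n₀ ^ 6 * (n₀ * n₀) * n₀ ^ (16 * k)               ≡⟨ cong (_* n₀ ^ (16 * k)) (eq₂ n₀) ⟩
      n₀ ^ 8 * n₀ ^ (16 * k)                           ≤⟨ *-monoˡ-≤ _ (^-monoʳ-≤ n₀ (*-monoʳ-≤ 4 2≤k)) ⟩
      n₀ ^ (4 * k) * n₀ ^ (16 * k)                     ≡⟨ sym (^-distribˡ-+-* n₀ (4 * k) (16 * k)) ⟩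
      n₀ ^ (4 * k + 16 * k)                            ≡⟨ cong (n₀ ^_) (sym (*-distribʳ-+ k 4 16)) ⟩
      n₀ ^ (20 * k)                                    ≡⟨ sym R≡ ⟩
      R                                                ∎
      where
        open ≤-Reasoning
        n≥1 : 1 ≤ n₀
        n≥1 = ≤-trans (s≤s z≤n) 2≤n
        eq : ∀ t → 2 * (t + 24 * t) ≡ 50 * t
        eq = solve-∀
        eq₂ : ∀ n → n * (n * (n * (n * (n * (n * 1))))) * (n * n) ≡ n * (n * (n * (n * (n * (n * (n * (n * 1)))))))
        eq₂ = solve-∀

    -- Bernoulli in the form (1 - p)^R ≤ 1 / (1 + R p), with p ≥ n^(-16k) the success probability of
    -- a trial, read off from the numbers f and g of failing and successful strings.
    failure-bound : ∀ {j} → ℓ ≤ j → j ≤ m₀ → failureSum j * (2 * suc L₀) ≤ 2 ^ Z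
    failure-bound {j} ℓ≤j j≤m = ≤-trans (*-monoˡ-≤ (2 * suc L₀) (trials-failures k j hs m₀ (m₀ + n₀) R)) (*-cancelʳ-≤ _ _ M {{m^n≢0 2 N}} (begin
      f ^ R * (2 * suc L₀) * M              ≡⟨ *-assoc (f ^ R) _ M ⟩
      f ^ R * (2 * suc L₀ * M)              ≤⟨ *-monoʳ-≤ (f ^ R) (≤-trans enough (m≤n+m _ (f + g))) ⟩
      f ^ R * (f + g + R * g)               ≤⟨ bernoulli f g R ⟩
      (f + g) ^ R * (f + g)                 ≡⟨ cong (λ x → x ^ R * x) f+g ⟩
      M ^ R * M                             ≡⟨ cong (_* M) (trans (^-*-assoc 2 N R) (cong (2 ^_) (*-comm N R))) ⟩
      2 ^ Z * M                             ∎))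
      where
        open ≤-Reasoning
        N = (m₀ + n₀) * m₀
        M = 2 ^ N
        lead : Vec Bool N → Bool
        lead u = leads k j hs (m₀ + n₀) u (singles n₀ , j , hs)
        f = ∑ N (λ u → ⟨ not (lead u) ⟩)
        g = ∑ N (λ u → ⟨ lead u ⟩)
        complement : ∀ b → ⟨ not b ⟩ + ⟨ b ⟩ ≡ 1
        complement true  = refl
        complement false = refl
        f+g : f + g ≡ M
        f+g = trans (sym (∑-+ N (λ u → ⟨ not (lead u) ⟩) (λ u → ⟨ lead u ⟩)))
                (trans (∑-cong N (λ u → complement (lead u))) (trans (∑-const N 1) (*-identityʳ M)))
        enough : 2 * suc L₀ * M ≤ R * g
        enough = begin
          2 * suc L₀ * M                            ≤⟨ *-monoʳ-≤ (2 * suc L₀) (success-initial 2≤k m₀ hs P (nonEmpty (proj₁ (proj₁ opt))) ℓ j value≡ optimal ℓ≤j (≤-reflexive len) j≤m) ⟩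
          2 * suc L₀ * (g * n₀ ^ (16 * k))          ≡⟨ eq (2 * suc L₀) g (n₀ ^ (16 * k)) ⟩
          2 * suc L₀ * n₀ ^ (16 * k) * g            ≤⟨ *-monoˡ-≤ g L₀-bound ⟩
          R * g                                     ∎
          where eq : ∀ a b c → a * (b * c) ≡ a * c * b
                eq = solve-∀

    failureSum≤ : ∀ j → failureSum j ≤ 2 ^ Z
    failureSum≤ j = ≤-trans (∑-mono Z (λ u → ⟨⟩≤1 (not (Maybe.is-just (result j u))))) (≤-reflexive (trans (∑-const Z 1) (*-identityʳ _)))

    -- From stage ℓ on, the time of the stages grows by a factor of at most
    -- L₀ + 1, and a stage fails with probability at most 1 / (2 (L₀ + 1)).
    late : ∀ rem j {σ} → ℓ ≤ j → j + length rem ≡ suc m₀ → AtStage j rem σ → Time≤ (while 2 stage ∷ final , σ) (2 * (base * W j)) 1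
    late []        j ℓ≤j e a = time-mono (≤-trans (s≤s (s≤s z≤n)) (*-monoʳ-≤ 2 (*-mono-≤ (≤-trans (s≤s z≤n) base≥16) (bin≥1 L₀ j))))
      (time-⟶ {x = 0} (leave (AtStage.at₂ a)) time-stop)
    late (t ∷ rem) j ℓ≤j e a = time-ratio (m^n>0 2 Z) (begin
        f * (2 * (base * W (suc j))) + own-time j * 2 ^ Z           ≤⟨ +-mono-≤ (*-monoʳ-≤ f (*-monoʳ-≤ 2 (*-monoʳ-≤ base (bin-suc-right L₀ j)))) (*-monoˡ-≤ (2 ^ Z) (own-time≤ j)) ⟩
        f * (2 * (base * (suc L₀ * W j))) + base * W j * 2 ^ Z      ≡⟨ cong (_+ base * W j * 2 ^ Z) (eq₁ f base (suc L₀) (W j)) ⟩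
        f * (2 * suc L₀) * (base * W j) + base * W j * 2 ^ Z        ≤⟨ +-monoˡ-≤ _ (*-monoˡ-≤ (base * W j) (failure-bound ℓ≤j j≤m)) ⟩
        2 ^ Z * (base * W j) + base * W j * 2 ^ Z                   ≡⟨ eq₂ (2 ^ Z) (base * W j) ⟩
        2 * (base * W j) * 2 ^ Z                                    ∎)
      (time-stage (stage-cost j≤m) a (late rem (suc j) (m≤n⇒m≤1+n ℓ≤j) (trans (sym (+-suc j _)) e)))
      where
        open ≤-Reasoning
        f = failureSum j
        j≤m : j ≤ m₀
        j≤m = s≤s⁻¹ (≤-trans (≤-trans (s≤s (m≤m+n j (length rem))) (≤-reflexive (sym (+-suc j _)))) (≤-reflexive e))
        eq₁ : ∀ f b l w → f * (2 * (b * (l * w))) ≡ f * (2 * l) * (b * w)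
        eq₁ = solve-∀
        eq₂ : ∀ z b → z * b + b * z ≡ 2 * b * z
        eq₂ = solve-∀

    W≤ : ∀ {j d} → j + d ≡ ℓ → W j ≤ W ℓ
    W≤ {j} {d} refl = bin-monoʳ L₀ j d

    -- Each of the d stages before ℓ is charged the bound for stage ℓ, since the weights grow with
    -- j. With d ≤ ℓ ≤ m this costs only a factor linear in m.
    early : ∀ d rem j {σ} → j + d ≡ ℓ → j + length rem ≡ suc m₀ → AtStage j rem σ →
      Time≤ (while 2 stage ∷ final , σ) ((2 + d) * (base * W ℓ)) 1
    early zero    rem       j {σ} eℓ e a = subst (λ x → Time≤ (while 2 stage ∷ final , σ) (2 * (base * W x)) 1) j≡ℓ (late rem j (≤-reflexive (sym j≡ℓ)) e a)
      where j≡ℓ = trans (sym (+-identityʳ j)) eℓ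
    early (suc d) []        j eℓ e a = ⊥-elim (<-irrefl refl (begin-strict
        m₀               <⟨ n<1+n m₀ ⟩
        suc m₀           ≡⟨ sym e ⟩
        j + 0            ≡⟨ +-identityʳ j ⟩
        j                ≤⟨ m≤m+n j (suc d) ⟩
        j + suc d        ≡⟨ eℓ ⟩
        ℓ                ≤⟨ ℓ≤m ⟩
        m₀               ∎))
      where open ≤-Reasoning
    early (suc d) (t ∷ rem) j eℓ e a = time-ratio (m^n>0 2 Z) (begin
        f * ((2 + d) * (base * W ℓ)) + own-time j * 2 ^ Z           ≤⟨ +-mono-≤ (*-monoˡ-≤ _ (failureSum≤ j)) (*-monoˡ-≤ (2 ^ Z) (≤-trans (own-time≤ j) (*-monoʳ-≤ base (W≤ eℓ)))) ⟩
        2 ^ Z * ((2 + d) * (base * W ℓ)) + base * W ℓ * 2 ^ Z       ≡⟨ eq (2 ^ Z) d (base * W ℓ) ⟩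
        (2 + suc d) * (base * W ℓ) * 2 ^ Z                          ∎)
      (time-stage (stage-cost j≤m) a (early d rem (suc j) (trans (sym (+-suc j d)) eℓ) (trans (sym (+-suc j _)) e)))
      where
        open ≤-Reasoning
        f = failureSum j
        j≤m : j ≤ m₀
        j≤m = ≤-trans (m≤m+n j (suc d)) (≤-trans (≤-reflexive eℓ) ℓ≤m)
        eq : ∀ z d b → z * ((2 + d) * b) + b * z ≡ (2 + suc d) * b * z
        eq = solve-∀

    Optimal : Config → Set
    Optimal γ = ∃[ D ] Outputs γ D × IsOptimum G k D

    found-optimum : ∀ u bs → result ℓ u ≡ just bs → ∀ {σ} → σ 0 ≡ encodeMaybe (just bs) → Optimal ([] , σ)
    found-optimum u bs e o with D , e′ , p , le ← General.cut-set ℓ u bs e =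
      D , (halted , trans o e′) , p , λ D′ p′ → ≤-trans le (≤-trans (≤-reflexive (sym size≡)) (proj₂ opt D′ p′))

    -- A result of stage j would be a cut-set with at most j < ℓ hedges. For the same reason,
    -- whatever stage ℓ finds is optimum.
    nothing-before : ∀ j → j < ℓ → ∀ u → result j u ≡ nothing
    nothing-before j j<ℓ u = cases (result j u) refl
      where
        cases : ∀ r → result j u ≡ r → r ≡ nothing
        cases nothing   e = refl
        cases (just bs) e with D , _ , p , le ← General.cut-set j u bs e =
          ⊥-elim (<-irrefl refl (≤-trans j<ℓ (≤-trans (≤-reflexive (sym size≡)) (≤-trans (proj₂ opt D p) le))))

    -- Up to the end of stage ℓ the time is bounded on every path, so no Markov inequality is
    -- involved. The probability ½ is that of stage ℓ alone, which fails with probability at most 1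
    -- / (2 (L₀ + 1)).
    finds : ∀ d rem j {σ} → j + d ≡ ℓ → j + length rem ≡ suc m₀ → AtStage j rem σ →
      Likely Optimal (while 2 stage ∷ final , σ) ((1 + d) * (base * W ℓ)) 1 2
    finds d       []        j eℓ e a = ⊥-elim (<-irrefl refl (≤-trans (s≤s (≤-trans (m≤m+n j d) (≤-trans (≤-reflexive eℓ) ℓ≤m))) (≤-reflexive (trans (sym e) (+-identityʳ j)))))
    finds zero    (t ∷ rem) j {σ} eℓ e a = subst (λ j → AtStage j (t ∷ rem) σ → Likely Optimal (while 2 stage ∷ final , σ) (1 * (base * W ℓ)) 1 2) (sym (trans (sym (+-identityʳ j)) eℓ))
      (λ a → likely-mono (≤-trans (own-time≤ ℓ) (≤-reflexive (sym (+-identityʳ _)))) ≤-refl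
        (likely-ratio (subst (1 ≤_) (sym (*-identityʳ (2 ^ Z))) (m^n>0 2 Z)) half
          (likely-stage (stage-cost ℓ≤m) a (λ u bs e o → found-optimum u bs e o)))) a
      where
        f = failureSum ℓ
        2f≤ : 2 * f ≤ 2 ^ Z
        2f≤ = ≤-trans (≤-reflexive (*-comm 2 f)) (≤-trans (*-monoʳ-≤ f (m≤m*n 2 (suc L₀))) (failure-bound ≤-refl ℓ≤m))
        half : 1 * (2 ^ Z * 1) ≤ 2 * (2 ^ Z ∸ f)
        half = begin
          1 * (2 ^ Z * 1)              ≡⟨ trans (*-identityˡ _) (*-identityʳ _) ⟩
          2 ^ Z                        ≡⟨ sym (m+n∸n≡m (2 ^ Z) (2 ^ Z)) ⟩
          2 ^ Z + 2 ^ Z ∸ 2 ^ Z        ≡⟨ cong (λ x → 2 ^ Z + x ∸ 2 ^ Z) (sym (+-identityʳ (2 ^ Z))) ⟩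
          2 * 2 ^ Z ∸ 2 ^ Z            ≤⟨ ∸-monoʳ-≤ (2 * 2 ^ Z) 2f≤ ⟩
          2 * 2 ^ Z ∸ 2 * f            ≡⟨ sym (*-distribˡ-∸ 2 (2 ^ Z) f) ⟩
          2 * (2 ^ Z ∸ f)              ∎
          where open ≤-Reasoning
    finds (suc d) (t ∷ rem) j eℓ e a = likely-mono le ≤-refl
        (likely-ratio (*-mono-≤ (m^n>0 2 Z) (s≤s z≤n)) (≤-reflexive (eq (2 ^ Z)))
          (likely-skip (stage-cost j≤m) a (nothing-before j j<ℓ) (finds d rem (suc j) (trans (sym (+-suc j d)) eℓ) (trans (sym (+-suc j _)) e))))
      where
        j<ℓ : j < ℓ
        j<ℓ = ≤-trans (m<m+n j z<s) (≤-reflexive eℓ)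
        j≤m = ≤-trans (<⇒≤ j<ℓ) ℓ≤m
        le : 14 + ⟦ proj₁ (proj₂ searchP) ⟧ᵖ s * suc (R * suc (W j)) + 6 * Z + (1 + d) * (base * W ℓ) ≤ (1 + suc d) * (base * W ℓ)
        le = +-monoˡ-≤ ((1 + d) * (base * W ℓ)) (≤-trans (≤-trans (+-monoˡ-≤ (6 * Z) (+-monoˡ-≤ (⟦ proj₁ (proj₂ searchP) ⟧ᵖ s * suc (R * suc (W j))) (m≤m+n 14 2))) (own-time≤ j)) (*-monoʳ-≤ base (W≤ eℓ)))
        eq : ∀ z → 1 * (z * 2) ≡ 2 * (z * 1)
        eq = solve-∀

    limit : ℕ
    limit = constant * ((L + ℓ) C ℓ) * n₀ ^ (constant * k) * (m₀ + 1) ^ constant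

    init-time : ℕ
    init-time = 19 + (⟦ proj₁ (proj₂ numberOfTrialsP) ⟧ᵖ s * suc R + ⟦ proj₁ (proj₂ numberOfBitsP) ⟧ᵖ s * suc R)

    init-time≤ : init-time ≤ ⟦ initPoly ⟧ᵖ s * R
    init-time≤ = begin
      19 + (a * suc R + b * suc R)              ≤⟨ +-mono-≤ (m≤m*n 19 R {{>-nonZero R≥1}}) (+-mono-≤ (*-monoʳ-≤ a 1+R) (*-monoʳ-≤ b 1+R)) ⟩
      19 * R + (a * (R + R) + b * (R + R))      ≡⟨ eq a b R ⟩
      (19 + (2 * a + 2 * b)) * R                ∎
      where
        open ≤-Reasoning
        a = ⟦ proj₁ (proj₂ numberOfTrialsP) ⟧ᵖ s
        b = ⟦ proj₁ (proj₂ numberOfBitsP) ⟧ᵖ s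
        1+R = +-monoˡ-≤ R R≥1
        eq : ∀ a b R → 19 * R + (a * (R + R) + b * (R + R)) ≡ (19 + (2 * a + 2 * b)) * R
        eq = solve-∀

    s-bound : s ≤ n₀ ^ 3 * (m₀ + 1)
    s-bound = begin
      m₀ + n₀ + k                      ≤⟨ +-monoʳ-≤ (m₀ + n₀) k≤n ⟩
      m₀ + n₀ + n₀                     ≡⟨ eq₁ m₀ n₀ ⟩
      1 * m₀ + 2 * n₀                  ≤⟨ +-mono-≤ (*-monoˡ-≤ m₀ (m^n>0 n₀ 3)) (≤-trans (*-monoˡ-≤ n₀ (≤-trans 2≤n (m≤m*n n₀ n₀))) (≤-reflexive (eq₃ n₀))) ⟩
      n₀ ^ 3 * m₀ + n₀ ^ 3             ≡⟨ eq₂ (n₀ ^ 3) m₀ ⟩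
      n₀ ^ 3 * (m₀ + 1)                ∎
      where
        open ≤-Reasoning
        eq₁ : ∀ m n → m + n + n ≡ 1 * m + 2 * n
        eq₁ = solve-∀
        eq₂ : ∀ x m → x * m + x ≡ x * (m + 1)
        eq₂ = solve-∀
        eq₃ : ∀ n → n * n * n ≡ n * (n * (n * 1))
        eq₃ = solve-∀

    total≤ : (2 + ℓ) * (base * W ℓ) + init-time ≤ limit
    total≤ = begin
      (2 + ℓ) * (base * W ℓ) + init-time                    ≤⟨ +-monoʳ-≤ ((2 + ℓ) * (base * W ℓ)) (≤-trans init-time≤ (≤-trans (m≤m*n (b * R) (W ℓ) {{>-nonZero (bin≥1 L₀ ℓ)}}) (m≤m+n _ _))) ⟩
      (2 + ℓ) * (a * R * W ℓ) + (2 + ℓ) * (b * R * W ℓ)     ≡⟨ eq₁ (2 + ℓ) a b R (W ℓ) ⟩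
      (2 + ℓ) * ((a + b) * R * W ℓ)                         ≤⟨ *-mono-≤ {2 + ℓ} {2 * (m₀ + 1)} 2+ℓ≤ (*-mono-≤ (*-mono-≤ poly≤ (≤-reflexive R≡)) W≤C) ⟩
      2 * M * (n₀ ^ (3 * E) * M ^ E * n₀ ^ (20 * k) * B)    ≡⟨ eq₂ M (n₀ ^ (3 * E)) (M ^ E) (n₀ ^ (20 * k)) B ⟩
      2 * B * (n₀ ^ (3 * E) * n₀ ^ (20 * k)) * (M * M ^ E)  ≡⟨ cong (λ x → 2 * B * x * (M * M ^ E)) (sym (^-distribˡ-+-* n₀ (3 * E) (20 * k))) ⟩
      2 * B * n₀ ^ (3 * E + 20 * k) * M ^ suc E             ≤⟨ *-mono-≤ (*-mono-≤ (*-monoˡ-≤ B (m≤m+n 2 (45 + 3 * E))) (^-monoʳ-≤ n₀ exponent)) (^-monoʳ-≤ M {{M≢0}} (≤-trans (s≤s (m≤n*m E 3)) (s≤s (m≤n+m (3 * E) 46)))) ⟩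
      constant * B * n₀ ^ (constant * k) * M ^ constant     ∎
      where
        open ≤-Reasoning
        a = ⟦ stagePoly ⟧ᵖ s
        b = ⟦ initPoly ⟧ᵖ s
        E = totalDegree
        M = m₀ + 1
        B = (L + ℓ) C ℓ
        M≢0 : NonZero M
        M≢0 = >-nonZero (m≤n+m 1 m₀)
        2+ℓ≤ : 2 + ℓ ≤ 2 * (m₀ + 1)
        2+ℓ≤ = ≤-trans (+-monoʳ-≤ 2 (≤-trans ℓ≤m (m≤n*m m₀ 2))) (≤-reflexive (eq m₀))
          where eq : ∀ m → 2 + 2 * m ≡ 2 * (m + 1)
                eq = solve-∀
        W≤C : W ℓ ≤ B
        W≤C = ≤-trans (bin-monoˡ ℓ (m⊓n≤m L (24 * k * n₀))) (≤-reflexive (bin-C L ℓ))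
        poly≤ : a + b ≤ n₀ ^ (3 * E) * M ^ E
        poly≤ = begin
          a + b                        ≤⟨ poly-bound (stagePoly ⊕ initPoly) (≤-trans 2≤k k≤s) ⟩
          s ^ E                        ≤⟨ ^-monoˡ-≤ E s-bound ⟩
          (n₀ ^ 3 * M) ^ E             ≡⟨ ^-distribʳ-* (n₀ ^ 3) M E ⟩
          (n₀ ^ 3) ^ E * M ^ E         ≡⟨ cong (_* M ^ E) (^-*-assoc n₀ 3 E) ⟩
          n₀ ^ (3 * E) * M ^ E         ∎
        exponent : 3 * E + 20 * k ≤ constant * k
        exponent = begin
          3 * E + 20 * k               ≤⟨ +-mono-≤ (m≤m*n (3 * E) k {{>-nonZero 1≤k}}) (*-monoˡ-≤ k (m≤m+n 20 27)) ⟩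
          3 * E * k + 47 * k           ≡⟨ +-comm (3 * E * k) _ ⟩
          47 * k + 3 * E * k           ≡⟨ sym (*-distribʳ-+ k 47 (3 * E)) ⟩
          constant * k                 ∎
        eq₁ : ∀ l a b R w → l * (a * R * w) + l * (b * R * w) ≡ l * ((a + b) * R * w)
        eq₁ = solve-∀
        eq₂ : ∀ M x y z B → 2 * M * (x * y * z * B) ≡ 2 * B * (x * z) * (M * y)
        eq₂ = solve-∀

    all-stages : 0 + length (nil ∷ List.map encodeHedge hs) ≡ suc m₀
    all-stages = cong suc (trans (Listₚ.length-map encodeHedge hs) len)

    initialized-input : ∃[ σ ] start algorithm (encodeInput G k) ⟶⟨ init-time ⟩ (while 2 stage ∷ final , σ) × AtStage 0 (nil ∷ List.map encodeHedge hs) σ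
    initialized-input = subst (λ t → ∃[ σ ] start algorithm t ⟶⟨ init-time ⟩ (while 2 stage ∷ final , σ) × AtStage 0 (nil ∷ List.map encodeHedge hs) σ) (sym input≡)
      (initialized {s} {R} ≤-refl (≤-reflexive (sym R≡)))

    expected-time : ExpectedTime≤ (start algorithm (encodeInput G k)) limit
    expected-time N = ≤-trans (≤-reflexive (sym (*-identityˡ _)))
      (Time≤.total-time (time-mono (≤-trans (≤-reflexive (cong ((2 + ℓ) * (base * W ℓ) +_) (*-identityʳ init-time))) total≤)
        (time-⟶ (proj₁ (proj₂ initialized-input)) (early ℓ (nil ∷ List.map encodeHedge hs) 0 refl all-stages (proj₂ (proj₂ initialized-input))))) N)

    finds-optimum : FindsOptimumWithin limit ½ algorithm G k
    finds-optimum = let S , p , q = Likely.event (likely-⟶ (proj₁ (proj₂ initialized-input)) (finds ℓ (nil ∷ List.map encodeHedge hs) 0 refl all-stages (proj₂ (proj₂ initialized-input)))) limit in-time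
      in S , p , half-probability (2 ^ limit) (∑ limit (λ w → if S w then 1 else 0)) (≤-trans (≤-reflexive (sym (*-identityˡ _))) q)
      where
        in-time : init-time + (1 + ℓ) * (base * W ℓ) ≤ limit
        in-time = ≤-trans (≤-trans (≤-reflexive (+-comm init-time _)) (+-monoˡ-≤ init-time (m≤n+m ((1 + ℓ) * (base * W ℓ)) (base * W ℓ)))) total≤

theorem1 : ∃[ A ] ∃[ p ] ∃[ c ] 0ℚ ℚ.< p ×
    (∀ (G : HedgeGraph) (k : ℕ) → 2 ≤ k →
    AlwaysHalts (start A (encodeInput G k)) ×
    Sound A G k ×
    (∀ (ℓ L : ℕ) → OptimumSize G k ℓ → IsFloorLn (n G ^ (c * k)) L →
    let T = c * ((L + ℓ) C ℓ) * n G ^ (c * k) * (m G + 1) ^ c in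
    ExpectedTime≤ (start A (encodeInput G k)) T ×
    FindsOptimumWithin T p A G k))
theorem1 = algorithm , ½ , constant , 0<½ , λ G k 2≤k →
  terminates-halts (Instance.terminates G k 2≤k) , Instance.sound G k 2≤k , λ { ℓ L (C₀ , opt , e) ln →
    Instance.Bounds.expected-time G k 2≤k ℓ L C₀ opt e ln , Instance.Bounds.finds-optimum G k 2≤k ℓ L C₀ opt e ln }
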